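{- Let $K$ be a number field (viewed inside $\mathbb{C}$) and let $A=\begin{pmatrix}a_{11}&a_{12}\\ a_{21}&a_{22}\end{pmatrix}$ be a $2\times2$ matrix over $K$ such that $A^2\in \mathrm{SL}_2(K)$ (so $\det A=\pm1$). Let $\mathcal{C}(A)=A\circ (A^{ -1})^T$ be its combined matrix. In the following, the sign $\pm$ is $+$ if $\det A=1$ and $-$ if $\det A=-1$. Then: 1. $\mathrm{Tr}(\mathcal{C}(A))=\pm 2a_{12}a_{21}+2$. 2. $\det(\mathcal{C}(A))=\mathrm{Tr}(\mathcal{C}(A))-1$. 3. The characteristic polynomial of $\mathcal{C}(A)$ is $p_{\mathcal{C}(A)}(\lambda)=\lambda^2-(\pm2a_{12}a_{21}+2)\lambda\pm2a_{12}a_{21}+1$. 4. The eigenvalues of $\mathcal{C}(A)$ are $\{1,\pm2a_{12}a_{21}+1\}$. 5. The vectors $\begin{pmatrix}1\\1\end{pmatrix},\begin{pmatrix}1\\-1\end{pmatrix}$ form a basis of eigenvectors of $\mathcal{C}(A)$. 6. The Galois group $\mathrm{Gal}(L/K)$ of the characteristic polynomial of $\mathcal{C}(A)$, where $L$ is its splitting field over $K$, is the trivial group. 7. $\mathcal{C}(A)$ is orthogonally diagonalizable: $\mathcal{C}(A)=PDP^T$ with $P=P^T=\dfrac{1}{\sqrt2}\begin{pmatrix}1&1\\1&-1\end{pmatrix}$ and $D=\begin{pmatrix}1&0\\0&\pm2a_{12}a_{21}+1\end{pmatrix}$. Moreover, if $f$ is a function analytic at $1$ and at $\pm2a_{12}a_{21}+1$,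 then $$f(\mathcal{C}(A))=\frac12\begin{pmatrix}1&1\\1&-1\end{pmatrix}\begin{pmatrix}f(1)&0\\0&f(\pm2a_{12}a_{21}+1)\end{pmatrix}\begin{pmatrix}1&1\\1&-1\end{pmatrix}.$$
   Context: A number field is a finite extension of $\mathbb{Q}$. $\circ$ denotes the Hadamard (entrywise) product; the combined matrix of a non-singular matrix $A$ is $\mathcal{C}(A)=A\circ (A^{ -1})^T$. The characteristic polynomial of $M$ is $\det(M-\lambda I_n)$. $f(\mathcal{C}(A))$ is the usual matrix function obtained from the holomorphic functional calculus. -}

module Defs where

open import Level using (Level; _⊔_) renaming (suc to lsuc)
open import Algebra.Bundles using (Semiring; CommutativeRing; Group)
open import Algebra.Bundles.Raw using (RawRing)
open import Algebra.Apartness.Bundles using (HeytingField; HeytingCommutativeRing)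
open import Algebra.Morphism.Structures using (module RingMorphisms)
import Algebra.Definitions
import Algebra.Definitions.RawSemiring as RawSemiringDefinitions
import Algebra.Morphism.Construct.Composition as Composition
import Algebra.Morphism.Construct.Identity as Identity
import Algebra.Properties.Ring as RingProperties
import Algebra.Solver.Ring.NaturalCoefficients.Default as SemiringSolver
open import Data.Fin.Base using (Fin; zero; suc; toℕ; punchIn)
open import Data.Fin.Properties using () renaming (_≟_ to _≟ᶠ_)
open import Data.Integer.Base using (ℤ; +_; -[1+_])
open import Data.List.Base using (List; []; _∷_)
import Data.List.Base as List
open import Data.Nat.Base as ℕ using (ℕ; zero; suc)
open import Data.Product.Base using (Σ; Σ-syntax; ∃; ∃-syntax; _×_; _,_; proj₁; proj₂)
open import Data.Rational.Base using (ℚ; mkℚ; 0ℚ; ½)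
open import Data.Sign.Base as Sign using (Sign)
open import Data.Sum.Base using (_⊎_; inj₁; inj₂)
open import Data.Vec.Functional using (Vector)
open import Function.Bundles using (_⇔_; Equivalence)
open import Relation.Binary.Core using (Rel)
open import Relation.Binary.PropositionalEquality.Core using (_≡_)
import Relation.Binary.Reasoning.Setoid as SetoidReasoning
open import Relation.Binary.Structures using (IsEquivalence; IsStrictPartialOrder)
open import Relation.Nullary.Decidable.Core using (yes; no)
open import Relation.Nullary.Negation.Core using (¬_)
open import Relation.Unary using (Pred; _∈_)

-- The real numbers, given by their characterisation up to isomorphism as the
-- complete Archimedean ordered field.  Classically these axioms are the usual
-- ones (comparability is the tightness of _#_); constructively they are
-- satisfied by the Cauchy reals, Cauchy sequences coming with a modulus.
record Reals (c ℓ₁ ℓ₂ : Level) : Set (lsuc (c ⊔ ℓ₁ ⊔ ℓ₂)) where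
  infix 4 _<_
  field
    heytingField : HeytingField c ℓ₁ ℓ₂

  open HeytingField heytingField public

  commutativeRing : CommutativeRing c ℓ₁
  commutativeRing = HeytingCommutativeRing.commutativeRing heytingCommutativeRing

  open RawSemiringDefinitions (Semiring.rawSemiring (CommutativeRing.semiring commutativeRing)) public
    using () renaming (_×_ to _×#_)

  field
    _<_                  : Rel Carrier ℓ₂
    isStrictPartialOrder : IsStrictPartialOrder _≈_ _<_
    #⇔<⊎>                : ∀ {x y} → (x # y) ⇔ (x < y ⊎ y < x)
    0<1                  : 0# < 1#
    +-monoˡ-<            : ∀ z {x y} → x < y → x + z < y + z
    *-pos                : ∀ {x y} → 0# < x → 0# < y → 0# < x * y
    archimedean          : ∀ x → ∃[ n ] x < n ×# 1#

  infix 4 _within_of_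
  _within_of_ : Carrier → Carrier → Carrier → Set ℓ₂
  x within ε of y = y - ε < x × x < y + ε

  IsCauchy : (ℕ → Carrier) → Set (c ⊔ ℓ₂)
  IsCauchy s = ∀ ε → 0# < ε → ∃[ N ] ∀ m n → N ℕ.≤ m → N ℕ.≤ n → s m within ε of s n

  IsLimit : (ℕ → Carrier) → Carrier → Set (c ⊔ ℓ₂)
  IsLimit s l = ∀ ε → 0# < ε → ∃[ N ] ∀ n → N ℕ.≤ n → s n within ε of l

  field
    complete : ∀ s → IsCauchy s → ∃ (IsLimit s)

  open IsStrictPartialOrder isStrictPartialOrder public
    using (<-respʳ-≈; <-respˡ-≈) renaming (trans to <-trans)

  recip : ∀ x → 0# < x → Carrier
  recip x 0<x = proj₁ (#⇒invertible (Equivalence.from #⇔<⊎> (inj₂ 0<x)))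

  0<suc : ∀ n → 0# < suc n ×# 1#
  0<suc zero    = <-respʳ-≈ (sym (+-identityʳ 1#)) 0<1
  0<suc (suc n) =
    <-trans (0<suc n) (<-respˡ-≈ (+-identityˡ _) (+-monoˡ-< (suc n ×# 1#) 0<1))

  fromℤ : ℤ → Carrier
  fromℤ (+ n)    = n ×# 1#
  fromℤ -[1+ n ] = - (suc n ×# 1#)

  fromℚ : ℚ → Carrier
  fromℚ (mkℚ p d-1 _) = fromℤ p * recip (suc d-1 ×# 1#) (0<suc d-1)

module Polynomials {c ℓ} (R : RawRing c ℓ) where
  open RawRing R

  -- Coefficients in order of increasing degree; trailing zeros are allowed.
  Poly : Set c
  Poly = List Carrier

  coeff : Poly → ℕ → Carrier
  coeff []      _       = 0#
  coeff (a ∷ p) zero    = a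
  coeff (a ∷ p) (suc k) = coeff p k

  infix 4 _≈ₚ_
  _≈ₚ_ : Rel Poly ℓ
  p ≈ₚ q = ∀ k → coeff p k ≈ coeff q k

  infixl 6 _+ₚ_
  _+ₚ_ : Poly → Poly → Poly
  []      +ₚ q       = q
  (a ∷ p) +ₚ []      = a ∷ p
  (a ∷ p) +ₚ (b ∷ q) = a + b ∷ p +ₚ q

  infixl 7 _*ₚ_
  _*ₚ_ : Poly → Poly → Poly
  []      *ₚ q = []
  (a ∷ p) *ₚ q = List.map (a *_) q +ₚ (0# ∷ p *ₚ q)

  const : Carrier → Poly
  const a = a ∷ []

  X : Poly
  X = 0# ∷ 1# ∷ []

  polyRing : RawRing c ℓ
  polyRing = record
    { Carrier = Poly
    ; _≈_     = _≈ₚ_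
    ; _+_     = _+ₚ_
    ; _*_     = _*ₚ_
    ; -_      = List.map (-_)
    ; 0#      = []
    ; 1#      = const 1#
    }

module Matrices {c ℓ} (R : RawRing c ℓ) where
  open RawRing R
  open RawSemiringDefinitions rawSemiring using (sum; _^_)

  Matrix : ℕ → Set c
  Matrix n = Fin n → Fin n → Carrier

  infix 4 _≋_
  _≋_ : ∀ {n} → Rel (Matrix n) ℓ
  A ≋ B = ∀ i j → A i j ≈ B i j

  1ᴹ : ∀ {n} → Matrix n
  1ᴹ i j with i ≟ᶠ j
  ... | yes _ = 1#
  ... | no  _ = 0#

  infixl 6 _-ᴹ_
  _-ᴹ_ : ∀ {n} → Matrix n → Matrix n → Matrix n
  (A -ᴹ B) i j = A i j + - B i j

  infixl 7 _*ᴹ_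
  _*ᴹ_ : ∀ {n} → Matrix n → Matrix n → Matrix n
  (A *ᴹ B) i j = sum λ k → A i k * B k j

  infixr 8 _·ᴹ_
  _·ᴹ_ : ∀ {n} → Carrier → Matrix n → Matrix n
  (a ·ᴹ A) i j = a * A i j

  infixr 8 _·ᵛ_
  _·ᵛ_ : ∀ {n} → Matrix n → Vector Carrier n → Vector Carrier n
  (A ·ᵛ v) i = sum λ k → A i k * v k

  infixl 7 _∘ᴹ_
  _∘ᴹ_ : ∀ {n} → Matrix n → Matrix n → Matrix n
  (A ∘ᴹ B) i j = A i j * B i j

  infixl 9 _ᵀ
  _ᵀ : ∀ {n} → Matrix n → Matrix n
  (A ᵀ) i j = A j i

  tr : ∀ {n} → Matrix n → Carrier
  tr A = sum λ i → A i i

  det : ∀ {n} → Matrix n → Carrier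
  det {zero}  A = 1#
  det {suc n} A =
    sum λ j → (- 1#) ^ toℕ j * A zero j * det λ k l → A (suc k) (punchIn j l)

  ⟦_,_∣_,_⟧ : Carrier → Carrier → Carrier → Carrier → Matrix 2
  ⟦ a , b ∣ c , d ⟧ zero       zero       = a
  ⟦ a , b ∣ c , d ⟧ zero       (suc zero) = b
  ⟦ a , b ∣ c , d ⟧ (suc zero) zero       = c
  ⟦ a , b ∣ c , d ⟧ (suc zero) (suc zero) = d

  vec₂ : Carrier → Carrier → Vector Carrier 2
  vec₂ a b zero       = a
  vec₂ a b (suc zero) = b

  Invertible : ∀ {n} → Matrix n → Set (c ⊔ ℓ)
  Invertible = Algebra.Definitions.Invertible _≋_ 1ᴹ _*ᴹ_

  𝒞 : ∀ {n} (A : Matrix n) → Invertible A → Matrix n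
  𝒞 A (A⁻¹ , _) = A ∘ᴹ A⁻¹ ᵀ

module CharacteristicPolynomial {c ℓ} (R : RawRing c ℓ) where
  open Polynomials R
  open Matrices R using (Matrix)
  open Matrices polyRing using (det; _·ᴹ_; _-ᴹ_; 1ᴹ)

  charPoly : ∀ {n} → Matrix n → Poly
  charPoly M = det ((λ i j → const (M i j)) -ᴹ X ·ᴹ 1ᴹ)

private
  module CommutativeRingLemmas {c ℓ} (R : CommutativeRing c ℓ) where
    open CommutativeRing R
    open RingProperties ring using (-‿distribˡ-*; -‿distribʳ-*; -‿involutive)
    open SemiringSolver commutativeSemiring using (solve; _:=_; _:+_; _:*_; con)
    open SetoidReasoning setoid

    cancel : ∀ p x → p + x - p ≈ x
    cancel p x = begin
      p + x - p    ≈⟨ +-congʳ (+-comm p x) ⟩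
      x + p - p    ≈⟨ +-assoc x p _ ⟩
      x + (p - p)  ≈⟨ +-congˡ (-‿inverseʳ p) ⟩
      x + 0#       ≈⟨ +-identityʳ x ⟩
      x            ∎

    neg-square : ∀ b → - b * - b ≈ b * b
    neg-square b = begin
      - b * - b    ≈⟨ -‿distribˡ-* b (- b) ⟨
      - (b * - b)  ≈⟨ -‿cong (-‿distribʳ-* b b) ⟨
      - - (b * b)  ≈⟨ -‿involutive _ ⟩
      b * b        ∎

    two-squares : ∀ a b x y →
      (a * x - b * y) * (a * x - b * y) + (a * y + b * x) * (a * y + b * x)
      ≈ (a * a + b * b) * (x * x + y * y)
    two-squares a b x y = begin
      (a * x - b * y) * (a * x - b * y) + v * v
        ≈⟨ +-congʳ (*-cong (+-congˡ (-‿distribˡ-* b y)) (+-congˡ (-‿distribˡ-* b y))) ⟩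
      (a * x + - b * y) * (a * x + - b * y) + v * v
        ≈⟨ solve 5 (λ a b b′ x y →
             (a :* x :+ b′ :* y) :* (a :* x :+ b′ :* y) :+
             (a :* y :+ b :* x) :* (a :* y :+ b :* x)
             := (a :* a) :* (x :* x :+ y :* y) :+ (b :* b) :* (x :* x) :+
                (b′ :* b′) :* (y :* y) :+ (a :* x :* y :+ a :* x :* y) :* (b :+ b′))
             refl a b (- b) x y ⟩
      (a * a) * (x * x + y * y) + (b * b) * (x * x) + (- b * - b) * (y * y) + w * (b - b)
        ≈⟨ +-cong (+-congˡ (*-congʳ (neg-square b)))
             (trans (*-congˡ (-‿inverseʳ b)) (zeroʳ w)) ⟩
      (a * a) * (x * x + y * y) + (b * b) * (x * x) + (b * b) * (y * y) + 0#
        ≈⟨ solve 4 (λ a b x y →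
             (a :* a) :* (x :* x :+ y :* y) :+ (b :* b) :* (x :* x) :+
             (b :* b) :* (y :* y) :+ con 0
             := (a :* a :+ b :* b) :* (x :* x :+ y :* y)) refl a b x y ⟩
      (a * a + b * b) * (x * x + y * y) ∎
      where
      v = a * y + b * x
      w = a * x * y + a * x * y

module Complex {c ℓ₁ ℓ₂} (Rl : Reals c ℓ₁ ℓ₂) where
  private module ℝ = Reals Rl

  ℝ : Set c
  ℝ = ℝ.Carrier

  infix 5 _+i_
  record ℂ : Set c where
    constructor _+i_
    field
      re im : ℝ
  open ℂ public

  ℂ-rawRing : RawRing c ℓ₁
  ℂ-rawRing = record
    { Carrier = ℂ
    ; _≈_     = λ z w → re z ℝ.≈ re w × im z ℝ.≈ im w
    ; _+_     = λ z w → re z ℝ.+ re w +i im z ℝ.+ im w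
    ; _*_     = λ z w → re z ℝ.* re w ℝ.- im z ℝ.* im w +i re z ℝ.* im w ℝ.+ im z ℝ.* re w
    ; -_      = λ z → ℝ.- re z +i ℝ.- im z
    ; 0#      = ℝ.0# +i ℝ.0#
    ; 1#      = ℝ.1# +i ℝ.0#
    }

  open RawRing ℂ-rawRing public hiding (Carrier)
  open RawSemiringDefinitions rawSemiring public using (sum; _^_)
  open Polynomials ℂ-rawRing public
  open Matrices ℂ-rawRing public
  open CharacteristicPolynomial ℂ-rawRing public

  ≈-isEquivalence : IsEquivalence _≈_
  ≈-isEquivalence = record
    { refl  = ℝ.refl , ℝ.refl
    ; sym   = λ (p , q) → ℝ.sym p , ℝ.sym q
    ; trans = λ (p , q) (p′ , q′) → ℝ.trans p p′ , ℝ.trans q q′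
    }

  private
    module ≈ = IsEquivalence ≈-isEquivalence

    +-cong : ∀ {x y u v} → x ≈ y → u ≈ v → x + u ≈ y + v
    +-cong (p , q) (p′ , q′) = ℝ.+-cong p p′ , ℝ.+-cong q q′

    -‿cong : ∀ {x y} → x ≈ y → - x ≈ - y
    -‿cong (p , q) = ℝ.-‿cong p , ℝ.-‿cong q

    *-cong : ∀ {x y u v} → x ≈ y → u ≈ v → x * u ≈ y * v
    *-cong (p , q) (p′ , q′) =
      ℝ.+-cong (ℝ.*-cong p p′) (ℝ.-‿cong (ℝ.*-cong q q′)) ,
      ℝ.+-cong (ℝ.*-cong p q′) (ℝ.*-cong q p′)

  infixl 6 _-_
  _-_ : ℂ → ℂ → ℂ
  z - w = z + - w

  infix 4 _#_
  _#_ : Rel ℂ ℓ₂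
  z # w = re z ℝ.# re w ⊎ im z ℝ.# im w

  fromℝ : ℝ → ℂ
  fromℝ x = x +i ℝ.0#

  fromℚ : ℚ → ℂ
  fromℚ q = fromℝ (ℝ.fromℚ q)

  2# : ℂ
  2# = 1# + 1#

  fromSign : Sign → ℂ
  fromSign Sign.+ = 1#
  fromSign Sign.- = - 1#

  -- The square of the modulus; metric notions are stated with squares.
  ∣_∣² : ℂ → ℝ
  ∣ z ∣² = re z ℝ.* re z ℝ.+ im z ℝ.* im z

  infix 4 _⟶_
  _⟶_ : (ℕ → ℂ) → ℂ → Set (c ⊔ ℓ₂)
  s ⟶ l = ∀ ε → ℝ.0# ℝ.< ε → ∃[ N ] ∀ n → N ℕ.≤ n → ∣ s n - l ∣² ℝ.< ε ℝ.* ε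

  Disc : ℂ → ℝ → Pred ℂ ℓ₂
  Disc a r z = ∣ z - a ∣² ℝ.< r ℝ.* r

  Circle : ℂ → ℝ → Pred ℂ ℓ₁
  Circle a r z = ∣ z - a ∣² ℝ.≈ r ℝ.* r

  NonZeroVector : ∀ {n} → Pred (Vector ℂ n) ℓ₂
  NonZeroVector v = ∃[ i ] v i # 0#

  IsEigenpair : ∀ {n} → Matrix n → ℂ → Vector ℂ n → Set (ℓ₁ ⊔ ℓ₂)
  IsEigenpair M λ′ v = NonZeroVector v × (∀ i → (M ·ᵛ v) i ≈ λ′ * v i)

  IsEigenvalue : ∀ {n} → Matrix n → ℂ → Set (c ⊔ ℓ₁ ⊔ ℓ₂)
  IsEigenvalue M λ′ = ∃[ v ] IsEigenpair M λ′ v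

  IsEigenvector : ∀ {n} → Matrix n → Vector ℂ n → Set (c ⊔ ℓ₁ ⊔ ℓ₂)
  IsEigenvector M v = ∃[ λ′ ] IsEigenpair M λ′ v

  record IsSubfield {p} (P : Pred ℂ p) : Set (c ⊔ ℓ₁ ⊔ p) where
    field
      resp : ∀ {z w} → z ≈ w → z ∈ P → w ∈ P
      0∈   : 0# ∈ P
      1∈   : 1# ∈ P
      +∈   : ∀ {z w} → z ∈ P → w ∈ P → z + w ∈ P
      *∈   : ∀ {z w} → z ∈ P → w ∈ P → z * w ∈ P
      -∈   : ∀ {z} → z ∈ P → - z ∈ P
      inv∈ : ∀ {z} → z ∈ P → ¬ (z ≈ 0#) → ∃[ w ] w ∈ P × z * w ≈ 1#

  SL : ∀ {p} n → Pred ℂ p → Pred (Matrix n) (ℓ₁ ⊔ p)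
  SL n P A = (∀ i j → A i j ∈ P) × det A ≈ 1#

  record Subfield (p : Level) : Set (c ⊔ ℓ₁ ⊔ lsuc p) where
    field
      Member     : Pred ℂ p
      isSubfield : IsSubfield Member
    open IsSubfield isSubfield public

    rawRing : RawRing (c ⊔ p) ℓ₁
    rawRing = record
      { Carrier = Σ ℂ Member
      ; _≈_     = λ z w → proj₁ z ≈ proj₁ w
      ; _+_     = λ z w → proj₁ z + proj₁ w , +∈ (proj₂ z) (proj₂ w)
      ; _*_     = λ z w → proj₁ z * proj₁ w , *∈ (proj₂ z) (proj₂ w)
      ; -_      = λ z → - proj₁ z , -∈ (proj₂ z)
      ; 0#      = 0# , 0∈
      ; 1#      = 1# , 1∈
      }

  open Subfield using (Member) public

  record NumberField (p : Level) : Set (c ⊔ ℓ₁ ⊔ lsuc p) where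
    field
      subfield    : Subfield p
      degree      : ℕ
      basis       : Vector ℂ degree
      basis∈      : ∀ i → basis i ∈ Member subfield
      spanning    : ∀ {z} → z ∈ Member subfield →
                    Σ[ q ∈ Vector ℚ degree ] z ≈ sum (λ i → fromℚ (q i) * basis i)
      independent : ∀ (q : Vector ℚ degree) →
                    sum (λ i → fromℚ (q i) * basis i) ≈ 0# → ∀ i → q i ≡ 0ℚ

  module _ {k} (K : Subfield k) where

    record IsBasis {n m} (b : Vector (Vector ℂ n) m) : Set (c ⊔ ℓ₁ ⊔ k) where
      field
        over        : ∀ j i → b j i ∈ Member K
        spanning    : ∀ (v : Vector ℂ n) → (∀ i → v i ∈ Member K) →
                      Σ[ a ∈ Vector ℂ m ] (∀ j → a j ∈ Member K) ×
                                          (∀ i → v i ≈ sum λ j → a j * b j i)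
        independent : ∀ (a : Vector ℂ m) → (∀ j → a j ∈ Member K) →
                      (∀ i → sum (λ j → a j * b j i) ≈ 0#) → ∀ j → a j ≈ 0#

    data Adjoin {m} (S : Vector ℂ m) : ℂ → Set (c ⊔ ℓ₁ ⊔ k) where
      base : ∀ {z} → z ∈ Member K → Adjoin S z
      gen  : ∀ i → Adjoin S (S i)
      resp : ∀ {z w} → z ≈ w → Adjoin S z → Adjoin S w
      add  : ∀ {z w} → Adjoin S z → Adjoin S w → Adjoin S (z + w)
      mul  : ∀ {z w} → Adjoin S z → Adjoin S w → Adjoin S (z * w)
      neg  : ∀ {z} → Adjoin S z → Adjoin S (- z)
      inv  : ∀ {z w} → Adjoin S z → z * w ≈ 1# → Adjoin S w

    record IsSplittingField (p : Poly) {l} (L : Subfield l) : Set (c ⊔ ℓ₁ ⊔ k ⊔ l) where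
      field
        K⊆L       : ∀ {z} → z ∈ Member K → z ∈ Member L
        leading   : ℂ
        leading∈  : leading ∈ Member K
        leading≉0 : ¬ (leading ≈ 0#)
        count     : ℕ
        roots     : Vector ℂ count
        roots∈    : ∀ i → roots i ∈ Member L
        splits    : p ≈ₚ const leading *ₚ
                         RawSemiringDefinitions.product (RawRing.rawSemiring polyRing)
                           (λ i → X +ₚ const (- roots i))
        generated : ∀ {z} → z ∈ Member L → Adjoin roots z

  module _ {k l} (K : Subfield k) (L : Subfield l) where
    private
      module L = RawRing (Subfield.rawRing L)
      open RingMorphisms (Subfield.rawRing L) (Subfield.rawRing L)

      ≈ᴸ-trans : ∀ {x y z} → x L.≈ y → y L.≈ z → x L.≈ z
      ≈ᴸ-trans = ≈.trans

    record KAutomorphism : Set (c ⊔ ℓ₁ ⊔ k ⊔ l) where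
      field
        map                : L.Carrier → L.Carrier
        isRingIsomorphism  : IsRingIsomorphism map
        fixes              : ∀ x → proj₁ x ∈ Member K → map x L.≈ x
      open IsRingIsomorphism isRingIsomorphism public

    open KAutomorphism using (map; fixes; isRingIsomorphism)

    private
      idᴬ : KAutomorphism
      idᴬ = record
        { map               = λ x → x
        ; isRingIsomorphism = Identity.isRingIsomorphism (Subfield.rawRing L) ≈.refl
        ; fixes             = λ _ _ → ≈.refl
        }

      _∘ᴬ_ : KAutomorphism → KAutomorphism → KAutomorphism
      σ ∘ᴬ τ = record
        { map               = λ x → map σ (map τ x)
        ; isRingIsomorphism =
            Composition.isRingIsomorphism (λ {x} {y} {z} → ≈ᴸ-trans {x} {y} {z})
              (isRingIsomorphism τ) (isRingIsomorphism σ)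
        ; fixes             = λ x x∈K →
            ≈.trans (KAutomorphism.⟦⟧-cong σ {map τ x} {x} (fixes τ x x∈K)) (fixes σ x x∈K)
        }

      module Inverse (σ : KAutomorphism) where
        open KAutomorphism σ using (surjective; injective; ⟦⟧-cong; +-homo; *-homo; -‿homo; 0#-homo; 1#-homo)

        inverse : L.Carrier → L.Carrier
        inverse y = proj₁ (surjective y)

        inverseʳ : ∀ y → map σ (inverse y) L.≈ y
        inverseʳ y = proj₂ (surjective y) ≈.refl

        unique : ∀ {x y} → map σ x L.≈ y → inverse y L.≈ x
        unique {x} {y} p = injective (≈.trans (inverseʳ y) (≈.sym p))

        inverseᴬ : KAutomorphism
        inverseᴬ = record
          { map               = inverse
          ; isRingIsomorphism = record
            { isRingMonomorphism = record
              { isRingHomomorphism = record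
                { isSemiringHomomorphism = record
                  { isNearSemiringHomomorphism = record
                    { +-isMonoidHomomorphism = record
                      { isMagmaHomomorphism = record
                        { isRelHomomorphism = record
                          { cong = λ {x} {y} x≈y → unique (≈.trans (inverseʳ y) (≈.sym x≈y)) }
                        ; homo = λ x y → unique (≈.trans (+-homo _ _)
                            (+-cong (inverseʳ x) (inverseʳ y)))
                        }
                      ; ε-homo = unique 0#-homo
                      }
                    ; *-homo = λ x y → unique (≈.trans (*-homo _ _)
                        (*-cong (inverseʳ x) (inverseʳ y)))
                    }
                  ; 1#-homo = unique 1#-homo
                  }
                ; -‿homo = λ x → unique (≈.trans (-‿homo _) (-‿cong (inverseʳ x)))
                }
              ; injective = λ {x} {y} p →
                  ≈.trans (≈.sym (inverseʳ x)) (≈.trans (⟦⟧-cong p) (inverseʳ y))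
              }
            ; surjective = λ x → map σ x , λ p → unique (≈.sym p)
            }
          ; fixes = λ x x∈K → unique (fixes σ x x∈K)
          }

    Gal : Group (c ⊔ ℓ₁ ⊔ k ⊔ l) (c ⊔ ℓ₁ ⊔ l)
    Gal = record
      { Carrier = KAutomorphism
      ; _≈_     = λ σ τ → ∀ x → map σ x L.≈ map τ x
      ; _∙_     = _∘ᴬ_
      ; ε       = idᴬ
      ; _⁻¹     = Inverse.inverseᴬ
      ; isGroup = record
        { isMonoid = record
          { isSemigroup = record
            { isMagma = record
              { isEquivalence = record
                { refl  = λ _ → ≈.refl
                ; sym   = λ p x → ≈.sym (p x)
                ; trans = λ p q x → ≈.trans (p x) (q x)
                }
              ; ∙-cong = λ {σ} p q x → ≈.trans (KAutomorphism.⟦⟧-cong σ (q x)) (p _)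
              }
            ; assoc = λ _ _ _ _ → ≈.refl
            }
          ; identity = (λ _ _ → ≈.refl) , (λ _ _ → ≈.refl)
          }
        ; inverse = (λ σ x → Inverse.unique σ ≈.refl) , (λ σ x → Inverse.inverseʳ σ x)
        ; ⁻¹-cong = λ {σ} {τ} p x →
            Inverse.unique σ (≈.trans (p _) (Inverse.inverseʳ τ x))
        }
      }

  record PartialFunction (d : Level) : Set (c ⊔ ℓ₁ ⊔ lsuc d) where
    field
      Dom : Pred ℂ d
      fun : ∀ z → z ∈ Dom → ℂ
      fun-cong : ∀ {z w} (z∈ : z ∈ Dom) (w∈ : w ∈ Dom) → z ≈ w → fun z z∈ ≈ fun w w∈

  module _ {d} (f : PartialFunction d) where
    open PartialFunction f

    ExpandsOn : ℂ → ℝ → Set (c ⊔ ℓ₂ ⊔ d)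
    ExpandsOn a r = Σ[ coef ∈ (ℕ → ℂ) ] ∀ z → z ∈ Disc a r →
      Σ[ z∈ ∈ z ∈ Dom ]
        (λ n → sum {n} λ k → coef (toℕ k) * (z - a) ^ toℕ k) ⟶ fun z z∈

    record AnalyticAt (a : ℂ) : Set (c ⊔ ℓ₂ ⊔ d) where
      field
        a∈       : a ∈ Dom
        radius   : ℝ
        0<radius : ℝ.0# ℝ.< radius
        expands  : ExpandsOn a radius

      value : ℂ
      value = fun a a∈

  -- ζ m is a primitive 2ᵐ-th root of unity, so its powers divide the unit
  -- circle into 2ᵐ equal arcs.
  record DyadicRoots : Set (c ⊔ ℓ₁) where
    field
      ζ        : ℕ → ℂ
      ∣ζ∣≈1    : ∀ m → ∣ ζ m ∣² ℝ.≈ ℝ.1#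
      ζ-zero   : ζ 0 ≈ 1#
      ζ-one    : ζ 1 ≈ - 1#
      ζ-square : ∀ m → ζ (suc m) * ζ (suc m) ≈ ζ m

  private
    open CommutativeRingLemmas ℝ.commutativeRing
    open SetoidReasoning (CommutativeRing.setoid ℝ.commutativeRing)

    ∣∣²-cong : ∀ z w → z ≈ w → ∣ z ∣² ℝ.≈ ∣ w ∣²
    ∣∣²-cong _ _ (p , q) = ℝ.+-cong (ℝ.*-cong p p) (ℝ.*-cong q q)

    ∣*∣² : ∀ z w → ∣ z * w ∣² ℝ.≈ ∣ z ∣² ℝ.* ∣ w ∣²
    ∣*∣² (a +i b) (x +i y) = two-squares a b x y

    ∣fromℝ∣² : ∀ ρ → ∣ fromℝ ρ ∣² ℝ.≈ ρ ℝ.* ρ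
    ∣fromℝ∣² ρ = ℝ.trans (ℝ.+-congˡ (ℝ.zeroˡ _)) (ℝ.+-identityʳ _)

    add-sub : ∀ a u → a + u - a ≈ u
    add-sub a u = cancel (re a) (re u) , cancel (im a) (im u)

  module _ (roots : DyadicRoots) where
    open DyadicRoots roots

    private
      ∣ζ^∣² : ∀ m k → ∣ ζ m ^ k ∣² ℝ.≈ ℝ.1#
      ∣ζ^∣² m zero    = ℝ.trans (∣fromℝ∣² ℝ.1#) (ℝ.*-identityˡ ℝ.1#)
      ∣ζ^∣² m (suc k) = ℝ.trans (∣*∣² (ζ m) (ζ m ^ k))
        (ℝ.trans (ℝ.*-cong (∣ζ∣≈1 m) (∣ζ^∣² m k)) (ℝ.*-identityˡ ℝ.1#))

    node : ℂ → ℝ → ∀ m → Fin (2 ℕ.^ m) → ℂ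
    node a ρ m k = a + fromℝ ρ * ζ m ^ toℕ k

    node∈Circle : ∀ a ρ m k → node a ρ m k ∈ Circle a ρ
    node∈Circle a ρ m k = begin
      ∣ a + fromℝ ρ * w - a ∣²
        ≈⟨ ∣∣²-cong (a + fromℝ ρ * w - a) (fromℝ ρ * w) (add-sub a (fromℝ ρ * w)) ⟩
      ∣ fromℝ ρ * w ∣²          ≈⟨ ∣*∣² (fromℝ ρ) w ⟩
      ∣ fromℝ ρ ∣² ℝ.* ∣ w ∣²   ≈⟨ ℝ.*-cong (∣fromℝ∣² ρ) (∣ζ^∣² m (toℕ k)) ⟩
      ρ ℝ.* ρ ℝ.* ℝ.1#          ≈⟨ ℝ.*-identityʳ _ ⟩
      ρ ℝ.* ρ                   ∎
      where w = ζ m ^ toℕ k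

    -- Since dz = i (z - a) dθ on the circle z = a + ρ exp (iθ),
    --   (1 / 2πi) ∮ g(z) dz = (1 / 2π) ∫₀²ᵖⁱ g(z) (z - a) dθ,
    -- and this is its Riemann sum for the division into 2ᵐ equal arcs.
    circleSum : ∀ {n} a ρ → (∀ z → z ∈ Circle a ρ → Matrix n) → ℕ → Matrix n
    circleSum a ρ g m i j = fromℚ ½ ^ m * sum λ k →
      (node a ρ m k - a) * g (node a ρ m k) (node∈Circle a ρ m k) i j

  module _ {n d} (f : PartialFunction d) (M : Matrix n) where
    open PartialFunction f

    -- A contour around the spectrum of M: disjoint circles about the distinct
    -- eigenvalues, f being analytic on discs strictly containing them.
    record Contour : Set (c ⊔ ℓ₁ ⊔ ℓ₂ ⊔ d) where
      field
        size      : ℕ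
        centre    : Vector ℂ size
        spectrum  : ∀ z → IsEigenvalue M z ⇔ (∃[ i ] z ≈ centre i)
        radius    : Vector ℝ size
        0<radius  : ∀ i → ℝ.0# ℝ.< radius i
        disjoint  : ∀ {i j} → ¬ (i ≡ j) →
                    (radius i ℝ.+ radius j) ℝ.* (radius i ℝ.+ radius j)
                      ℝ.< ∣ centre i - centre j ∣²
        analytic  : ∀ i → ∃[ r ] radius i ℝ.< r × ExpandsOn f (centre i) r
        ⊆Dom      : ∀ i z → z ∈ Circle (centre i) (radius i) → z ∈ Dom
        resolvent : ∀ i z → z ∈ Circle (centre i) (radius i) → Invertible (z ·ᴹ 1ᴹ -ᴹ M)

      integrand : ∀ i z → z ∈ Circle (centre i) (radius i) → Matrix n
      integrand i z z∈ = fun z (⊆Dom i z z∈) ·ᴹ proj₁ (resolvent i z z∈)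

      riemannSum : DyadicRoots → ℕ → Matrix n
      riemannSum roots m j k =
        sum λ i → circleSum roots (centre i) (radius i) (integrand i) m j k

    IsContourIntegral : DyadicRoots → Contour → Matrix n → Set (c ⊔ ℓ₂)
    IsContourIntegral ζ Γ X = ∀ j k → (λ m → Contour.riemannSum Γ ζ m j k) ⟶ X j k

    -- X is f(M) in the sense of the holomorphic functional calculus,
    --   f(M) = (1 / 2πi) ∮ f(z) (z - M)⁻¹ dz.
    IsMatrixFunction : Matrix n → Set (c ⊔ ℓ₁ ⊔ ℓ₂ ⊔ d)
    IsMatrixFunction X = DyadicRoots × Contour × (∀ ζ Γ → IsContourIntegral ζ Γ X)

{-# OPTIONS --safe #-}
module Submission where

-- With s = det A = ±1 and t = 2 s a₁₂ a₂₁, Cramer's rule gives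
-- 𝒞(A) = [p q; q p] where p + q = 1 and p - q = t + 1, so everything algebraic
-- follows from the eigenvectors (1,1) and (1,-1).  The constructive case
-- distinctions rest on two facts: a number field has decidable equality, since
-- its elements are determined by rational coordinates, and the apartness of ℂ
-- is cotransitive.
--
-- For the functional calculus, (z - M)⁻¹ is a combination of 1/(z - 1) and
-- 1/(z - (t + 1)), so each Riemann sum is a combination of means of
-- f(z) (z - a)/(z - μ) over the 2ᵐ-th roots of unity on a circle about a.  A
-- power of z - a whose exponent is positive and below 2ᵐ has mean 0, and f is a
-- uniform limit of polynomials in z - a, so the mean tends to f(a) if μ = a.
-- If μ lies outside the circle, 1/(z - μ) expands into a geometric series in
-- z - a, and the factor z - a makes the mean tend to 0.

open import Defs
open import Level using (Level; 0ℓ; _⊔_)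
open import Algebra.Bundles using (CommutativeRing; Group; RawRing)
import Algebra.Definitions.RawSemiring as RawSemiringDefinitions
import Algebra.Properties.CommutativeMonoid.Sum
import Algebra.Properties.CommutativeSemigroup
import Algebra.Properties.CommutativeSemiring.Exp
import Algebra.Properties.Ring
import Algebra.Properties.Semiring.Exp
import Algebra.Properties.Semiring.Mult
import Algebra.Properties.Semiring.Mult.TCOptimised
import Algebra.Properties.Semiring.Sum
import Algebra.Solver.Ring
open import Algebra.Solver.Ring.AlmostCommutativeRing using (_-Raw-AlmostCommutative⟶_; fromCommutativeRing)
open import Algebra.Structures using (IsCommutativeRing)
open import Data.Empty using (⊥-elim)
open import Data.Fin.Base using (Fin; zero; suc; toℕ)
open import Data.Fin.Patterns using (0F; 1F)
import Data.Fin.Properties as Fin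
open import Data.Integer.Base as ℤ using (ℤ; +_; -[1+_])
import Data.Integer.Properties as ℤ
open import Data.List.Base as List using ([]; _∷_)
open import Data.Maybe.Base using (Maybe; just; nothing)
open import Data.Nat.Base as ℕ using (ℕ; zero; suc)
import Data.Nat.Properties as ℕ
open import Data.Product.Base using (Σ-syntax; ∃-syntax; _×_; _,_; proj₁; proj₂)
open import Data.Rational.Base using (½; 0ℚ)
import Data.Rational.Properties as ℚ
open import Data.Sign.Base as Sign using (Sign)
open import Data.Sum.Base using (_⊎_; inj₁; inj₂; [_,_]′; map)
open import Data.Vec.Functional using () renaming ([] to []ᵛ; _∷_ to _∷ᵛ_)
open import Function.Base using (_$_)
open import Function.Bundles using (_⇔_; mk⇔; Equivalence)
open import Relation.Binary.PropositionalEquality.Core as ≡ using (_≡_)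
import Relation.Binary.Reasoning.Setoid
open import Relation.Binary.Structures using (IsStrictPartialOrder)
open import Relation.Nullary.Decidable.Core using (Dec; yes; no)
open import Relation.Nullary.Negation.Core using (¬_)
open import Relation.Unary using (_∈_)

-- The theorem speaks of every inverse of `A`, every splitting field, every contour and every system
-- of dyadic roots, so each of these is used only through its defining equations. One of each must
-- also be exhibited, and for the roots of unity this means building real square roots from
-- completeness, because halving an angle requires them. The modulus of a complex number is a square
-- root as well; every estimate is therefore phrased as a bound of the squared modulus by the square
-- of a known real. With 2ᵐ nodes on a circle the vanishing of the power means is an induction on
-- `m`: odd powers cancel between opposite nodes, even powers are powers on the coarser division.
-- Whether `t` vanishes has to be decided twice: to locate the roots of a given splitting field, and
-- to know whether a contour consists of one circle or of two.

module IntegerSolver {c ℓ} (R : CommutativeRing c ℓ) where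
  open CommutativeRing R
  open Algebra.Properties.Ring ring
  open Algebra.Properties.CommutativeSemigroup (CommutativeRing.+-commutativeSemigroup R) using (interchange)
  open Algebra.Properties.Semiring.Mult.TCOptimised semiring renaming (_×_ to _×#_)
  open Relation.Binary.Reasoning.Setoid setoid

  -- The optimised multiple makes `con (+ 1)` denote `1#` itself and not `1# + 0#`, so that solved
  -- identities match their goals definitionally.
  fromInteger : ℤ → Carrier
  fromInteger (+ n)    = n ×# 1#
  fromInteger -[1+ n ] = - (suc n ×# 1#)

  suc-homo : ∀ n → suc n ×# 1# ≈ 1# + n ×# 1#
  suc-homo n = ×-homo-+ 1# 1 n

  add-cancel : ∀ x y z → (x + y) - (x + z) ≈ y - z
  add-cancel x y z = begin
    (x + y) - (x + z)      ≈⟨ +-congˡ (-‿+-comm x z) ⟨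
    (x + y) + (- x + - z)  ≈⟨ interchange x y (- x) (- z) ⟩
    (x - x) + (y - z)      ≈⟨ +-congʳ (-‿inverseʳ x) ⟩
    0# + (y - z)           ≈⟨ +-identityˡ _ ⟩
    y - z                  ∎

  ⊖-homo : ∀ m n → fromInteger (m ℤ.⊖ n) ≈ m ×# 1# - n ×# 1#
  ⊖-homo zero    zero    = sym (-‿inverseʳ 0#)
  ⊖-homo zero    (suc n) = sym (+-identityˡ _)
  ⊖-homo (suc m) zero    = sym (trans (+-congˡ -0#≈0#) (+-identityʳ _))
  ⊖-homo (suc m) (suc n) = begin
    fromInteger (suc m ℤ.⊖ suc n)    ≡⟨ ≡.cong fromInteger (ℤ.[1+m]⊖[1+n]≡m⊖n m n) ⟩
    fromInteger (m ℤ.⊖ n)            ≈⟨ ⊖-homo m n ⟩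
    m ×# 1# - n ×# 1#                  ≈⟨ add-cancel 1# _ _ ⟨
    (1# + m ×# 1#) - (1# + n ×# 1#)    ≈⟨ +-cong (suc-homo m) (-‿cong (suc-homo n)) ⟨
    suc m ×# 1# - suc n ×# 1#          ∎

  neg-homo : ∀ i → fromInteger (ℤ.- i) ≈ - fromInteger i
  neg-homo (+ zero)  = sym -0#≈0#
  neg-homo (+ suc n) = refl
  neg-homo -[1+ n ]  = sym (-‿involutive _)

  add-homo : ∀ i j → fromInteger (i ℤ.+ j) ≈ fromInteger i + fromInteger j
  add-homo (+ m)    (+ n)    = ×-homo-+ 1# m n
  add-homo (+ m)    -[1+ n ] = ⊖-homo m (suc n)
  add-homo -[1+ m ] (+ n)    = trans (⊖-homo n (suc m)) (+-comm _ _)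
  add-homo -[1+ m ] -[1+ n ] = begin
    - (suc (suc (m ℕ.+ n)) ×# 1#)       ≡⟨ ≡.cong (λ k → - (suc k ×# 1#)) (ℕ.+-suc m n) ⟨
    - ((suc m ℕ.+ suc n) ×# 1#)         ≈⟨ -‿cong (×-homo-+ 1# (suc m) (suc n)) ⟩
    - (suc m ×# 1# + suc n ×# 1#)        ≈⟨ -‿+-comm _ _ ⟨
    - (suc m ×# 1#) + - (suc n ×# 1#)    ∎

  mul-pos-neg : ∀ m n → fromInteger (+ m ℤ.* -[1+ n ]) ≈ fromInteger (+ m) * fromInteger -[1+ n ]
  mul-pos-neg zero    n = sym (zeroˡ _)
  mul-pos-neg (suc m) n = trans (-‿cong (×1-homo-* (suc m) (suc n))) (-‿distribʳ-* _ _)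

  mul-homo : ∀ i j → fromInteger (i ℤ.* j) ≈ fromInteger i * fromInteger j
  mul-homo (+ m)    (+ n)    = trans (reflexive (≡.cong fromInteger (≡.sym (ℤ.pos-* m n)))) (×1-homo-* m n)
  mul-homo (+ m)    -[1+ n ] = mul-pos-neg m n
  mul-homo -[1+ m ] (+ n)    = begin
    fromInteger (-[1+ m ] ℤ.* + n)            ≡⟨ ≡.cong fromInteger (ℤ.*-comm -[1+ m ] (+ n)) ⟩
    fromInteger (+ n ℤ.* -[1+ m ])            ≈⟨ mul-pos-neg n m ⟩
    fromInteger (+ n) * fromInteger -[1+ m ]  ≈⟨ *-comm _ _ ⟩
    fromInteger -[1+ m ] * fromInteger (+ n)  ∎
  mul-homo -[1+ m ] -[1+ n ] = begin
    (suc m ℕ.* suc n) ×# 1#               ≈⟨ ×1-homo-* (suc m) (suc n) ⟩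
    (suc m ×# 1#) * (suc n ×# 1#)          ≈⟨ -‿involutive _ ⟨
    - - ((suc m ×# 1#) * (suc n ×# 1#))    ≈⟨ -‿cong (-‿distribʳ-* _ _) ⟩
    - ((suc m ×# 1#) * - (suc n ×# 1#))    ≈⟨ -‿distribˡ-* _ _ ⟩
    - (suc m ×# 1#) * - (suc n ×# 1#)      ∎

  -- Equality in the ring is not decidable. Normalising with coefficients in ℤ lets like terms
  -- cancel by computation, and this homomorphism carries the result back.
  fromInteger-morphism : ℤ.+-*-rawRing -Raw-AlmostCommutative⟶ fromCommutativeRing R
  fromInteger-morphism = record
    { ⟦_⟧    = fromInteger
    ; +-homo = add-homo
    ; *-homo = mul-homo
    ; -‿homo = neg-homo
    ; 0-homo = refl
    ; 1-homo = refl
    }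

  fromInteger≟ : ∀ i j → Maybe (fromInteger i ≈ fromInteger j)
  fromInteger≟ i j with i ℤ.≟ j
  ... | yes ≡.refl = just refl
  ... | no  _      = nothing

  open Algebra.Solver.Ring ℤ.+-*-rawRing (fromCommutativeRing R) fromInteger-morphism fromInteger≟ public
    using (Polynomial; solve; _:=_; _:+_; _:*_; _:-_; :-_; con)

  -- Running a construction that is generic in a raw ring on solver
  -- expressions yields the expression of its result.
  expressions : ℕ → RawRing 0ℓ 0ℓ
  expressions n = record
    { Carrier = Polynomial n
    ; _≈_     = _≡_
    ; _+_     = _:+_
    ; _*_     = _:*_
    ; -_      = :-_
    ; 0#      = con (+ 0)
    ; 1#      = con (+ 1)
    }

-- Equations that follow linearly from given equations

module LinearCombination {c ℓ} (R : CommutativeRing c ℓ) where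
  open CommutativeRing R
  open IntegerSolver R
  open Relation.Binary.Reasoning.Setoid setoid

  vanish : ∀ {l r} k → l ≈ r → k * (l - r) ≈ 0#
  vanish k l≈r = trans (*-congˡ (trans (+-congʳ l≈r) (-‿inverseʳ _))) (zeroʳ k)

  -- lin₁ … lin₃ reduce an equation that follows linearly from given ones to
  -- an identity of commutative rings.
  lin₁ : ∀ {x y l r} k → l ≈ r → x ≈ y + k * (l - r) → x ≈ y
  lin₁ k l≈r eq = trans eq (trans (+-congˡ (vanish k l≈r)) (+-identityʳ _))

  lin₂ : ∀ {x y l₁ r₁ l₂ r₂} k₁ k₂ → l₁ ≈ r₁ → l₂ ≈ r₂ →
         x ≈ y + k₁ * (l₁ - r₁) + k₂ * (l₂ - r₂) → x ≈ y
  lin₂ k₁ k₂ e₁ e₂ eq = lin₁ k₁ e₁ (lin₁ k₂ e₂ eq)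

  lin₃ : ∀ {x y l₁ r₁ l₂ r₂ l₃ r₃} k₁ k₂ k₃ → l₁ ≈ r₁ → l₂ ≈ r₂ → l₃ ≈ r₃ →
         x ≈ y + k₁ * (l₁ - r₁) + k₂ * (l₂ - r₂) + k₃ * (l₃ - r₃) → x ≈ y
  lin₃ k₁ k₂ k₃ e₁ e₂ e₃ eq = lin₁ k₁ e₁ (lin₁ k₂ e₂ (lin₁ k₃ e₃ eq))

-- Constructive arithmetic of the ordered field of reals

module OrderedField {c ℓ₁ ℓ₂} (Rl : Reals c ℓ₁ ℓ₂) where
  open Reals Rl
  open CommutativeRing commutativeRing using (semiring)
  open IntegerSolver commutativeRing public
  open LinearCombination commutativeRing public
  open Algebra.Properties.Semiring.Exp semiring using (_^_) public
  open Algebra.Properties.Semiring.Mult semiring using (×-homo-+)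

  <-irrefl : ∀ {x} → ¬ x < x
  <-irrefl = IsStrictPartialOrder.irrefl isStrictPartialOrder refl

  <⇒# : ∀ {x y} → x < y → x # y
  <⇒# x<y = Equivalence.from #⇔<⊎> (inj₁ x<y)

  -- Stands in for trichotomy: `z` is apart from `x` or from `y`, and if it lies on the far side,
  -- transitivity through `x < y` still yields one of the two alternatives.
  <-cotrans : ∀ {x y} → x < y → ∀ z → x < z ⊎ z < y
  <-cotrans x<y z with #-cotrans (<⇒# x<y) z
  ... | inj₁ x#z = [ inj₁ , (λ z<x → inj₂ (<-trans z<x x<y)) ]′ (Equivalence.to #⇔<⊎> x#z)
  ... | inj₂ z#y = [ inj₂ , (λ y<z → inj₁ (<-trans x<y y<z)) ]′ (Equivalence.to #⇔<⊎> z#y)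

  infix 4 _≤_
  -- As a negation, a weak inequality may be proved by refuting the strict reverse one, without
  -- deciding anything.
  _≤_ : Carrier → Carrier → Set ℓ₂
  x ≤ y = ¬ y < x

  <⇒≤ : ∀ {x y} → x < y → x ≤ y
  <⇒≤ x<y y<x = <-irrefl (<-trans x<y y<x)

  ≤-reflexive : ∀ {x y} → x ≈ y → x ≤ y
  ≤-reflexive x≈y y<x = <-irrefl (<-respʳ-≈ x≈y y<x)

  ≤-refl : ∀ {x} → x ≤ x
  ≤-refl = <-irrefl

  <-≤-trans : ∀ {x y z} → x < y → y ≤ z → x < z
  <-≤-trans x<y y≤z = [ (λ x<z → x<z) , (λ z<y → ⊥-elim (y≤z z<y)) ]′ (<-cotrans x<y _)

  ≤-<-trans : ∀ {x y z} → x ≤ y → y < z → x < z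
  ≤-<-trans x≤y y<z = [ (λ y<x → ⊥-elim (x≤y y<x)) , (λ x<z → x<z) ]′ (<-cotrans y<z _)

  ≤-trans : ∀ {x y z} → x ≤ y → y ≤ z → x ≤ z
  ≤-trans x≤y y≤z z<x = y≤z (<-≤-trans z<x x≤y)

  ≤-antisym : ∀ {x y} → x ≤ y → y ≤ x → x ≈ y
  ≤-antisym x≤y y≤x = proj₁ (tight _ _) λ x#y → [ y≤x , x≤y ]′ (Equivalence.to #⇔<⊎> x#y)

  ≤-resp : ∀ {x x′ y y′} → x ≈ x′ → y ≈ y′ → x ≤ y → x′ ≤ y′
  ≤-resp p q x≤y y<x = x≤y (<-respʳ-≈ (sym p) (<-respˡ-≈ (sym q) y<x))

  <-resp : ∀ {x x′ y y′} → x ≈ x′ → y ≈ y′ → x < y → x′ < y′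
  <-resp p q x<y = <-respʳ-≈ q (<-respˡ-≈ p x<y)

  <⇒0< : ∀ {x y} → x < y → 0# < y - x
  <⇒0< {x} {y} x<y = <-resp (-‿inverseʳ x) refl (+-monoˡ-< (- x) x<y)

  0<⇒< : ∀ {x y e} → 0# < e → y - x ≈ e → x < y
  0<⇒< {x} {y} 0<e eq = <-resp (+-identityˡ x)
    (lin₁ 1# (sym eq) (solve 3 (λ x y e → e :+ x := y :+ con (+ 1) :* (e :- (y :- x))) refl x y _))
    (+-monoˡ-< x 0<e)

  ≤⇒0≤ : ∀ {x y} → x ≤ y → 0# ≤ y - x
  ≤⇒0≤ {x} {y} x≤y p = x≤y (<-resp
    (solve 2 (λ x y → y :- x :+ x := y) refl x y) (+-identityˡ x) (+-monoˡ-< x p))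

  0≤⇒≤ : ∀ {x y e} → 0# ≤ e → y - x ≈ e → x ≤ y
  0≤⇒≤ 0≤e eq y<x = 0≤e (0<⇒< (<⇒0< y<x)
    (lin₁ 1# eq (solve 3 (λ x y e → con (+ 0) :- e := x :- y :+ con (+ 1) :* (y :- x :- e)) refl _ _ _)))

  0<-+ : ∀ {x y} → 0# < x → 0# < y → 0# < x + y
  0<-+ {x} {y} 0<x 0<y = <-trans 0<y (<-respˡ-≈ (+-identityˡ y) (+-monoˡ-< y 0<x))

  0≤-+ : ∀ {x y} → 0# ≤ x → 0# ≤ y → 0# ≤ x + y
  0≤-+ {x} {y} 0≤x 0≤y p = 0≤y (≤-<-trans
    (0≤⇒≤ 0≤x (solve 2 (λ x y → x :+ y :- y := x) refl x y)) p)

  0<-+-0≤ : ∀ {x y} → 0# < x → 0# ≤ y → 0# < x + y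
  0<-+-0≤ {x} {y} 0<x 0≤y = <-≤-trans 0<x (0≤⇒≤ 0≤y (solve 2 (λ x y → x :+ y :- x := y) refl x y))

  inverse⇒# : ∀ {x y} → x * y ≈ 1# → x # 0#
  inverse⇒# {x} {y} eq = invertible⇒# (y , trans (*-comm _ _) p , p)
    where
    p : (x - 0#) * y ≈ 1#
    p = lin₁ 1# eq (solve 2 (λ x y → (x :- con (+ 0)) :* y :=
      con (+ 1) :+ con (+ 1) :* (x :* y :- con (+ 1))) refl x y)

  #⇒inverse : ∀ {x} → x # 0# → ∃[ y ] x * y ≈ 1#
  #⇒inverse {x} x#0 = let (y , _ , eq) = #⇒invertible x#0 in
    y , lin₁ 1# eq (solve 2 (λ x y → x :* y :=
      con (+ 1) :+ con (+ 1) :* ((x :- con (+ 0)) :* y :- con (+ 1))) refl x y)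

  -#0⇒# : ∀ {x y} → x - y # 0# → x # y
  -#0⇒# p = let (z , eq) = #⇒inverse p in invertible⇒# (z , trans (*-comm _ _) eq , eq)

  *-#0ˡ : ∀ {x y} → x * y # 0# → x # 0#
  *-#0ˡ p = let (z , eq) = #⇒inverse p in inverse⇒# (trans (sym (*-assoc _ _ z)) eq)

  *-#0ʳ : ∀ {x y} → x * y # 0# → y # 0#
  *-#0ʳ p = let (z , eq) = #⇒inverse p in
    inverse⇒# (trans (solve 3 (λ x y z → y :* (x :* z) := x :* y :* z) refl _ _ z) eq)

  #0-≤⇒0< : ∀ {x} → x # 0# → 0# ≤ x → 0# < x
  #0-≤⇒0< x#0 0≤x = [ (λ x<0 → ⊥-elim (0≤x x<0)) , (λ p → p) ]′ (Equivalence.to #⇔<⊎> x#0)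

  -- A negative product would be apart from zero, hence invertible; both factors would then be apart
  -- from zero, so positive, and the product positive.
  0≤-* : ∀ {x y} → 0# ≤ x → 0# ≤ y → 0# ≤ x * y
  0≤-* 0≤x 0≤y xy<0 = <⇒≤
    (*-pos (#0-≤⇒0< (*-#0ˡ (<⇒# xy<0)) 0≤x) (#0-≤⇒0< (*-#0ʳ (<⇒# xy<0)) 0≤y)) xy<0

  #0⇒0<² : ∀ {x} → x # 0# → 0# < x * x
  #0⇒0<² {x} x#0 with Equivalence.to #⇔<⊎> x#0
  ... | inj₂ 0<x = *-pos 0<x 0<x
  ... | inj₁ x<0 = <-resp refl (solve 1 (λ x → (con (+ 0) :- x) :* (con (+ 0) :- x) := x :* x) refl x)
    (*-pos (<⇒0< x<0) (<⇒0< x<0))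

  0≤² : ∀ x → 0# ≤ x * x
  0≤² x p = <⇒≤ (#0⇒0<² (*-#0ˡ (<⇒# p))) p

  +-mono-≤ : ∀ {x y u v} → x ≤ y → u ≤ v → x + u ≤ y + v
  +-mono-≤ {x} {y} {u} {v} p q = 0≤⇒≤ (0≤-+ (≤⇒0≤ p) (≤⇒0≤ q))
    (solve 4 (λ x y u v → y :+ v :- (x :+ u) := y :- x :+ (v :- u)) refl x y u v)

  *-mono-≤ : ∀ {x y u v} → 0# ≤ x → 0# ≤ u → x ≤ y → u ≤ v → x * u ≤ y * v
  *-mono-≤ {x} {y} {u} {v} 0≤x 0≤u p q =
    0≤⇒≤ (0≤-+ (0≤-* (≤⇒0≤ p) (≤-trans 0≤u q)) (0≤-* 0≤x (≤⇒0≤ q)))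
    (solve 4 (λ x y u v → y :* v :- x :* u := (y :- x) :* v :+ x :* (v :- u)) refl x y u v)

  square-mono-< : ∀ {x y} → 0# ≤ x → x < y → x * x < y * y
  square-mono-< {x} {y} 0≤x x<y = 0<⇒< (*-pos (<⇒0< x<y) (0<-+-0≤ (≤-<-trans 0≤x x<y) 0≤x))
    (solve 2 (λ x y → y :* y :- x :* x := (y :- x) :* (y :+ x)) refl x y)

  square-cancel-≤ : ∀ {x y} → 0# ≤ y → x * x ≤ y * y → x ≤ y
  square-cancel-≤ 0≤y p y<x = p (square-mono-< 0≤y y<x)

  0<⇒inverse : ∀ {x} → 0# < x → ∃[ y ] (0# < y × x * y ≈ 1#)
  0<⇒inverse {x} 0<x with #⇒inverse (#-sym (<⇒# 0<x))
  ... | y , eq with Equivalence.to #⇔<⊎> (inverse⇒# (trans (*-comm y x) eq))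
  ...   | inj₂ 0<y = y , 0<y , eq
  ...   | inj₁ y<0 = ⊥-elim (<⇒≤ 0<1 (0<⇒< (*-pos 0<x (<⇒0< y<0))
            (lin₁ 1# eq (solve 2 (λ x y → con (+ 0) :- con (+ 1) :=
              x :* (con (+ 0) :- y) :+ con (+ 1) :* (x :* y :- con (+ 1))) refl x y))))

  0<2 : 0# < 1# + 1#
  0<2 = 0<-+ 0<1 0<1

  ½ᴿ : Carrier
  ½ᴿ = fromℚ ½

  ½+½≈1 : ½ᴿ + ½ᴿ ≈ 1#
  ½+½≈1 = lin₁ 1# (proj₂ (proj₂ (#⇒invertible (Equivalence.from #⇔<⊎> (inj₂ (0<suc 1))))))
    (solve 1 (λ r → (con (+ 1) :+ con (+ 0)) :* r :+ (con (+ 1) :+ con (+ 0)) :* r :=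
      con (+ 1) :+ con (+ 1) :* ((con (+ 1) :+ (con (+ 1) :+ con (+ 0)) :- con (+ 0)) :* r :- con (+ 1))) refl _)

  0<½ : 0# < ½ᴿ
  0<½ = [ (λ p → p) , (λ ½<1 → 0<⇒< (<⇒0< ½<1)
    (lin₁ 1# ½+½≈1 (solve 1 (λ h → h :- con (+ 0) := con (+ 1) :- h :+ con (+ 1) :* (h :+ h :- con (+ 1))) refl ½ᴿ))) ]′
    (<-cotrans 0<1 ½ᴿ)

  halve : Carrier → Carrier
  halve x = ½ᴿ * x

  halve+halve : ∀ x → halve x + halve x ≈ x
  halve+halve x = lin₁ x ½+½≈1
    (solve 2 (λ h x → h :* x :+ h :* x := x :+ x :* (h :+ h :- con (+ 1))) refl ½ᴿ x)

  ½<1 : ½ᴿ < 1#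
  ½<1 = <-resp (+-identityˡ ½ᴿ) ½+½≈1 (+-monoˡ-< ½ᴿ 0<½)

  0<halve : ∀ {x} → 0# < x → 0# < halve x
  0<halve = *-pos 0<½

  halve< : ∀ {x} → 0# < x → halve x < x
  halve< {x} 0<x = 0<⇒< (0<halve 0<x) (lin₁ (- 1#) (halve+halve x)
    (solve 2 (λ x y → x :- y := y :+ (:- con (+ 1)) :* (y :+ y :- x)) refl x (halve x)))

  between : ∀ {x y} → x < y → ∃[ z ] (x < z × z < y)
  between {x} {y} x<y = x + halve (y - x) ,
    0<⇒< (0<halve (<⇒0< x<y)) (solve 2 (λ x d → x :+ d :- x := d) refl x _) ,
    0<⇒< (0<halve (<⇒0< x<y)) (lin₁ (- 1#) (halve+halve (y - x))
      (solve 3 (λ x y d → y :- (x :+ d) := d :+ (:- con (+ 1)) :* (d :+ d :- (y :- x))) refl x y _))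

  -- The minimum of `x` and `y` cannot be picked by comparison; locating `y` between `halve x` and
  -- `x` tells which half is small enough.
  positive-below : ∀ {x y} → 0# < x → 0# < y → ∃[ z ] (0# < z × z < x × z < y)
  positive-below {x} {y} 0<x 0<y =
    [ (λ p → halve x , 0<halve 0<x , halve< 0<x , p)
    , (λ p → halve y , 0<halve 0<y , <-trans (halve< 0<y) p , halve< 0<y)
    ]′ (<-cotrans (halve< 0<x) y)

  0≤^ : ∀ {x} → 0# ≤ x → ∀ n → 0# ≤ x ^ n
  0≤^ 0≤x zero    = <⇒≤ 0<1
  0≤^ 0≤x (suc n) = 0≤-* 0≤x (0≤^ 0≤x n)

  0≤× : ∀ {x} → 0# ≤ x → ∀ n → 0# ≤ n ×# x
  0≤× 0≤x zero    = ≤-refl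
  0≤× 0≤x (suc n) = 0≤-+ 0≤x (0≤× 0≤x n)

  ×-mono-≤ : ∀ {m n} → m ℕ.≤ n → m ×# 1# ≤ n ×# 1#
  ×-mono-≤ {m} {n} m≤n = 0≤⇒≤ (0≤× (<⇒≤ 0<1) (n ℕ.∸ m))
    (lin₁ 1# (trans (reflexive′ (ℕ.m+[n∸m]≡n m≤n)) (×-homo-+ 1# m (n ℕ.∸ m)))
      (solve 3 (λ n m d → n :- m := d :+ con (+ 1) :* (n :- (m :+ d))) refl _ _ _))
    where
    reflexive′ : ∀ {j k} → j ≡ k → k ×# 1# ≈ j ×# 1#
    reflexive′ ≡.refl = refl

  -- Bernoulli's inequality 1 + nh ≤ (1 + h)ⁿ multiplied by xⁿ. The left side decreases in `n`: by
  -- `step`, it drops by xⁿ · x n h².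
  bernoulli : ∀ {x h} → 0# ≤ x → x * (1# + h) ≈ 1# → ∀ n → x ^ n * (1# + n ×# 1# * h) ≤ 1#
  bernoulli {x} {h} 0≤x eq zero = ≤-reflexive (solve 1 (λ h → con (+ 1) :* (con (+ 1) :+ con (+ 0) :* h) := con (+ 1)) refl h)
  bernoulli {x} {h} 0≤x eq (suc n) = ≤-trans
    (0≤⇒≤ (0≤-* (0≤^ 0≤x n) (0≤-* (0≤-* 0≤x (0≤× (<⇒≤ 0<1) n)) (0≤² h)))
      (step (x ^ n) (n ×# 1#)))
    (bernoulli 0≤x eq n)
    where
    step : ∀ p k → p * (1# + k * h) - x * p * (1# + (1# + k) * h) ≈ p * (x * k * (h * h))
    step p k = lin₁ (- (p * (1# + k * h))) eq (solve 4 (λ x h p k →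
        p :* (con (+ 1) :+ k :* h) :- x :* p :* (con (+ 1) :+ (con (+ 1) :+ k) :* h) :=
        p :* (x :* k :* (h :* h)) :+ (:- (p :* (con (+ 1) :+ k :* h))) :* (x :* (con (+ 1) :+ h) :- con (+ 1)))
        refl x h p k)

  ^→0 : ∀ {x} → 0# < x → x < 1# → ∀ ε → 0# < ε → ∃[ N ] ∀ n → N ℕ.≤ n → x ^ n ≤ ε
  ^→0 {x} 0<x x<1 ε 0<ε =
    let (x⁻¹ , 0<x⁻¹ , xx⁻¹≈1) = 0<⇒inverse 0<x
        h = x⁻¹ - 1#
        0<h = 0<⇒< (*-pos 0<x⁻¹ (<⇒0< x<1)) (shrink xx⁻¹≈1)
        -- `N` exceeds 1/(hε), so ε < xⁿ for some n ≥ N would give 1 < ε n h ≤ xⁿ (1 + nh), against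
        -- `bernoulli`.
        (i , _ , hεi≈1) = 0<⇒inverse (*-pos 0<h 0<ε)
        (N , i<N) = archimedean i
    in N , λ n N≤n ε<xⁿ → bernoulli (<⇒≤ 0<x) (scale xx⁻¹≈1) n (<-≤-trans
         (0<⇒< (*-pos (<⇒0< (<-≤-trans i<N (×-mono-≤ N≤n))) (*-pos 0<h 0<ε))
           (large ε (n ×# 1#) h i hεi≈1))
         (≤-trans
           (*-mono-≤ (<⇒≤ 0<ε) (0≤-* (0≤× (<⇒≤ 0<1) n) (<⇒≤ 0<h)) (<⇒≤ ε<xⁿ) ≤-refl)
           (0≤⇒≤ (0≤^ (<⇒≤ 0<x) n)
             (solve 2 (λ p k → p :* (con (+ 1) :+ k) :- p :* k := p) refl (x ^ n) (n ×# 1# * h)))))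
    where
    shrink : ∀ {y} → x * y ≈ 1# → (y - 1#) - 0# ≈ y * (1# - x)
    shrink {y} xy≈1 = lin₁ 1# xy≈1 (solve 2 (λ x y →
      y :- con (+ 1) :- con (+ 0) := y :* (con (+ 1) :- x) :+ con (+ 1) :* (x :* y :- con (+ 1))) refl x y)
    scale : ∀ {y} → x * y ≈ 1# → x * (1# + (y - 1#)) ≈ 1#
    scale {y} xy≈1 = lin₁ 1# xy≈1 (solve 2 (λ x y →
      x :* (con (+ 1) :+ (y :- con (+ 1))) := con (+ 1) :+ con (+ 1) :* (x :* y :- con (+ 1))) refl x y)
    large : ∀ ε k h i → h * ε * i ≈ 1# → ε * (k * h) - 1# ≈ (k - i) * (h * ε)
    large ε k h i hεi≈1 = lin₁ 1# hεi≈1 (solve 4 (λ ε k h i →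
      ε :* (k :* h) :- con (+ 1) := (k :- i) :* (h :* ε) :+ con (+ 1) :* (h :* ε :* i :- con (+ 1)))
      refl ε k h i)

-- The iteration x ↦ x + (y - x²) / 2 increases from 1/2 and at least halves
-- the residual y - x² in each step.
module SquareRoot {c ℓ₁ ℓ₂} (Rl : Reals c ℓ₁ ℓ₂) where
  open Reals Rl
  open OrderedField Rl

  module _ (y : Carrier) (½≤y : ½ᴿ ≤ y) (y≤1 : y ≤ 1#) where
    private
      x : ℕ → Carrier
      x zero    = ½ᴿ
      x (suc n) = x n + halve (y - x n * x n)

      e : ℕ → Carrier
      e n = y - x n * x n

      ½≤1 : ½ᴿ ≤ 1#
      ½≤1 = ≤-trans ½≤y y≤1

      record Invariant (n : ℕ) : Set ℓ₂ where
        field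
          ½≤x  : ½ᴿ ≤ x n
          0≤e  : 0# ≤ e n
          e≤½ⁿ : e n ≤ ½ᴿ ^ n

        x≤1 : x n ≤ 1#
        x≤1 = square-cancel-≤ (<⇒≤ 0<1) (≤-resp refl (sym (*-identityʳ 1#))
          (≤-trans (0≤⇒≤ 0≤e refl) y≤1))

      open Invariant

      -- The new residual is e (1 - x - e/4), and four times the bracket equals (1 - y) + (1 - x)(3
      -- - x), a sum of nonnegative terms as long as x, y ≤ 1. Hence the iteration never overshoots
      -- the root.
      e-suc : ∀ n → e (suc n) ≈ e n * (½ᴿ * ½ᴿ * ((1# - y) + (1# - x n) * ((1# - x n) + (1# + 1#))))
      e-suc n = lin₁ (e n * ((½ᴿ + ½ᴿ) * x n - (½ᴿ + ½ᴿ + 1#))) ½+½≈1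
        (solve 3 (λ h x y →
          y :- (x :+ h :* (y :- x :* x)) :* (x :+ h :* (y :- x :* x)) :=
          (y :- x :* x) :* (h :* h :* (con (+ 1) :- y :+ (con (+ 1) :- x) :* (con (+ 1) :- x :+ con (+ 2))))
          :+ ((y :- x :* x) :* ((h :+ h) :* x :- (h :+ h :+ con (+ 1)))) :* (h :+ h :- con (+ 1)))
          refl ½ᴿ (x n) y)

      -- The difference of the two sides is e ((x - 1/2) + e/4), nonnegative because the iteration
      -- starts at 1/2 and increases.
      e-halves : ∀ n → Invariant n → e (suc n) ≤ halve (e n)
      e-halves n inv = 0≤⇒≤ (0≤-* (0≤e inv) (0≤-+ (≤⇒0≤ (½≤x inv)) (0≤-* (0≤² ½ᴿ) (0≤e inv))))
        (lin₁ (e n * (1# + x n)) ½+½≈1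
          (solve 3 (λ h x y →
            h :* (y :- x :* x) :- (y :- (x :+ h :* (y :- x :* x)) :* (x :+ h :* (y :- x :* x))) :=
            (y :- x :* x) :* (x :- h :+ h :* h :* (y :- x :* x))
            :+ ((y :- x :* x) :* (con (+ 1) :+ x)) :* (h :+ h :- con (+ 1))) refl ½ᴿ (x n) y))

      invariant : ∀ n → Invariant n
      invariant zero = record
        { ½≤x  = ≤-refl
        ; 0≤e  = ≤⇒0≤ (≤-trans (≤-resp refl (*-identityʳ _) (*-mono-≤ (<⇒≤ 0<½) (<⇒≤ 0<½) ≤-refl ½≤1)) ½≤y)
        ; e≤½ⁿ = ≤-trans (0≤⇒≤ (0≤² ½ᴿ) (solve 2 (λ y z → y :- (y :- z) := z) refl y _)) y≤1
        }
      invariant (suc n) = record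
        { ½≤x  = ≤-trans (½≤x inv) (0≤⇒≤ (0≤-* (<⇒≤ 0<½) (0≤e inv))
                   (solve 2 (λ x z → x :+ z :- x := z) refl (x n) _))
        ; 0≤e  = ≤-resp refl (sym (e-suc n)) (0≤-* (0≤e inv) (0≤-* (0≤² ½ᴿ)
                   (0≤-+ (≤⇒0≤ y≤1) (0≤-* (≤⇒0≤ (x≤1 inv)) (0≤-+ (≤⇒0≤ (x≤1 inv)) (<⇒≤ 0<2))))))
        ; e≤½ⁿ = ≤-trans (e-halves n inv) (*-mono-≤ (<⇒≤ 0<½) (0≤e inv) ≤-refl (e≤½ⁿ inv))
        }
        where inv = invariant n

      x-mono : ∀ n k → x n ≤ x (k ℕ.+ n)
      x-mono n zero    = ≤-refl
      x-mono n (suc k) = ≤-trans (x-mono n k) (0≤⇒≤ (0≤-* (<⇒≤ 0<½) (0≤e (invariant (k ℕ.+ n))))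
        (solve 2 (λ x z → x :+ z :- x := z) refl (x (k ℕ.+ n)) _))

      -- Two iterates u ≤ v are at least 1/2, so u + v ≥ 1 and v - u ≤ v² - u² ≤ y - u².
      x-close : ∀ n k → x (k ℕ.+ n) ≤ x n + e n
      x-close n k = 0≤⇒≤ (0≤-+ (0≤-* (0≤-+ (≤⇒0≤ (½≤x i)) (≤⇒0≤ (½≤x j))) (≤⇒0≤ (x-mono n k))) (0≤e j))
        (lin₁ (x (k ℕ.+ n) - x n) ½+½≈1
          (solve 4 (λ h y u v → u :+ (y :- u :* u) :- v :=
            (u :- h :+ (v :- h)) :* (v :- u) :+ (y :- v :* v) :+ (v :- u) :* (h :+ h :- con (+ 1)))
            refl ½ᴿ y (x n) (x (k ℕ.+ n))))
        where
        i = invariant n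
        j = invariant (k ℕ.+ n)

      e-small : ∀ ε → 0# < ε → ∃[ N ] e N ≤ ε
      e-small ε 0<ε = let (N , small) = ^→0 0<½ ½<1 ε 0<ε in
        N , ≤-trans (e≤½ⁿ (invariant N)) (small N ℕ.≤-refl)

      x-below : ∀ N {ε} → e N < ε → ∀ m n → N ℕ.≤ m → N ℕ.≤ n → x m < x n + ε
      x-below N {ε} eN<ε m n N≤m N≤n with ℕ.m∸n+n≡m N≤m | ℕ.m∸n+n≡m N≤n
      ... | p | q rewrite ≡.sym p | ≡.sym q = ≤-<-trans
        (≤-trans (x-close N (m ℕ.∸ N)) (+-mono-≤ (x-mono N (n ℕ.∸ N)) ≤-refl))
        (0<⇒< (<⇒0< eN<ε) (solve 3 (λ x d e → x :+ d :- (x :+ e) := d :- e) refl _ _ _))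

      cauchy : IsCauchy x
      cauchy ε 0<ε =
        let (N , small) = e-small (halve ε) (0<halve 0<ε)
            below = x-below N (≤-<-trans small (halve< 0<ε))
        in N , λ m n N≤m N≤n →
          0<⇒< (<⇒0< (below n m N≤n N≤m)) (solve 3 (λ u v d → u :- (v :- d) := u :+ d :- v) refl _ _ _) ,
          below m n N≤m N≤n

      l : Carrier
      l = proj₁ (complete x cauchy)

      isLimit : IsLimit x l
      isLimit = proj₂ (complete x cauchy)

      x≤l : ∀ n → x n ≤ l
      x≤l n l<x =
        let (N , close) = isLimit (x n - l) (<⇒0< l<x)
            (_ , p) = close (N ℕ.+ n) (ℕ.m≤m+n N n)
        in x-mono n N (<-respʳ-≈ (solve 2 (λ l x → l :+ (x :- l) := x) refl l (x n)) p)

      l≤x+e : ∀ n → l ≤ x n + e n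
      l≤x+e n p =
        let (N , close) = isLimit (l - (x n + e n)) (<⇒0< p)
            (q , _) = close (N ℕ.+ n) (ℕ.m≤m+n N n)
        in x-close n N (<-respˡ-≈ (solve 2 (λ l x → l :- (l :- x) := x) refl l _) q)

      0≤x : ∀ n → 0# ≤ x n
      0≤x n = ≤-trans (<⇒≤ 0<½) (½≤x (invariant n))

      y≤l²+ε : ∀ n → y ≤ l * l + e n
      y≤l²+ε n = ≤-resp (solve 2 (λ x y → x :* x :+ (y :- x :* x) := y) refl (x n) y) refl
        (+-mono-≤ (*-mono-≤ (0≤x n) (0≤x n) (x≤l n) (x≤l n)) ≤-refl)

      l²≤y+2ε : ∀ n → l * l ≤ y + (1# + 1#) * e n
      l²≤y+2ε n = ≤-trans (*-mono-≤ 0≤l 0≤l (l≤x+e n) (l≤x+e n))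
        (0≤⇒≤ (0≤-* (0≤e i) (0≤-+ (0≤-* (<⇒≤ 0<2) (≤⇒0≤ (x≤1 i))) (0≤-+ (≤⇒0≤ y≤1) (0≤² (x n)))))
          (solve 2 (λ x y → y :+ con (+ 2) :* (y :- x :* x) :- (x :+ (y :- x :* x)) :* (x :+ (y :- x :* x)) :=
             (y :- x :* x) :* (con (+ 2) :* (con (+ 1) :- x) :+ (con (+ 1) :- y :+ x :* x)))
             refl (x n) y))
        where
        i = invariant n
        0≤l = ≤-trans (0≤x 0) (x≤l 0)

      squeeze : ∀ {a b} k → 0# < k → (∀ n → a ≤ b + k * e n) → a ≤ b
      squeeze {a} {b} k 0<k bound b<a =
        let (i , 0<i , ki≈1) = 0<⇒inverse 0<k
            (n , small) = e-small (i * halve (a - b)) (*-pos 0<i (0<halve (<⇒0< b<a)))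
        in bound n (≤-<-trans (+-mono-≤ ≤-refl (*-mono-≤ (<⇒≤ 0<k) (0≤e (invariant n)) ≤-refl small))
             (0<⇒< (0<halve (<⇒0< b<a)) (residue (halve (a - b)) i (halve+halve (a - b)) ki≈1)))
        where
        residue : ∀ d i → d + d ≈ a - b → k * i ≈ 1# → a - (b + k * (i * d)) ≈ d
        residue d i p q = lin₂ (- 1#) (- d) p q (solve 5 (λ a b d k i →
          a :- (b :+ k :* (i :* d)) := d :+ :- con (+ 1) :* (d :+ d :- (a :- b)) :+ :- d :* (k :* i :- con (+ 1)))
          refl a b d k i)

    √ : Carrier
    √ = l

    ½≤√ : ½ᴿ ≤ √
    ½≤√ = x≤l 0

    √-square : √ * √ ≈ y
    √-square = ≤-antisym (squeeze (1# + 1#) 0<2 l²≤y+2ε)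
      (squeeze 1# 0<1 (λ n → ≤-resp refl (+-congˡ (sym (*-identityˡ _))) (y≤l²+ε n)))

-- Complex numbers: apartness, bounds on the modulus, limits

module ComplexField {c ℓ₁ ℓ₂} (Rl : Reals c ℓ₁ ℓ₂) where
  private
    module ℝ where
      open Reals Rl public
      open OrderedField Rl public
  open Complex Rl
  open ℝ using (solve; _:=_; _:+_; _:*_; _:-_; :-_; con; lin₁)

  ℂ-isCommutativeRing : IsCommutativeRing _≈_ _+_ _*_ -_ 0# 1#
  ℂ-isCommutativeRing = record
    { isRing = record
      { +-isAbelianGroup = record
        { isGroup = record
          { isMonoid = record
            { isSemigroup = record
              { isMagma = record
                { isEquivalence = ≈-isEquivalence
                ; ∙-cong = λ (p , q) (p′ , q′) → ℝ.+-cong p p′ , ℝ.+-cong q q′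
                }
              ; assoc = λ _ _ _ → ℝ.+-assoc _ _ _ , ℝ.+-assoc _ _ _
              }
            ; identity = (λ _ → ℝ.+-identityˡ _ , ℝ.+-identityˡ _) ,
                         (λ _ → ℝ.+-identityʳ _ , ℝ.+-identityʳ _)
            }
          ; inverse = (λ _ → ℝ.-‿inverseˡ _ , ℝ.-‿inverseˡ _) ,
                      (λ _ → ℝ.-‿inverseʳ _ , ℝ.-‿inverseʳ _)
          ; ⁻¹-cong = λ (p , q) → ℝ.-‿cong p , ℝ.-‿cong q
          }
        ; comm = λ _ _ → ℝ.+-comm _ _ , ℝ.+-comm _ _
        }
      ; *-cong = λ (p , q) (p′ , q′) →
          ℝ.+-cong (ℝ.*-cong p p′) (ℝ.-‿cong (ℝ.*-cong q q′)) ,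
          ℝ.+-cong (ℝ.*-cong p q′) (ℝ.*-cong q p′)
      ; *-assoc = λ (a +i b) (x +i y) (u +i v) →
          solve 6 (λ a b x y u v →
            (a :* x :- b :* y) :* u :- (a :* y :+ b :* x) :* v :=
            a :* (x :* u :- y :* v) :- b :* (x :* v :+ y :* u)) ℝ.refl a b x y u v ,
          solve 6 (λ a b x y u v →
            (a :* x :- b :* y) :* v :+ (a :* y :+ b :* x) :* u :=
            a :* (x :* v :+ y :* u) :+ b :* (x :* u :- y :* v)) ℝ.refl a b x y u v
      ; *-identity =
          (λ (a +i b) →
            solve 2 (λ a b → con (+ 1) :* a :- con (+ 0) :* b := a) ℝ.refl a b ,
            solve 2 (λ a b → con (+ 1) :* b :+ con (+ 0) :* a := b) ℝ.refl a b) ,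
          (λ (a +i b) →
            solve 2 (λ a b → a :* con (+ 1) :- b :* con (+ 0) := a) ℝ.refl a b ,
            solve 2 (λ a b → a :* con (+ 0) :+ b :* con (+ 1) := b) ℝ.refl a b)
      ; distrib =
          (λ (a +i b) (x +i y) (u +i v) →
            solve 6 (λ a b x y u v → a :* (x :+ u) :- b :* (y :+ v) :=
              a :* x :- b :* y :+ (a :* u :- b :* v)) ℝ.refl a b x y u v ,
            solve 6 (λ a b x y u v → a :* (y :+ v) :+ b :* (x :+ u) :=
              a :* y :+ b :* x :+ (a :* v :+ b :* u)) ℝ.refl a b x y u v) ,
          (λ (a +i b) (x +i y) (u +i v) →
            solve 6 (λ a b x y u v → (x :+ u) :* a :- (y :+ v) :* b :=
              x :* a :- y :* b :+ (u :* a :- v :* b)) ℝ.refl a b x y u v ,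
            solve 6 (λ a b x y u v → (x :+ u) :* b :+ (y :+ v) :* a :=
              x :* b :+ y :* a :+ (u :* b :+ v :* a)) ℝ.refl a b x y u v)
      }
    ; *-comm = λ (a +i b) (x +i y) →
        solve 4 (λ a b x y → a :* x :- b :* y := x :* a :- y :* b) ℝ.refl a b x y ,
        solve 4 (λ a b x y → a :* y :+ b :* x := x :* b :+ y :* a) ℝ.refl a b x y
    }

  ℂ-commutativeRing : CommutativeRing c ℓ₁
  ℂ-commutativeRing = record { isCommutativeRing = ℂ-isCommutativeRing }

  private
    module C = CommutativeRing ℂ-commutativeRing

  ∣∣²-cong : ∀ {z w} → z ≈ w → ∣ z ∣² ℝ.≈ ∣ w ∣²
  ∣∣²-cong (p , q) = ℝ.+-cong (ℝ.*-cong p p) (ℝ.*-cong q q)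

  ∣∣²-* : ∀ z w → ∣ z * w ∣² ℝ.≈ ∣ z ∣² ℝ.* ∣ w ∣²
  ∣∣²-* (a +i b) (x +i y) = solve 4 (λ a b x y →
    (a :* x :- b :* y) :* (a :* x :- b :* y) :+ (a :* y :+ b :* x) :* (a :* y :+ b :* x) :=
    (a :* a :+ b :* b) :* (x :* x :+ y :* y)) ℝ.refl a b x y

  ∣-∣² : ∀ z → ∣ - z ∣² ℝ.≈ ∣ z ∣²
  ∣-∣² (a +i b) = solve 2 (λ a b → :- a :* :- a :+ :- b :* :- b := a :* a :+ b :* b) ℝ.refl a b

  ∣fromℝ∣² : ∀ x → ∣ fromℝ x ∣² ℝ.≈ x ℝ.* x
  ∣fromℝ∣² x = solve 1 (λ x → x :* x :+ con (+ 0) :* con (+ 0) := x :* x) ℝ.refl x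

  0≤∣∣² : ∀ z → ℝ.0# ℝ.≤ ∣ z ∣²
  0≤∣∣² z = ℝ.0≤-+ (ℝ.0≤² (re z)) (ℝ.0≤² (im z))

  #⇒0<∣∣² : ∀ {z} → z # 0# → ℝ.0# ℝ.< ∣ z ∣²
  #⇒0<∣∣² {z} (inj₁ p) = ℝ.0<-+-0≤ (ℝ.#0⇒0<² p) (ℝ.0≤² (im z))
  #⇒0<∣∣² {z} (inj₂ p) = ℝ.<-respʳ-≈ (ℝ.+-comm _ _) (ℝ.0<-+-0≤ (ℝ.#0⇒0<² p) (ℝ.0≤² (re z)))

  0<∣∣²⇒inverse : ∀ {z} → ℝ.0# ℝ.< ∣ z ∣² → ∃[ w ] z * w ≈ 1#
  0<∣∣²⇒inverse {a +i b} 0<n =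
    let (r , _ , eq) = ℝ.0<⇒inverse 0<n in
    (a ℝ.* r +i ℝ.- (b ℝ.* r)) ,
    lin₁ ℝ.1# eq (solve 3 (λ a b r → a :* (a :* r) :- b :* :- (b :* r) :=
      con (+ 1) :+ con (+ 1) :* ((a :* a :+ b :* b) :* r :- con (+ 1))) ℝ.refl a b r) ,
    solve 3 (λ a b r → a :* :- (b :* r) :+ b :* (a :* r) := con (+ 0)) ℝ.refl a b r

  #-cotrans : ∀ {z w} → z # w → ∀ u → z # u ⊎ u # w
  #-cotrans (inj₁ p) u = map inj₁ inj₁ (ℝ.#-cotrans p (re u))
  #-cotrans (inj₂ p) u = map inj₂ inj₂ (ℝ.#-cotrans p (im u))

  tight : ∀ {z w} → ¬ z # w → z ≈ w
  tight p = proj₁ (ℝ.tight _ _) (λ q → p (inj₁ q)) , proj₁ (ℝ.tight _ _) (λ q → p (inj₂ q))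

  #-irrefl : ∀ {z w} → z ≈ w → ¬ z # w
  #-irrefl (p , q) (inj₁ r) = ℝ.#-irrefl p r
  #-irrefl (p , q) (inj₂ r) = ℝ.#-irrefl q r

  #-sym : ∀ {z w} → z # w → w # z
  #-sym (inj₁ p) = inj₁ (ℝ.#-sym p)
  #-sym (inj₂ p) = inj₂ (ℝ.#-sym p)

  #-resp : ∀ {z z′ w w′} → z ≈ z′ → w ≈ w′ → z # w → z′ # w′
  #-resp p q r with #-cotrans r _
  ... | inj₁ s = ⊥-elim (#-irrefl p s)
  ... | inj₂ s with #-cotrans s _
  ...   | inj₁ t = t
  ...   | inj₂ t = ⊥-elim (#-irrefl (C.sym q) t)

  0<∣∣²⇒# : ∀ {z} → ℝ.0# ℝ.< ∣ z ∣² → z # 0#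
  0<∣∣²⇒# {a +i b} 0<n =
    [ (λ p → inj₁ (ℝ.*-#0ˡ (ℝ.#-sym (ℝ.<⇒# p))))
    , (λ p → inj₂ (ℝ.*-#0ˡ (ℝ.#-sym (ℝ.<⇒# (ℝ.<-respʳ-≈
        (solve 2 (λ a b → a :+ b :- a := b) ℝ.refl (a ℝ.* a) (b ℝ.* b)) (ℝ.<⇒0< p))))))
    ]′ (ℝ.<-cotrans 0<n (a ℝ.* a))

  #⇒inverse : ∀ {z} → z # 0# → ∃[ w ] z * w ≈ 1#
  #⇒inverse z#0 = 0<∣∣²⇒inverse (#⇒0<∣∣² z#0)

  1#0 : 1# # 0#
  1#0 = inj₁ (ℝ.#-sym (ℝ.<⇒# ℝ.0<1))

  #-0ˡ : ∀ {z w} → z # w → z - w # 0#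
  #-0ˡ (inj₁ p) = inj₁ (ℝ.inverse⇒# (proj₂ (proj₂ (ℝ.#⇒invertible p))))
  #-0ˡ (inj₂ p) = inj₂ (ℝ.inverse⇒# (proj₂ (proj₂ (ℝ.#⇒invertible p))))

  -#0⇒# : ∀ {z w} → z - w # 0# → z # w
  -#0⇒# (inj₁ p) = inj₁ (ℝ.-#0⇒# p)
  -#0⇒# (inj₂ p) = inj₂ (ℝ.-#0⇒# p)

  *-#0ˡ : ∀ {z w} → z * w # 0# → z # 0#
  *-#0ˡ {z} {w} p = 0<∣∣²⇒# (ℝ.#0-≤⇒0<
    (ℝ.*-#0ˡ (ℝ.#-sym (ℝ.<⇒# (ℝ.<-respʳ-≈ (∣∣²-* z w) (#⇒0<∣∣² p))))) (0≤∣∣² z))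

  *-#0ʳ : ∀ {z w} → z * w # 0# → w # 0#
  *-#0ʳ p = *-#0ˡ (#-resp (C.*-comm _ _) C.refl p)

  inverse⇒# : ∀ {z w} → z * w ≈ 1# → z # 0#
  inverse⇒# eq = *-#0ˡ (#-resp (C.sym eq) C.refl 1#0)

  *-cancel-0 : ∀ {z w} → z # 0# → z * w ≈ 0# → w ≈ 0#
  *-cancel-0 {z} {w} z#0 zw≈0 = tight λ w#0 →
    let (i , zi≈1) = #⇒inverse z#0 in
    #-irrefl (C.trans (C.sym (C.trans (C.*-congʳ (C.trans (C.*-comm i z) zi≈1)) (C.*-identityˡ w)))
      (C.trans (C.*-assoc i z w) (C.trans (C.*-congˡ zw≈0) (C.zeroʳ i)))) w#0

  -- By tightness it suffices to refute that `z` is apart from zero; if it were, one factor could be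
  -- cancelled and `z` would vanish.
  square-0 : ∀ {z} → z * z ≈ 0# → z ≈ 0#
  square-0 zz≈0 = tight λ z#0 → #-irrefl (*-cancel-0 z#0 zz≈0) z#0

  -- z ≼ r says that the modulus of z, which is not itself available, is at most r.
  infix 4 _≼_
  record _≼_ (z : ℂ) (r : ℝ) : Set ℓ₂ where
    constructor _,_
    field
      0≤bound : ℝ.0# ℝ.≤ r
      ∣∣²≤    : ∣ z ∣² ℝ.≤ r ℝ.* r
  open _≼_ public

  ≼-resp : ∀ {z w r s} → z ≈ w → r ℝ.≈ s → z ≼ r → w ≼ s
  ≼-resp z≈w r≈s (p , q) = ℝ.≤-resp ℝ.refl r≈s p , ℝ.≤-resp (∣∣²-cong z≈w) (ℝ.*-cong r≈s r≈s) q

  ≼-mono : ∀ {z r s} → r ℝ.≤ s → z ≼ r → z ≼ s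
  ≼-mono r≤s (p , q) = ℝ.≤-trans p r≤s , ℝ.≤-trans q (ℝ.*-mono-≤ p p r≤s r≤s)

  ≼-0 : 0# ≼ ℝ.0#
  ≼-0 = ℝ.≤-refl , ℝ.≤-reflexive (∣fromℝ∣² ℝ.0#)

  ≼-fromℝ : ∀ {x} → ℝ.0# ℝ.≤ x → fromℝ x ≼ x
  ≼-fromℝ {x} 0≤x = 0≤x , ℝ.≤-reflexive (∣fromℝ∣² x)

  ≼-* : ∀ {z w r s} → z ≼ r → w ≼ s → z * w ≼ r ℝ.* s
  ≼-* {z} {w} {r} {s} (p , q) (p′ , q′) = ℝ.0≤-* p p′ ,
    ℝ.≤-resp (ℝ.sym (∣∣²-* z w)) (solve 2 (λ r s → r :* r :* (s :* s) := r :* s :* (r :* s)) ℝ.refl r s)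
      (ℝ.*-mono-≤ (0≤∣∣² z) (0≤∣∣² w) q q′)

  ≼-neg : ∀ {z r} → z ≼ r → - z ≼ r
  ≼-neg {z} (p , q) = p , ℝ.≤-resp (ℝ.sym (∣-∣² z)) ℝ.refl q

  -- By Cauchy–Schwarz: |z|²|w|² exceeds the squared inner product by (ay - bx)².
  ≼-+ : ∀ {z w r s} → z ≼ r → w ≼ s → z + w ≼ r ℝ.+ s
  ≼-+ {z@(a +i b)} {w@(x +i y)} {r} {s} (p , q) (p′ , q′) = ℝ.0≤-+ p p′ ,
    ℝ.≤-resp
      (solve 4 (λ a b x y → a :* a :+ b :* b :+ (x :* x :+ y :* y) :+ con (+ 2) :* (a :* x :+ b :* y) :=
        (a :+ x) :* (a :+ x) :+ (b :+ y) :* (b :+ y)) ℝ.refl a b x y)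
      (solve 2 (λ r s → r :* r :+ s :* s :+ con (+ 2) :* (r :* s) := (r :+ s) :* (r :+ s)) ℝ.refl r s)
      (ℝ.+-mono-≤ (ℝ.+-mono-≤ q q′) double)
    where
    inner : a ℝ.* x ℝ.+ b ℝ.* y ℝ.≤ r ℝ.* s
    inner = ℝ.square-cancel-≤ (ℝ.0≤-* p p′) (ℝ.≤-trans
      (ℝ.0≤⇒≤ (ℝ.0≤² (a ℝ.* y ℝ.- b ℝ.* x)) (solve 4 (λ a b x y →
        (a :* a :+ b :* b) :* (x :* x :+ y :* y) :- (a :* x :+ b :* y) :* (a :* x :+ b :* y) :=
        (a :* y :- b :* x) :* (a :* y :- b :* x)) ℝ.refl a b x y))
      (ℝ.≤-resp (∣∣²-* z w) ℝ.refl (∣∣²≤ (≼-* {z} {w} (p , q) (p′ , q′)))))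
    double : (ℝ.1# ℝ.+ ℝ.1#) ℝ.* (a ℝ.* x ℝ.+ b ℝ.* y) ℝ.≤ (ℝ.1# ℝ.+ ℝ.1#) ℝ.* (r ℝ.* s)
    double = ℝ.0≤⇒≤ (ℝ.0≤-* (ℝ.<⇒≤ ℝ.0<2) (ℝ.≤⇒0≤ inner))
      (solve 2 (λ u v → con (+ 2) :* v :- con (+ 2) :* u := con (+ 2) :* (v :- u)) ℝ.refl _ (r ℝ.* s))

  ≼-^ : ∀ {z r} → z ≼ r → ∀ n → z ^ n ≼ r ℝ.^ n
  ≼-^ p zero    = ≼-fromℝ (ℝ.<⇒≤ ℝ.0<1)
  ≼-^ p (suc n) = ≼-* p (≼-^ p n)

  ≼-sum : ∀ n {r} (t : Fin n → ℂ) → (∀ i → t i ≼ r) → sum t ≼ n ℝ.×# r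
  ≼-sum zero    t p = ≼-0
  ≼-sum (suc n) t p = ≼-+ (p zero) (≼-sum n (λ i → t (suc i)) (λ i → p (suc i)))

  -- 1 + |z|² bounds the modulus without a square root, since its square exceeds |z|².
  bounded : ∀ z → ∃[ r ] (ℝ.0# ℝ.< r × z ≼ r)
  bounded z = ℝ.1# ℝ.+ ∣ z ∣² , 0<r , ℝ.<⇒≤ 0<r ,
    ℝ.0≤⇒≤ (ℝ.0≤-+ (ℝ.<⇒≤ 0<r) (ℝ.0≤² ∣ z ∣²))
      (solve 1 (λ n → (con (+ 1) :+ n) :* (con (+ 1) :+ n) :- n := con (+ 1) :+ n :+ n :* n) ℝ.refl ∣ z ∣²)
    where 0<r = ℝ.0<-+-0≤ ℝ.0<1 (0≤∣∣² z)

  ≼-< : ∀ {z r s} → z ≼ r → r ℝ.< s → ∣ z ∣² ℝ.< s ℝ.* s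
  ≼-< (p , q) r<s = ℝ.≤-<-trans q (ℝ.square-mono-< p r<s)

  infix 4 _⇝_
  -- The weak-inequality form of `_⟶_`, to which the calculus of `_≼_` applies directly; halving ε
  -- recovers the strict form.
  _⇝_ : (ℕ → ℂ) → ℂ → Set _
  s ⇝ l = ∀ ε → ℝ.0# ℝ.< ε → ∃[ N ] ∀ n → N ℕ.≤ n → s n - l ≼ ε

  ⇝⇒⟶ : ∀ {s l} → s ⇝ l → s ⟶ l
  ⇝⇒⟶ s⇝l ε 0<ε =
    let (N , close) = s⇝l (ℝ.halve ε) (ℝ.0<halve 0<ε)
    in N , λ n N≤n → ≼-< (close n N≤n) (ℝ.halve< 0<ε)

  ⟶⇒⇝ : ∀ {s l} → s ⟶ l → s ⇝ l
  ⟶⇒⇝ s⟶l ε 0<ε =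
    let (N , close) = s⟶l ε 0<ε in N , λ n N≤n → ℝ.<⇒≤ 0<ε , ℝ.<⇒≤ (close n N≤n)

  open IntegerSolver ℂ-commutativeRing using () renaming (solve to solveᶜ; _:=_ to _:=ᶜ_; _:+_ to _:+ᶜ_; _:*_ to _:*ᶜ_; _:-_ to _:-ᶜ_)

  ⇝-cong : ∀ {s s′ l l′} N → (∀ n → N ℕ.≤ n → s n ≈ s′ n) → l ≈ l′ → s ⇝ l → s′ ⇝ l′
  ⇝-cong N s≈s′ l≈l′ s⇝l ε 0<ε =
    let (M , close) = s⇝l ε 0<ε in
    M ℕ.⊔ N , λ n p → ≼-resp (C.+-cong (s≈s′ n (ℕ.≤-trans (ℕ.m≤n⊔m M N) p)) (C.-‿cong l≈l′)) ℝ.refl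
      (close n (ℕ.≤-trans (ℕ.m≤m⊔n M N) p))

  ⇝-limit-cong : ∀ {s l l′} → l ≈ l′ → s ⇝ l → s ⇝ l′
  ⇝-limit-cong {s} {l} {l′} l≈l′ s⇝l ε 0<ε =
    let (N , close) = s⇝l ε 0<ε in
    N , λ n N≤n → ≼-resp {s n - l} {s n - l′} (C.+-congˡ {s n} (C.-‿cong l≈l′)) ℝ.refl (close n N≤n)

  ⇝-sequence-cong : ∀ {s s′ l} → (∀ n → s n ≈ s′ n) → s ⇝ l → s′ ⇝ l
  ⇝-sequence-cong {s} {s′} {l} s≈s′ s⇝l ε 0<ε =
    let (N , close) = s⇝l ε 0<ε in
    N , λ n N≤n → ≼-resp {s n - l} {s′ n - l} (C.+-congʳ {x = - l} (s≈s′ n)) ℝ.refl (close n N≤n)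

  ⇝-const : ∀ {l} → (λ _ → l) ⇝ l
  ⇝-const {l} ε 0<ε = 0 , λ _ _ → ≼-resp (C.sym (C.-‿inverseʳ l)) ℝ.refl (≼-mono (ℝ.<⇒≤ 0<ε) ≼-0)

  ⇝-+ : ∀ {s t l m} → s ⇝ l → t ⇝ m → (λ n → s n + t n) ⇝ l + m
  ⇝-+ {s} {t} {l} {m} s⇝l t⇝m ε 0<ε =
    let (M , p) = s⇝l (ℝ.halve ε) (ℝ.0<halve 0<ε)
        (N , q) = t⇝m (ℝ.halve ε) (ℝ.0<halve 0<ε)
    in M ℕ.⊔ N , λ n MN≤n → ≼-resp
      (solveᶜ 4 (λ s l t m → (s :-ᶜ l) :+ᶜ (t :-ᶜ m) :=ᶜ (s :+ᶜ t) :-ᶜ (l :+ᶜ m)) C.refl (s n) l (t n) m)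
      (ℝ.halve+halve ε)
      (≼-+ (p n (ℕ.≤-trans (ℕ.m≤m⊔n M N) MN≤n)) (q n (ℕ.≤-trans (ℕ.m≤n⊔m M N) MN≤n)))

  ⇝-*ˡ : ∀ {s l} a → s ⇝ l → (λ n → a * s n) ⇝ a * l
  ⇝-*ˡ {s} {l} a s⇝l ε 0<ε =
    let (r , 0<r , a≼r) = bounded a
        (i , 0<i , ri≈1) = ℝ.0<⇒inverse 0<r
        (N , p) = s⇝l (i ℝ.* ε) (ℝ.*-pos 0<i 0<ε)
    in N , λ n N≤n → ≼-resp
      (solveᶜ 3 (λ a s l → a :*ᶜ (s :-ᶜ l) :=ᶜ a :*ᶜ s :-ᶜ a :*ᶜ l) C.refl a (s n) l)
      (ℝ.trans (ℝ.sym (ℝ.*-assoc r i ε)) (ℝ.trans (ℝ.*-congʳ ri≈1) (ℝ.*-identityˡ ε)))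
      (≼-* a≼r (p n N≤n))

  ⇝-sum : ∀ k {s : ℕ → Fin k → ℂ} {l : Fin k → ℂ} → (∀ i → (λ n → s n i) ⇝ l i) → (λ n → sum (s n)) ⇝ sum l
  ⇝-sum zero    p = ⇝-const
  ⇝-sum (suc k) p = ⇝-+ (p zero) (⇝-sum k (λ i → p (suc i)))

-- Algebra of 2 × 2 matrices and of the combined matrix

module TwoByTwo {c ℓ} (R : CommutativeRing c ℓ) where
  open CommutativeRing R hiding (zero)
  open IntegerSolver R
  open LinearCombination R
  open Matrices rawRing
  open Polynomials rawRing
  open CharacteristicPolynomial rawRing

  private
    module E {n : ℕ} where
      open Matrices (expressions n) public
      open Polynomials (expressions n) public
      open CharacteristicPolynomial (expressions n) public

    2ᴿ : Carrier
    2ᴿ = 1# + 1#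

  -- The product is the sum of the rank-one matrices of (1,1) and (1,-1) weighted by `x` and `y`. In
  -- this form it can be compared with `resolvent-decomposition`, which has the same signs.
  conjugate-diagonal : ∀ x y j k →
    let H = ⟦ 1# , 1# ∣ 1# , - 1# ⟧ in
    (H *ᴹ ⟦ x , 0# ∣ 0# , y ⟧ *ᴹ H) j k ≈ x + H 1F j * H 1F k * y
  conjugate-diagonal x y j k = entry j k
    where
    H = ⟦ 1# , 1# ∣ 1# , - 1# ⟧
    :H : E.Matrix {2} 2
    :H = E.⟦ con (+ 1) , con (+ 1) ∣ con (+ 1) , :- con (+ 1) ⟧
    :left : Polynomial 2 → Polynomial 2 → E.Matrix {2} 2
    :left x y = (:H E.*ᴹ E.⟦ x , con (+ 0) ∣ con (+ 0) , y ⟧) E.*ᴹ :H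
    entry : ∀ j k → (H *ᴹ ⟦ x , 0# ∣ 0# , y ⟧ *ᴹ H) j k ≈ x + H 1F j * H 1F k * y
    entry 0F 0F = solve 2 (λ x y → :left x y 0F 0F := x :+ :H 1F 0F :* :H 1F 0F :* y) refl x y
    entry 0F 1F = solve 2 (λ x y → :left x y 0F 1F := x :+ :H 1F 0F :* :H 1F 1F :* y) refl x y
    entry 1F 0F = solve 2 (λ x y → :left x y 1F 0F := x :+ :H 1F 1F :* :H 1F 0F :* y) refl x y
    entry 1F 1F = solve 2 (λ x y → :left x y 1F 1F := x :+ :H 1F 1F :* :H 1F 1F :* y) refl x y

  module _ (A : Matrix 2) where
    private
      a = A 0F 0F
      b = A 0F 1F
      c′ = A 1F 0F
      d = A 1F 1F

    det-formula : det A ≈ a * d - b * c′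
    det-formula = solve 4 (λ a b c d → E.det E.⟦ a , b ∣ c , d ⟧ := a :* d :- b :* c) refl a b c′ d

    det-square : det (A *ᴹ A) ≈ det A * det A
    det-square = solve 4 (λ a b c d → let A = E.⟦ a , b ∣ c , d ⟧ in
      E.det (A E.*ᴹ A) := E.det A :* E.det A) refl a b c′ d

  module _ (A : Matrix 2) {s} (s²≈1 : s * s ≈ 1#) (det≈s : det A ≈ s) where
    private
      a = A 0F 0F
      b = A 0F 1F
      c′ = A 1F 0F
      d = A 1F 1F

      adj : Matrix 2
      adj = ⟦ s * d , s * - b ∣ s * - c′ , s * a ⟧

      ad-bc : a * d - b * c′ ≈ s
      ad-bc = trans (sym (det-formula A)) det≈s

    invertible : Invertible A
    invertible = adj
      , (λ { 0F 0F → diag (solve 5 (λ a b c d s →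
                 s :* d :* a :+ (s :* :- b :* c :+ con (+ 0)) := s :* (a :* d :- b :* c)) refl a b c′ d s)
           ; 0F 1F → solve 5 (λ a b c d s →
                 s :* d :* b :+ (s :* :- b :* d :+ con (+ 0)) := con (+ 0)) refl a b c′ d s
           ; 1F 0F → solve 5 (λ a b c d s →
                 s :* :- c :* a :+ (s :* a :* c :+ con (+ 0)) := con (+ 0)) refl a b c′ d s
           ; 1F 1F → diag (solve 5 (λ a b c d s →
                 s :* :- c :* b :+ (s :* a :* d :+ con (+ 0)) := s :* (a :* d :- b :* c)) refl a b c′ d s) })
      , (λ { 0F 0F → diag (solve 5 (λ a b c d s →
                 a :* (s :* d) :+ (b :* (s :* :- c) :+ con (+ 0)) := s :* (a :* d :- b :* c)) refl a b c′ d s)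
           ; 0F 1F → solve 5 (λ a b c d s →
                 a :* (s :* :- b) :+ (b :* (s :* a) :+ con (+ 0)) := con (+ 0)) refl a b c′ d s
           ; 1F 0F → solve 5 (λ a b c d s →
                 c :* (s :* d) :+ (d :* (s :* :- c) :+ con (+ 0)) := con (+ 0)) refl a b c′ d s
           ; 1F 1F → diag (solve 5 (λ a b c d s →
                 c :* (s :* :- b) :+ (d :* (s :* a) :+ con (+ 0)) := s :* (a :* d :- b :* c)) refl a b c′ d s) })
      where
      diag : ∀ {x} → x ≈ s * (a * d - b * c′) → x ≈ 1#
      diag eq = trans eq (trans (*-congˡ ad-bc) s²≈1)

    -- Cramer's rule with `s` in the place of 1 / det A, as s² = 1. Solving for an unknown column
    -- determines the entries of whichever inverse the combined matrix was formed with.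
    cramer₀ : ∀ {x y u v} → a * x + (b * y + 0#) ≈ u → c′ * x + (d * y + 0#) ≈ v → x ≈ s * (d * u - b * v)
    cramer₀ {x} {y} {u} {v} p q = lin₂ (- x) (- (s * x)) s²≈1 ad-bc $
      lin₂ (s * d) (- (s * b)) p q $ solve 9 (λ a b c d s x y u v →
        x := s :* (d :* u :- b :* v) :+ :- x :* (s :* s :- con (+ 1)) :+ :- (s :* x) :* (a :* d :- b :* c :- s)
          :+ s :* d :* (a :* x :+ (b :* y :+ con (+ 0)) :- u) :+ :- (s :* b) :* (c :* x :+ (d :* y :+ con (+ 0)) :- v))
        refl a b c′ d s x y u v

    cramer₁ : ∀ {x y u v} → a * x + (b * y + 0#) ≈ u → c′ * x + (d * y + 0#) ≈ v → y ≈ s * (a * v - c′ * u)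
    cramer₁ {x} {y} {u} {v} p q = lin₂ (- y) (- (s * y)) s²≈1 ad-bc $
      lin₂ (- (s * c′)) (s * a) p q $ solve 9 (λ a b c d s x y u v →
        y := s :* (a :* v :- c :* u) :+ :- y :* (s :* s :- con (+ 1)) :+ :- (s :* y) :* (a :* d :- b :* c :- s)
          :+ :- (s :* c) :* (a :* x :+ (b :* y :+ con (+ 0)) :- u) :+ s :* a :* (c :* x :+ (d :* y :+ con (+ 0)) :- v))
        refl a b c′ d s x y u v

  -- Equivalently, M (1,1) = (1,1) and M (1,-1) = (t + 1) (1,-1).
  record Bisymmetric (M : Matrix 2) (t : Carrier) : Set ℓ where
    field
      diagonal     : M 1F 1F ≈ M 0F 0F
      antidiagonal : M 1F 0F ≈ M 0F 1F
      row-sum      : M 0F 0F + M 0F 1F ≈ 1#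
      row-diff     : M 0F 0F - M 0F 1F ≈ t + 1#

  -- The inverse is `s` times the adjugate, so `𝒞 A A⁻¹` has diagonal entries s·ad and off-diagonal
  -- entries -s·bc. As ad - bc = s, their sum is s² = 1 and their difference s (s + 2bc) = 1 +
  -- 2s·bc.
  𝒞-bisymmetric : ∀ (A : Matrix 2) {s} (A⁻¹ : Invertible A) → s * s ≈ 1# → det A ≈ s →
                  Bisymmetric (𝒞 A A⁻¹) (s * (2ᴿ * A 0F 1F * A 1F 0F))
  𝒞-bisymmetric A {s} (B , _ , AB≈1) s²≈1 det≈s = record
    { diagonal = trans (*-congˡ B₁₁) (trans
        (solve 5 (λ a b c d s → d :* (s :* (a :* con (+ 1) :- c :* con (+ 0))) :=
          a :* (s :* (d :* con (+ 1) :- b :* con (+ 0)))) refl a b c′ d s)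
        (*-congˡ (sym B₀₀)))
    ; antidiagonal = trans (*-congˡ B₀₁) (trans
        (solve 5 (λ a b c d s → c :* (s :* (d :* con (+ 0) :- b :* con (+ 1))) :=
          b :* (s :* (a :* con (+ 0) :- c :* con (+ 1)))) refl a b c′ d s)
        (*-congˡ (sym B₁₀)))
    ; row-sum = trans (+-cong (*-congˡ B₀₀) (*-congˡ B₁₀)) (lin₂ 1# s s²≈1 ad-bc
        (solve 5 (λ a b c d s →
          a :* (s :* (d :* con (+ 1) :- b :* con (+ 0))) :+ b :* (s :* (a :* con (+ 0) :- c :* con (+ 1))) :=
          con (+ 1) :+ con (+ 1) :* (s :* s :- con (+ 1)) :+ s :* (a :* d :- b :* c :- s)) refl a b c′ d s))
    ; row-diff = trans (+-cong (*-congˡ B₀₀) (-‿cong (*-congˡ B₁₀))) (lin₂ 1# s s²≈1 ad-bc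
        (solve 5 (λ a b c d s →
          a :* (s :* (d :* con (+ 1) :- b :* con (+ 0))) :- b :* (s :* (a :* con (+ 0) :- c :* con (+ 1))) :=
          s :* (con (+ 2) :* b :* c) :+ con (+ 1) :+ con (+ 1) :* (s :* s :- con (+ 1)) :+ s :* (a :* d :- b :* c :- s))
          refl a b c′ d s))
    }
    where
    a = A 0F 0F
    b = A 0F 1F
    c′ = A 1F 0F
    d = A 1F 1F
    ad-bc = trans (sym (det-formula A)) det≈s
    B₀₀ = cramer₀ A s²≈1 det≈s (AB≈1 0F 0F) (AB≈1 1F 0F)
    B₁₀ = cramer₁ A s²≈1 det≈s (AB≈1 0F 0F) (AB≈1 1F 0F)
    B₀₁ = cramer₀ A s²≈1 det≈s (AB≈1 0F 1F) (AB≈1 1F 1F)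
    B₁₁ = cramer₁ A s²≈1 det≈s (AB≈1 0F 1F) (AB≈1 1F 1F)

  -- On (1,1) and (1,-1) such a matrix acts by b + e and b - e. `N` acts on the same vectors by the
  -- reciprocals `u` and `v`.
  circulant-invertible : ∀ (B : Matrix 2) {h u v} → h + h ≈ 1# → B 1F 1F ≈ B 0F 0F → B 1F 0F ≈ B 0F 1F →
                         (B 0F 0F + B 0F 1F) * u ≈ 1# → (B 0F 0F - B 0F 1F) * v ≈ 1# → Invertible B
  circulant-invertible B {h} {u} {v} h+h≈1 b′≈b e′≈e b+e b-e = N
    , (λ { 0F 0F → swap (diag refl e′≈e)
         ; 0F 1F → swap (trans (+-congˡ (+-identityʳ _)) (trans (+-comm _ _) (trans (+-congˡ (sym (+-identityʳ _))) (off b′≈b refl))))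
         ; 1F 0F → swap (off refl e′≈e)
         ; 1F 1F → swap (trans (+-congˡ (+-identityʳ _)) (trans (+-comm _ _) (trans (+-congˡ (sym (+-identityʳ _))) (diag b′≈b refl)))) })
    , (λ { 0F 0F → diag refl refl
         ; 0F 1F → off refl refl
         ; 1F 0F → trans (+-congˡ (+-identityʳ _)) (trans (+-comm _ _) (trans (+-congˡ (sym (+-identityʳ _))) (off b′≈b e′≈e)))
         ; 1F 1F → trans (+-congˡ (+-identityʳ _)) (trans (+-comm _ _) (trans (+-congˡ (sym (+-identityʳ _))) (diag b′≈b e′≈e))) })
    where
    b = B 0F 0F
    e = B 0F 1F
    N : Matrix 2
    N = ⟦ h * (u + v) , h * (u - v) ∣ h * (u - v) , h * (u + v) ⟧
    swap : ∀ {x y x′ y′ z} → x * x′ + (y * y′ + 0#) ≈ z → x′ * x + (y′ * y + 0#) ≈ z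
    swap eq = trans (+-cong (*-comm _ _) (+-congʳ (*-comm _ _))) eq
    diag : ∀ {x y} → x ≈ b → y ≈ e → x * (h * (u + v)) + (y * (h * (u - v)) + 0#) ≈ 1#
    diag {x} {y} p q = lin₂ (h * (u + v)) (h * (u - v)) p q $ lin₃ h h 1# b+e b-e h+h≈1 $ solve 7 (λ b e h u v x y →
      x :* (h :* (u :+ v)) :+ (y :* (h :* (u :- v)) :+ con (+ 0)) := con (+ 1)
        :+ h :* (u :+ v) :* (x :- b) :+ h :* (u :- v) :* (y :- e)
        :+ h :* ((b :+ e) :* u :- con (+ 1)) :+ h :* ((b :- e) :* v :- con (+ 1)) :+ con (+ 1) :* (h :+ h :- con (+ 1))) refl b e h u v x y
    off : ∀ {x y} → x ≈ b → y ≈ e → x * (h * (u - v)) + (y * (h * (u + v)) + 0#) ≈ 0#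
    off {x} {y} p q = lin₂ (h * (u - v)) (h * (u + v)) p q $ lin₂ h (- h) b+e b-e $ solve 7 (λ b e h u v x y →
      x :* (h :* (u :- v)) :+ (y :* (h :* (u :+ v)) :+ con (+ 0)) := con (+ 0)
        :+ h :* (u :- v) :* (x :- b) :+ h :* (u :+ v) :* (y :- e)
        :+ h :* ((b :+ e) :* u :- con (+ 1)) :+ :- h :* ((b :- e) :* v :- con (+ 1))) refl b e h u v x y

  module BisymmetricProperties {M t} (bi : Bisymmetric M t) where
    open Bisymmetric bi
    private
      p = M 0F 0F
      q = M 0F 1F
      q′ = M 1F 0F
      p′ = M 1F 1F

    tr-M : tr M ≈ t + 2ᴿ
    tr-M = lin₃ 1# 1# 1# diagonal row-sum row-diff (solve 4 (λ p q p′ t →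
      p :+ (p′ :+ con (+ 0)) := t :+ con (+ 2) :+ con (+ 1) :* (p′ :- p) :+
        con (+ 1) :* (p :+ q :- con (+ 1)) :+ con (+ 1) :* (p :- q :- (t :+ con (+ 1)))) refl p q p′ t)

    det-M : det M ≈ t + 1#
    det-M = lin₂ p (- q) diagonal antidiagonal $ lin₂ (p - q) 1# row-sum row-diff $ solve 5 (λ p q q′ p′ t →
      E.det E.⟦ p , q ∣ q′ , p′ ⟧ := t :+ con (+ 1) :+ p :* (p′ :- p) :+ :- q :* (q′ :- q)
        :+ (p :- q) :* (p :+ q :- con (+ 1)) :+ con (+ 1) :* (p :- q :- (t :+ con (+ 1)))) refl p q q′ p′ t

    det≈tr-1 : det M ≈ tr M - 1#
    det≈tr-1 = trans det-M (lin₁ (- 1#) tr-M (solve 2 (λ t x →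
      t :+ con (+ 1) := x :- con (+ 1) :+ :- con (+ 1) :* (x :- (t :+ con (+ 2)))) refl t (tr M)))

    charPoly-M : charPoly M ≈ₚ (t + 1#) ∷ - (t + 2ᴿ) ∷ 1# ∷ []
    charPoly-M 0 = trans (solve 4 (λ p q q′ p′ →
      E.coeff (E.charPoly E.⟦ p , q ∣ q′ , p′ ⟧) 0 := E.det E.⟦ p , q ∣ q′ , p′ ⟧) refl p q q′ p′) det-M
    charPoly-M 1 = trans (solve 4 (λ p q q′ p′ →
      E.coeff (E.charPoly E.⟦ p , q ∣ q′ , p′ ⟧) 1 := :- E.tr E.⟦ p , q ∣ q′ , p′ ⟧) refl p q q′ p′) (-‿cong tr-M)
    charPoly-M 2 = solve 4 (λ p q q′ p′ →
      E.coeff (E.charPoly E.⟦ p , q ∣ q′ , p′ ⟧) 2 := con (+ 1)) refl p q q′ p′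
    charPoly-M (suc (suc (suc k))) = refl

    charPoly-splits : charPoly M ≈ₚ const 1# *ₚ ((X +ₚ const (- 1#)) *ₚ ((X +ₚ const (- (t + 1#))) *ₚ const 1#))
    charPoly-splits k = trans (charPoly-M k) (expand k)
      where
      :splitting : ∀ {n} → Polynomial n → E.Poly {n}
      :splitting t = let infixl 6 _⊕_ ; _⊕_ = E._+ₚ_ ; infixl 7 _⊗_ ; _⊗_ = E._*ₚ_ in
        E.const (con (+ 1)) ⊗ ((E.X ⊕ E.const (:- con (+ 1))) ⊗ ((E.X ⊕ E.const (:- (t :+ con (+ 1)))) ⊗ E.const (con (+ 1))))
      expand : (t + 1#) ∷ - (t + 2ᴿ) ∷ 1# ∷ [] ≈ₚ const 1# *ₚ ((X +ₚ const (- 1#)) *ₚ ((X +ₚ const (- (t + 1#))) *ₚ const 1#))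
      expand 0 = solve 1 (λ t → t :+ con (+ 1) := E.coeff (:splitting t) 0) refl t
      expand 1 = solve 1 (λ t → :- (t :+ con (+ 2)) := E.coeff (:splitting t) 1) refl t
      expand 2 = solve 1 (λ t → con (+ 1) := E.coeff (:splitting t) 2) refl t
      expand 3 = solve 1 (λ t → con (+ 0) := E.coeff (:splitting t) 3) refl t
      expand 4 = solve 1 (λ t → con (+ 0) := E.coeff (:splitting t) 4) refl t
      expand (suc (suc (suc (suc (suc k))))) = refl

    private
      -- Add the two components of the eigenvalue equation: the columns, like the rows, sum to 1.
      -- Subtracting the components gives `act₂`.
      act₁ : ∀ z u v → p * u + (q * v + 0#) ≈ z * u → q′ * u + (p′ * v + 0#) ≈ z * v →
             (z - 1#) * (u + v) ≈ 0#
      act₁ z u v e₀ e₁ = lin₂ (- 1#) (- 1#) e₀ e₁ $ lin₃ v u (u + v) diagonal antidiagonal row-sum $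
        solve 7 (λ p q q′ p′ z u v → (z :- con (+ 1)) :* (u :+ v) := con (+ 0)
          :+ :- con (+ 1) :* (p :* u :+ (q :* v :+ con (+ 0)) :- z :* u)
          :+ :- con (+ 1) :* (q′ :* u :+ (p′ :* v :+ con (+ 0)) :- z :* v)
          :+ v :* (p′ :- p) :+ u :* (q′ :- q) :+ (u :+ v) :* (p :+ q :- con (+ 1))) refl p q q′ p′ z u v

      act₂ : ∀ z u v → p * u + (q * v + 0#) ≈ z * u → q′ * u + (p′ * v + 0#) ≈ z * v →
             (z - (t + 1#)) * (u - v) ≈ 0#
      act₂ z u v e₀ e₁ = lin₂ (- 1#) 1# e₀ e₁ $ lin₃ (- v) (- u) (u - v) diagonal antidiagonal row-diff $
        solve 8 (λ p q q′ p′ z u v t → (z :- (t :+ con (+ 1))) :* (u :- v) := con (+ 0)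
          :+ :- con (+ 1) :* (p :* u :+ (q :* v :+ con (+ 0)) :- z :* u)
          :+ con (+ 1) :* (q′ :* u :+ (p′ :* v :+ con (+ 0)) :- z :* v)
          :+ :- v :* (p′ :- p) :+ :- u :* (q′ :- q) :+ (u :- v) :* (p :- q :- (t :+ con (+ 1)))) refl p q q′ p′ z u v t

    eigen₊ : ∀ z v → (∀ i → (M ·ᵛ v) i ≈ z * v i) → (z - 1#) * (v 0F + v 1F) ≈ 0#
    eigen₊ z v eq = act₁ z (v 0F) (v 1F) (eq 0F) (eq 1F)

    eigen₋ : ∀ z v → (∀ i → (M ·ᵛ v) i ≈ z * v i) → (z - (t + 1#)) * (v 0F - v 1F) ≈ 0#
    eigen₋ z v eq = act₂ z (v 0F) (v 1F) (eq 0F) (eq 1F)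

    fixed₊ : ∀ i → (M ·ᵛ vec₂ 1# 1#) i ≈ 1# * vec₂ 1# 1# i
    fixed₊ 0F = lin₁ 1# row-sum (solve 2 (λ p q →
      p :* con (+ 1) :+ (q :* con (+ 1) :+ con (+ 0)) := con (+ 1) :* con (+ 1) :+ con (+ 1) :* (p :+ q :- con (+ 1))) refl p q)
    fixed₊ 1F = lin₃ 1# 1# 1# diagonal antidiagonal row-sum (solve 4 (λ p q q′ p′ →
      q′ :* con (+ 1) :+ (p′ :* con (+ 1) :+ con (+ 0)) := con (+ 1) :* con (+ 1)
        :+ con (+ 1) :* (p′ :- p) :+ con (+ 1) :* (q′ :- q) :+ con (+ 1) :* (p :+ q :- con (+ 1))) refl p q q′ p′)

    fixed₋ : ∀ i → (M ·ᵛ vec₂ 1# (- 1#)) i ≈ (t + 1#) * vec₂ 1# (- 1#) i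
    fixed₋ 0F = lin₁ 1# row-diff (solve 3 (λ p q t →
      p :* con (+ 1) :+ (q :* :- con (+ 1) :+ con (+ 0)) := (t :+ con (+ 1)) :* con (+ 1) :+ con (+ 1) :* (p :- q :- (t :+ con (+ 1)))) refl p q t)
    fixed₋ 1F = lin₃ (- 1#) 1# (- 1#) diagonal antidiagonal row-diff (solve 5 (λ p q q′ p′ t →
      q′ :* con (+ 1) :+ (p′ :* :- con (+ 1) :+ con (+ 0)) := (t :+ con (+ 1)) :* :- con (+ 1)
        :+ :- con (+ 1) :* (p′ :- p) :+ con (+ 1) :* (q′ :- q) :+ :- con (+ 1) :* (p :- q :- (t :+ con (+ 1)))) refl p q q′ p′ t)

    module _ {h} (2h²≈1 : h * h * 2ᴿ ≈ 1#) where
      private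
        H P D : Matrix 2
        H = ⟦ 1# , 1# ∣ 1# , - 1# ⟧
        P = h ·ᴹ H
        D = ⟦ 1# , 0# ∣ 0# , t + 1# ⟧

        :P : ∀ {n} → Polynomial n → E.Matrix {n} 2
        :P h = h E.·ᴹ E.⟦ con (+ 1) , con (+ 1) ∣ con (+ 1) , :- con (+ 1) ⟧

        :D : ∀ {n} → Polynomial n → E.Matrix {n} 2
        :D t = E.⟦ con (+ 1) , con (+ 0) ∣ con (+ 0) , t :+ con (+ 1) ⟧

        :PDP : ∀ {n} → Polynomial n → Polynomial n → E.Matrix {n} 2
        :PDP h t = (:P h E.*ᴹ :D t) E.*ᴹ (:P h E.ᵀ)

      symmetric : P ≋ P ᵀ
      symmetric 0F 0F = refl
      symmetric 0F 1F = refl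
      symmetric 1F 0F = refl
      symmetric 1F 1F = refl

      orthogonal : P *ᴹ P ᵀ ≋ 1ᴹ
      orthogonal 0F 0F = lin₁ 1# 2h²≈1 (solve 1 (λ h → (:P h E.*ᴹ (:P h E.ᵀ)) 0F 0F :=
        con (+ 1) :+ con (+ 1) :* (h :* h :* con (+ 2) :- con (+ 1))) refl h)
      orthogonal 0F 1F = solve 1 (λ h → (:P h E.*ᴹ (:P h E.ᵀ)) 0F 1F := con (+ 0)) refl h
      orthogonal 1F 0F = solve 1 (λ h → (:P h E.*ᴹ (:P h E.ᵀ)) 1F 0F := con (+ 0)) refl h
      orthogonal 1F 1F = lin₁ 1# 2h²≈1 (solve 1 (λ h → (:P h E.*ᴹ (:P h E.ᵀ)) 1F 1F :=
        con (+ 1) :+ con (+ 1) :* (h :* h :* con (+ 2) :- con (+ 1))) refl h)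

      private
        entry₀₀ : p ≈ (P *ᴹ D *ᴹ P ᵀ) 0F 0F
        entry₀₀ = lin₃ (- p) (h * h) (h * h) 2h²≈1 row-sum row-diff (solve 4 (λ p q h t →
          p := :PDP h t 0F 0F :+ :- p :* (h :* h :* con (+ 2) :- con (+ 1))
            :+ h :* h :* (p :+ q :- con (+ 1)) :+ h :* h :* (p :- q :- (t :+ con (+ 1)))) refl p q h t)

        entry₀₁ : q ≈ (P *ᴹ D *ᴹ P ᵀ) 0F 1F
        entry₀₁ = lin₃ (- q) (h * h) (- (h * h)) 2h²≈1 row-sum row-diff (solve 4 (λ p q h t →
          q := :PDP h t 0F 1F :+ :- q :* (h :* h :* con (+ 2) :- con (+ 1))
            :+ h :* h :* (p :+ q :- con (+ 1)) :+ :- (h :* h) :* (p :- q :- (t :+ con (+ 1)))) refl p q h t)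

      diagonalisation : M ≋ P *ᴹ D *ᴹ P ᵀ
      diagonalisation 0F 0F = entry₀₀
      diagonalisation 0F 1F = entry₀₁
      diagonalisation 1F 0F = trans antidiagonal (trans entry₀₁
        (solve 2 (λ h t → :PDP h t 0F 1F := :PDP h t 1F 0F) refl h t))
      diagonalisation 1F 1F = trans diagonal (trans entry₀₀
        (solve 2 (λ h t → :PDP h t 0F 0F := :PDP h t 1F 1F) refl h t))

    -- z - M has again equal diagonal and equal antidiagonal entries, with row sum z - 1 and row
    -- difference z - (t + 1).
    resolvent-exists : ∀ {h} → h + h ≈ 1# → ∀ z {u v} → (z - 1#) * u ≈ 1# → (z - (t + 1#)) * v ≈ 1# →
                       Invertible (z ·ᴹ 1ᴹ -ᴹ M)
    resolvent-exists {h} h+h≈1 z {u} {v} e₁ e₂ = circulant-invertible (z ·ᴹ 1ᴹ -ᴹ M) h+h≈1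
      (+-congˡ (-‿cong diagonal)) (+-congˡ (-‿cong antidiagonal))
      (lin₂ (- u) 1# row-sum e₁ (solve 4 (λ p q z u →
        (z :* con (+ 1) :- p :+ (z :* con (+ 0) :- q)) :* u := con (+ 1) :+ :- u :* (p :+ q :- con (+ 1))
          :+ con (+ 1) :* ((z :- con (+ 1)) :* u :- con (+ 1))) refl p q z u))
      (lin₂ (- v) 1# row-diff e₂ (solve 5 (λ p q z v t →
        (z :* con (+ 1) :- p :- (z :* con (+ 0) :- q)) :* v := con (+ 1) :+ :- v :* (p :- q :- (t :+ con (+ 1)))
          :+ con (+ 1) :* ((z :- (t :+ con (+ 1))) :* v :- con (+ 1))) refl p q z v t))

    -- A two-sided inverse N of z - M has N 00 + N 10 = (z - 1)⁻¹ and
    -- N 00 - N 10 = (z - (t + 1))⁻¹, which determines all its entries.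
    module _ {h} (h+h≈1 : h + h ≈ 1#) (z : Carrier) (inv : Invertible (z ·ᴹ 1ᴹ -ᴹ M)) where
      private
        N = proj₁ inv
        n₀ = N 0F 0F
        n₁ = N 1F 0F

      resolvent₊ resolvent₋ : Carrier
      resolvent₊ = N 0F 0F + N 1F 0F
      resolvent₋ = N 0F 0F - N 1F 0F

      private
        column : ∀ u v x y →
          (z * 1# - p) * u + ((z * 0# - q) * v + 0#) ≈ x → (z * 0# - q′) * u + ((z * 1# - p′) * v + 0#) ≈ y →
          (z - 1#) * (u + v) ≈ x + y × (z - (t + 1#)) * (u - v) ≈ x - y
        column u v x y e₀ e₁ =
          (lin₂ 1# 1# e₀ e₁ $ lin₃ v u (u + v) diagonal antidiagonal row-sum $
            solve 9 (λ p q q′ p′ z u v x y → (z :- con (+ 1)) :* (u :+ v) := x :+ y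
              :+ con (+ 1) :* ((z :* con (+ 1) :- p) :* u :+ ((z :* con (+ 0) :- q) :* v :+ con (+ 0)) :- x)
              :+ con (+ 1) :* ((z :* con (+ 0) :- q′) :* u :+ ((z :* con (+ 1) :- p′) :* v :+ con (+ 0)) :- y)
              :+ v :* (p′ :- p) :+ u :* (q′ :- q) :+ (u :+ v) :* (p :+ q :- con (+ 1))) refl p q q′ p′ z u v x y) ,
          (lin₂ 1# (- 1#) e₀ e₁ $ lin₃ (- v) (- u) (u - v) diagonal antidiagonal row-diff $
            solve 10 (λ p q q′ p′ z u v x y t → (z :- (t :+ con (+ 1))) :* (u :- v) := x :- y
              :+ con (+ 1) :* ((z :* con (+ 1) :- p) :* u :+ ((z :* con (+ 0) :- q) :* v :+ con (+ 0)) :- x)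
              :+ :- con (+ 1) :* ((z :* con (+ 0) :- q′) :* u :+ ((z :* con (+ 1) :- p′) :* v :+ con (+ 0)) :- y)
              :+ :- v :* (p′ :- p) :+ :- u :* (q′ :- q) :+ (u :- v) :* (p :- q :- (t :+ con (+ 1)))) refl p q q′ p′ z u v x y t)

        column₀ = column (N 0F 0F) (N 1F 0F) 1# 0# (proj₂ (proj₂ inv) 0F 0F) (proj₂ (proj₂ inv) 1F 0F)
        column₁ = column (N 0F 1F) (N 1F 1F) 0# 1# (proj₂ (proj₂ inv) 0F 1F) (proj₂ (proj₂ inv) 1F 1F)

        unique : ∀ {x y u v} → x * u ≈ 1# → x * v ≈ y → v ≈ y * u
        unique {x} {y} {u} {v} e f = lin₂ (- v) u e f (solve 4 (λ x y u v →
          v := y :* u :+ :- v :* (x :* u :- con (+ 1)) :+ u :* (x :* v :- y)) refl x y u v)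

      resolvent₊-inverse : (z - 1#) * resolvent₊ ≈ 1#
      resolvent₊-inverse = trans (proj₁ column₀) (+-identityʳ 1#)

      resolvent₋-inverse : (z - (t + 1#)) * resolvent₋ ≈ 1#
      resolvent₋-inverse = trans (proj₂ column₀) (solve 0 (con (+ 1) :- con (+ 0) := con (+ 1)) refl)

      -- The spectral decomposition of the resolvent: the projections onto (1,1) and (1,-1) have
      -- entries 1/2 and ±1/2, the signs being products of entries of the second row of the Hadamard
      -- matrix.
      resolvent-decomposition : ∀ j k →
        N j k ≈ h * (resolvent₊ + ⟦ 1# , 1# ∣ 1# , - 1# ⟧ 1F j * ⟦ 1# , 1# ∣ 1# , - 1# ⟧ 1F k * resolvent₋)
      resolvent-decomposition 0F 0F = lin₁ (- n₀) h+h≈1 (solve 3 (λ h u v →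
        u := h :* (u :+ v :+ con (+ 1) :* con (+ 1) :* (u :- v)) :+ :- u :* (h :+ h :- con (+ 1))) refl h n₀ n₁)
      resolvent-decomposition 1F 0F = lin₁ (- n₁) h+h≈1 (solve 3 (λ h u v →
        v := h :* (u :+ v :+ :- con (+ 1) :* con (+ 1) :* (u :- v)) :+ :- v :* (h :+ h :- con (+ 1))) refl h n₀ n₁)
      -- The sum and the difference of the second column solve the same scalar equations as those of
      -- the first, now with right sides 1 and -1; hence they are `resolvent₊` and minus
      -- `resolvent₋`.
      resolvent-decomposition 0F 1F = lin₃ (- N 0F 1F) h h h+h≈1
        (unique resolvent₊-inverse (proj₁ column₁)) (unique resolvent₋-inverse (proj₂ column₁))
        (solve 5 (λ h u v x y →
          x := h :* (u :+ con (+ 1) :* :- con (+ 1) :* v) :+ :- x :* (h :+ h :- con (+ 1))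
            :+ h :* (x :+ y :- (con (+ 0) :+ con (+ 1)) :* u) :+ h :* (x :- y :- (con (+ 0) :- con (+ 1)) :* v))
          refl h resolvent₊ resolvent₋ (N 0F 1F) (N 1F 1F))
      resolvent-decomposition 1F 1F = lin₃ (- N 1F 1F) h (- h) h+h≈1
        (unique resolvent₊-inverse (proj₁ column₁)) (unique resolvent₋-inverse (proj₂ column₁))
        (solve 5 (λ h u v x y →
          y := h :* (u :+ :- con (+ 1) :* :- con (+ 1) :* v) :+ :- y :* (h :+ h :- con (+ 1))
            :+ h :* (x :+ y :- (con (+ 0) :+ con (+ 1)) :* u) :+ :- h :* (x :- y :- (con (+ 0) :- con (+ 1)) :* v))
          refl h resolvent₊ resolvent₋ (N 0F 1F) (N 1F 1F))

-- Evaluation of polynomials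

module Evaluation {c ℓ} (R : CommutativeRing c ℓ) where
  open CommutativeRing R hiding (zero)
  open IntegerSolver R
  open Polynomials rawRing
  open Relation.Binary.Reasoning.Setoid setoid

  private
    product : ∀ {n} → (Fin n → Poly) → Poly
    product = RawSemiringDefinitions.product (RawRing.rawSemiring polyRing)

  eval : Poly → Carrier → Carrier
  eval []      x = 0#
  eval (a ∷ p) x = a + x * eval p x

  eval-0 : ∀ p x → p ≈ₚ [] → eval p x ≈ 0#
  eval-0 []      x eq = refl
  eval-0 (a ∷ p) x eq = begin
    a + x * eval p x  ≈⟨ +-cong (eq 0) (*-congˡ (eval-0 p x (λ k → eq (suc k)))) ⟩
    0# + x * 0#       ≈⟨ +-cong refl (zeroʳ x) ⟩
    0# + 0#           ≈⟨ +-identityˡ 0# ⟩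
    0#                ∎

  eval-cong : ∀ p q x → p ≈ₚ q → eval p x ≈ eval q x
  eval-cong []      q       x eq = sym (eval-0 q x (λ k → sym (eq k)))
  eval-cong (a ∷ p) []      x eq = eval-0 (a ∷ p) x eq
  eval-cong (a ∷ p) (b ∷ q) x eq = +-cong (eq 0) (*-congˡ (eval-cong p q x (λ k → eq (suc k))))

  eval-+ : ∀ p q x → eval (p +ₚ q) x ≈ eval p x + eval q x
  eval-+ []      q       x = sym (+-identityˡ _)
  eval-+ (a ∷ p) []      x = sym (+-identityʳ _)
  eval-+ (a ∷ p) (b ∷ q) x = trans (+-congˡ (*-congˡ (eval-+ p q x)))
    (solve 5 (λ a b x u v → a :+ b :+ x :* (u :+ v) := a :+ x :* u :+ (b :+ x :* v)) refl a b x (eval p x) (eval q x))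

  eval-scale : ∀ a p x → eval (List.map (a *_) p) x ≈ a * eval p x
  eval-scale a []      x = sym (zeroʳ a)
  eval-scale a (b ∷ p) x = trans (+-congˡ (*-congˡ (eval-scale a p x)))
    (solve 4 (λ a b x u → a :* b :+ x :* (a :* u) := a :* (b :+ x :* u)) refl a b x (eval p x))

  eval-* : ∀ p q x → eval (p *ₚ q) x ≈ eval p x * eval q x
  eval-* []      q x = sym (zeroˡ _)
  eval-* (a ∷ p) q x = begin
    eval (List.map (a *_) q +ₚ (0# ∷ p *ₚ q)) x            ≈⟨ eval-+ (List.map (a *_) q) _ x ⟩
    eval (List.map (a *_) q) x + (0# + x * eval (p *ₚ q) x)  ≈⟨ +-cong (eval-scale a q x) (+-congˡ (*-congˡ (eval-* p q x))) ⟩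
    a * eval q x + (0# + x * (eval p x * eval q x))
      ≈⟨ solve 4 (λ a x u v → a :* v :+ (con (+ 0) :+ x :* (u :* v)) := (a :+ x :* u) :* v) refl a x (eval p x) (eval q x) ⟩
    eval (a ∷ p) x * eval q x                              ∎

  eval-product-0 : ∀ {n} (f : Fin n → Poly) i x → eval (f i) x ≈ 0# → eval (product f) x ≈ 0#
  eval-product-0 f zero    x eq = trans (eval-* (f zero) _ x) (trans (*-congʳ eq) (zeroˡ _))
  eval-product-0 f (suc i) x eq = trans (eval-* (f zero) _ x)
    (trans (*-congˡ (eval-product-0 (λ j → f (suc j)) i x eq)) (zeroʳ _))

  -- Turns the formal factorisation that comes with a splitting field into an equation for each of
  -- its roots, which is a zero of its own linear factor.
  root-of-product : ∀ p a {n} (r : Fin n → Carrier) →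
                    p ≈ₚ const a *ₚ product (λ i → X +ₚ const (- r i)) → ∀ i → eval p (r i) ≈ 0#
  root-of-product p a r eq i = trans (eval-cong p (const a *ₚ product f) (r i) eq)
    (trans (eval-* (const a) (product f) (r i)) (trans (*-congˡ (eval-product-0 f i (r i)
      (solve 1 (λ x → con (+ 0) :+ :- x :+ x :* (con (+ 1) :+ x :* con (+ 0)) := con (+ 0)) refl (r i))))
      (zeroʳ _)))
    where f = λ j → X +ₚ const (- r j)

-- Finite sums, partial sums of power series, means over 2ᵐ terms

module PowerSums {c ℓ} (R : CommutativeRing c ℓ) where
  open CommutativeRing R hiding (zero)
  open IntegerSolver R
  open LinearCombination R
  open Algebra.Properties.CommutativeMonoid.Sum +-commutativeMonoid using (sum; sum-cong-≋; sum-replicate; ∑-distrib-+) public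
  open Algebra.Properties.Semiring.Sum semiring using (*-distribˡ-sum) public
  open Algebra.Properties.Semiring.Exp semiring using (_^_; ^-congˡ; ^-homo-*; ^-assocʳ) public
  open Algebra.Properties.CommutativeSemiring.Exp commutativeSemiring using (^-distrib-*) public
  open Algebra.Properties.Semiring.Mult semiring using (×-homo-+) renaming (_×_ to _×#_) public
  open Relation.Binary.Reasoning.Setoid setoid

  1^n≈1 : ∀ n → 1# ^ n ≈ 1#
  1^n≈1 zero    = refl
  1^n≈1 (suc n) = trans (*-identityˡ _) (1^n≈1 n)

  sum-split : ∀ m n (g : ℕ → Carrier) →
              sum {m ℕ.+ n} (λ k → g (toℕ k)) ≈ sum {m} (λ k → g (toℕ k)) + sum {n} (λ k → g (m ℕ.+ toℕ k))
  sum-split zero    n g = sym (+-identityˡ _)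
  sum-split (suc m) n g = trans (+-congˡ (sum-split m n (λ k → g (suc k)))) (sym (+-assoc _ _ _))

  partialSum : (ℕ → Carrier) → ℕ → Carrier → Carrier
  partialSum a N w = sum {N} λ k → a (toℕ k) * w ^ toℕ k

  partialSum-suc : ∀ a N w → partialSum a (suc N) w ≈ partialSum a N w + a N * w ^ N
  partialSum-suc a N w = begin
    sum {suc N} (λ k → g (toℕ k))                       ≡⟨ ≡.cong (λ n → sum {n} (λ k → g (toℕ k))) (ℕ.+-comm 1 N) ⟩
    sum {N ℕ.+ 1} (λ k → g (toℕ k))                     ≈⟨ sum-split N 1 g ⟩
    partialSum a N w + (g (N ℕ.+ 0) + 0#)               ≈⟨ +-congˡ (+-identityʳ _) ⟩
    partialSum a N w + g (N ℕ.+ 0)                      ≡⟨ ≡.cong (λ n → partialSum a N w + g n) (ℕ.+-identityʳ N) ⟩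
    partialSum a N w + g N                              ∎
    where g = λ n → a n * w ^ n

  partialSum-step : ∀ a n k w → partialSum a n w - partialSum a k w + a n * w ^ n ≈ partialSum a (suc n) w - partialSum a k w
  partialSum-step a n k w = lin₁ (- 1#) (partialSum-suc a n w) (solve 4 (λ s t u v →
    s :- t :+ u := v :- t :+ :- con (+ 1) :* (v :- (s :+ u))) refl (partialSum a n w) (partialSum a k w) (a n * w ^ n) (partialSum a (suc n) w))

  partialSum-diff : ∀ a n w l → partialSum a (suc n) w - l + - (partialSum a n w - l) ≈ a n * w ^ n
  partialSum-diff a n w l = lin₁ 1# (partialSum-suc a n w) (solve 4 (λ s l u v →
    v :- l :+ :- (s :- l) := u :+ con (+ 1) :* (v :- (s :+ u))) refl (partialSum a n w) l (a n * w ^ n) (partialSum a (suc n) w))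

  sum-0 : ∀ n {f : Fin n → Carrier} → (∀ i → f i ≈ 0#) → sum f ≈ 0#
  sum-0 zero    eq = refl
  sum-0 (suc n) eq = trans (+-cong (eq zero) (sum-0 n (λ i → eq (suc i)))) (+-identityˡ 0#)

  partialSum-0 : ∀ a N {w} → w ≈ 0# → partialSum a (suc N) w ≈ a 0
  partialSum-0 a N w≈0 = trans (+-cong (*-identityʳ (a 0)) (sum-0 N (λ k →
    trans (*-congˡ (trans (*-congʳ w≈0) (zeroˡ _))) (zeroʳ _)))) (+-identityʳ (a 0))

  partialSum-cong : ∀ a N {v w} → v ≈ w → partialSum a N v ≈ partialSum a N w
  partialSum-cong a N v≈w = sum-cong-≋ {N} (λ k → *-congˡ (^-congˡ (toℕ k) v≈w))

  rescale-term : ∀ a {r i} w n → r * i ≈ 1# → a * r ^ n * (w * i) ^ n ≈ a * w ^ n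
  rescale-term a {r} {i} w n ri≈1 = begin
    a * r ^ n * (w * i) ^ n      ≈⟨ *-congˡ (^-distrib-* w i n) ⟩
    a * r ^ n * (w ^ n * i ^ n)  ≈⟨ solve 4 (λ a r w i → a :* r :* (w :* i) := a :* w :* (r :* i)) refl a (r ^ n) (w ^ n) (i ^ n) ⟩
    a * w ^ n * (r ^ n * i ^ n)  ≈⟨ *-congˡ (^-distrib-* r i n) ⟨
    a * w ^ n * (r * i) ^ n      ≈⟨ *-congˡ (trans (^-congˡ n ri≈1) (1^n≈1 n)) ⟩
    a * w ^ n * 1#               ≈⟨ *-identityʳ _ ⟩
    a * w ^ n                    ∎

  module _ {h} (h+h≈1 : h + h ≈ 1#) where

    h^m*2^m : ∀ m x → h ^ m * ((2 ℕ.^ m) ×# x) ≈ x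
    h^m*2^m zero    x = trans (*-identityˡ _) (+-identityʳ x)
    h^m*2^m (suc m) x = begin
      h * h ^ m * ((n ℕ.+ (n ℕ.+ 0)) ×# x)    ≡⟨ ≡.cong (λ k → h * h ^ m * ((n ℕ.+ k) ×# x)) (ℕ.+-identityʳ n) ⟩
      h * h ^ m * ((n ℕ.+ n) ×# x)            ≈⟨ *-congˡ (×-homo-+ x n n) ⟩
      h * h ^ m * (n ×# x + n ×# x)           ≈⟨ solve 3 (λ h p y → h :* p :* (y :+ y) := (h :+ h) :* (p :* y)) refl h (h ^ m) (n ×# x) ⟩
      (h + h) * (h ^ m * (n ×# x))            ≈⟨ *-cong h+h≈1 (h^m*2^m m x) ⟩
      1# * x                                  ≈⟨ *-identityˡ x ⟩
      x                                       ∎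
      where n = 2 ℕ.^ m

    mean : ∀ m → (Fin (2 ℕ.^ m) → Carrier) → Carrier
    mean m g = h ^ m * sum g

    mean-cong : ∀ m {f g} → (∀ k → f k ≈ g k) → mean m f ≈ mean m g
    mean-cong m f≈g = *-congˡ (sum-cong-≋ f≈g)

    mean-+ : ∀ m f g → mean m (λ k → f k + g k) ≈ mean m f + mean m g
    mean-+ m f g = trans (*-congˡ (∑-distrib-+ f g)) (distribˡ _ _ _)

    mean-*ˡ : ∀ m a g → mean m (λ k → a * g k) ≈ a * mean m g
    mean-*ˡ m a g = trans (*-congˡ (sym (*-distribˡ-sum a g)))
      (solve 3 (λ p a s → p :* (a :* s) := a :* (p :* s)) refl (h ^ m) a (sum g))

    mean-const : ∀ m a → mean m (λ _ → a) ≈ a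
    mean-const m a = trans (*-congˡ (sum-replicate (2 ℕ.^ m))) (h^m*2^m m a)

-- Means of powers over the dyadic roots of unity

parity : ∀ n → ∃[ k ] (n ≡ k ℕ.+ k ⊎ n ≡ suc (k ℕ.+ k))
parity zero    = 0 , inj₁ ≡.refl
parity (suc n) with parity n
... | k , inj₁ ≡.refl = k , inj₂ ≡.refl
... | k , inj₂ ≡.refl = suc k , inj₁ (≡.cong suc (≡.sym (ℕ.+-suc k k)))

module DyadicMeans {c ℓ} (R : CommutativeRing c ℓ) where
  open CommutativeRing R
  open IntegerSolver R
  open LinearCombination R
  open PowerSums R
  open Relation.Binary.Reasoning.Setoid setoid

  module Nodes {h : Carrier} (h+h≈1 : h + h ≈ 1#) (ζ : ℕ → Carrier) (ζ-one : ζ 1 ≈ - 1#)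
    (ζ-square : ∀ m → ζ (suc m) * ζ (suc m) ≈ ζ m) where

    -- Repeated squaring descends to `ζ 1`, which is -1; this is the form in which primitivity of
    -- the root enters.
    ζ-half : ∀ m → ζ (suc m) ^ (2 ℕ.^ m) ≈ - 1#
    ζ-half ℕ.zero  = trans (*-identityʳ _) ζ-one
    ζ-half (suc m) = begin
      ζ (suc (suc m)) ^ (2 ℕ.* 2 ℕ.^ m)     ≈⟨ ^-assocʳ (ζ (suc (suc m))) 2 (2 ℕ.^ m) ⟨
      (ζ (suc (suc m)) ^ 2) ^ (2 ℕ.^ m)     ≈⟨ ^-congˡ (2 ℕ.^ m) (trans (*-congˡ (*-identityʳ _)) (ζ-square (suc m))) ⟩
      ζ (suc m) ^ (2 ℕ.^ m)                 ≈⟨ ζ-half m ⟩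
      - 1#                                  ∎

    -1^k+k : ∀ k → (- 1#) ^ (k ℕ.+ k) ≈ 1#
    -1^k+k k = begin
      (- 1#) ^ (k ℕ.+ k)          ≈⟨ ^-homo-* (- 1#) k k ⟩
      (- 1#) ^ k * (- 1#) ^ k     ≈⟨ ^-distrib-* (- 1#) (- 1#) k ⟨
      (- 1# * - 1#) ^ k           ≈⟨ ^-congˡ k (solve 0 (:- con (+ 1) :* :- con (+ 1) := con (+ 1)) refl) ⟩
      1# ^ k                      ≈⟨ 1^n≈1 k ⟩
      1#                          ∎

    ζ-even-power : ∀ m j k → (ζ (suc m) ^ j) ^ (k ℕ.+ k) ≈ (ζ m ^ j) ^ k
    ζ-even-power m j k = begin
      (ζ (suc m) ^ j) ^ (k ℕ.+ k)                        ≈⟨ ^-homo-* _ k k ⟩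
      (ζ (suc m) ^ j) ^ k * (ζ (suc m) ^ j) ^ k          ≈⟨ ^-distrib-* _ _ k ⟨
      (ζ (suc m) ^ j * ζ (suc m) ^ j) ^ k                ≈⟨ ^-congˡ k (^-distrib-* _ _ j) ⟨
      ((ζ (suc m) * ζ (suc m)) ^ j) ^ k                  ≈⟨ ^-congˡ k (^-congˡ j (ζ-square m)) ⟩
      (ζ m ^ j) ^ k                                      ∎

    -- The nodes with indices j and 2ᵐ + j are opposite, so the second half of the sum is (-1)ⁿ
    -- times the first.
    halves : ∀ m n → sum {2 ℕ.^ suc m} (λ k → (ζ (suc m) ^ toℕ k) ^ n) ≈
             (1# + (- 1#) ^ n) * sum {2 ℕ.^ m} (λ k → (ζ (suc m) ^ toℕ k) ^ n)
    halves m n = begin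
      sum {M ℕ.+ (M ℕ.+ 0)} (λ k → g (toℕ k))     ≡⟨ ≡.cong (λ j → sum {M ℕ.+ j} (λ k → g (toℕ k))) (ℕ.+-identityʳ M) ⟩
      sum {M ℕ.+ M} (λ k → g (toℕ k))             ≈⟨ sum-split M M g ⟩
      s + sum {M} (λ k → g (M ℕ.+ toℕ k))         ≈⟨ +-congˡ (sum-cong-≋ {M} (λ k → shift (toℕ k))) ⟩
      s + sum {M} (λ k → (- 1#) ^ n * g (toℕ k))  ≈⟨ +-congˡ (*-distribˡ-sum ((- 1#) ^ n) (λ k → g (toℕ {M} k))) ⟨
      s + (- 1#) ^ n * s                          ≈⟨ solve 2 (λ p s → s :+ p :* s := (con (+ 1) :+ p) :* s) refl ((- 1#) ^ n) s ⟩
      (1# + (- 1#) ^ n) * s                       ∎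
      where
      M = 2 ℕ.^ m
      g = λ j → (ζ (suc m) ^ j) ^ n
      s = sum {M} (λ k → g (toℕ k))
      shift : ∀ j → g (M ℕ.+ j) ≈ (- 1#) ^ n * g j
      shift j = begin
        (ζ (suc m) ^ (M ℕ.+ j)) ^ n               ≈⟨ ^-congˡ n (^-homo-* _ M j) ⟩
        (ζ (suc m) ^ M * ζ (suc m) ^ j) ^ n       ≈⟨ ^-congˡ n (*-congʳ (ζ-half m)) ⟩
        (- 1# * ζ (suc m) ^ j) ^ n                ≈⟨ ^-distrib-* _ _ n ⟩
        (- 1#) ^ n * g j                          ∎

    -- For odd `n` opposite nodes cancel; for n = 2k the sum is twice the sum of k-th powers one
    -- level down, with 0 < k < 2ᵐ. The induction replaces the geometric sum, which would require
    -- dividing by ζⁿ - 1.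
    sum-powers : ∀ m n → 0 ℕ.< n → n ℕ.< 2 ℕ.^ m → sum {2 ℕ.^ m} (λ k → (ζ m ^ toℕ k) ^ n) ≈ 0#
    sum-powers ℕ.zero  n 0<n n<1 = ⊥-elim (ℕ.<-irrefl ≡.refl (ℕ.<-≤-trans n<1 0<n))
    sum-powers (suc m) n 0<n n<M with parity n
    ... | k , inj₂ ≡.refl = trans (halves m n) (trans
          (*-congʳ (trans (+-congˡ (*-congˡ (-1^k+k k))) (solve 0 (con (+ 1) :+ :- con (+ 1) :* con (+ 1) := con (+ 0)) refl)))
          (zeroˡ _))
    ... | k , inj₁ ≡.refl = trans (halves m n) (trans
          (*-congˡ (trans (sum-cong-≋ {2 ℕ.^ m} (λ j → ζ-even-power m (toℕ j) k)) (sum-powers m k (0<k k 0<n) k<M)))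
          (zeroʳ _))
      where
      0<k : ∀ k → 0 ℕ.< k ℕ.+ k → 0 ℕ.< k
      0<k (suc k) _ = ℕ.s≤s ℕ.z≤n
      k<M : k ℕ.< 2 ℕ.^ m
      k<M = ℕ.*-cancelˡ-< 2 k (2 ℕ.^ m) (≡.subst (ℕ._< 2 ℕ.^ suc m) (≡.cong (k ℕ.+_) (≡.sym (ℕ.+-identityʳ k))) n<M)

    module _ (ρ : Carrier) where

      w : ∀ m → Fin (2 ℕ.^ m) → Carrier
      w m k = ρ * ζ m ^ toℕ k

      avg : ∀ m → (Fin (2 ℕ.^ m) → Carrier) → Carrier
      avg = mean h+h≈1

      avg-power : ∀ m n a → 0 ℕ.< n → n ℕ.< 2 ℕ.^ m → avg m (λ k → a * w m k ^ n) ≈ 0#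
      avg-power m n a 0<n n<M = begin
        avg m (λ k → a * w m k ^ n)                    ≈⟨ mean-*ˡ h+h≈1 m a _ ⟩
        a * avg m (λ k → w m k ^ n)                    ≈⟨ *-congˡ (mean-cong h+h≈1 m (λ k → ^-distrib-* ρ (ζ m ^ toℕ k) n)) ⟩
        a * avg m (λ k → ρ ^ n * (ζ m ^ toℕ k) ^ n)    ≈⟨ *-congˡ (mean-*ˡ h+h≈1 m (ρ ^ n) _) ⟩
        a * (ρ ^ n * avg m (λ k → (ζ m ^ toℕ k) ^ n))  ≈⟨ *-congˡ (*-congˡ (*-congˡ (sum-powers m n 0<n n<M))) ⟩
        a * (ρ ^ n * (h ^ m * 0#))                     ≈⟨ solve 3 (λ a b c → a :* (b :* (c :* con (+ 0))) := con (+ 0)) refl a (ρ ^ n) (h ^ m) ⟩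
        0#                                             ∎

      avg-partialSum : ∀ m a N → suc N ℕ.≤ 2 ℕ.^ m → avg m (λ k → partialSum a (suc N) (w m k)) ≈ a 0
      avg-partialSum m a ℕ.zero  1≤M = trans
        (mean-cong h+h≈1 m (λ k → trans (+-identityʳ _) (*-identityʳ (a 0)))) (mean-const h+h≈1 m (a 0))
      avg-partialSum m a (suc N) N<M = begin
        avg m (λ k → partialSum a (suc (suc N)) (w m k))
          ≈⟨ mean-cong h+h≈1 m (λ k → partialSum-suc a (suc N) (w m k)) ⟩
        avg m (λ k → partialSum a (suc N) (w m k) + a (suc N) * w m k ^ suc N)
          ≈⟨ mean-+ h+h≈1 m _ _ ⟩
        avg m (λ k → partialSum a (suc N) (w m k)) + avg m (λ k → a (suc N) * w m k ^ suc N)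
          ≈⟨ +-cong (avg-partialSum m a N (ℕ.<⇒≤ N<M)) (avg-power m (suc N) (a (suc N)) (ℕ.s≤s ℕ.z≤n) N<M) ⟩
        a 0 + 0#
          ≈⟨ +-identityʳ (a 0) ⟩
        a 0 ∎

      -- Here x stands for w / (w - δ).
      avg-shift : ∀ m n δ (x : Fin (2 ℕ.^ m) → Carrier) → (∀ k → w m k * x k ≈ w m k + δ * x k) →
                  suc n ℕ.< 2 ℕ.^ m → avg m (λ k → w m k ^ suc n * x k) ≈ δ * avg m (λ k → w m k ^ n * x k)
      avg-shift m n δ x eq n<M = begin
        avg m (λ k → w m k ^ suc n * x k)
          ≈⟨ mean-cong h+h≈1 m (λ k → lin₁ (w m k ^ n) (eq k) (solve 4 (λ w p x δ →
               w :* p :* x := con (+ 1) :* (w :* p) :+ δ :* (p :* x) :+ p :* (w :* x :- (w :+ δ :* x))) refl (w m k) (w m k ^ n) (x k) δ)) ⟩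
        avg m (λ k → 1# * w m k ^ suc n + δ * (w m k ^ n * x k))
          ≈⟨ mean-+ h+h≈1 m _ _ ⟩
        avg m (λ k → 1# * w m k ^ suc n) + avg m (λ k → δ * (w m k ^ n * x k))
          ≈⟨ +-cong (avg-power m (suc n) 1# (ℕ.s≤s ℕ.z≤n) n<M) (mean-*ˡ h+h≈1 m δ _) ⟩
        0# + δ * avg m (λ k → w m k ^ n * x k)
          ≈⟨ +-identityˡ _ ⟩
        δ * avg m (λ k → w m k ^ n * x k) ∎

      -- With x = w/(w - δ) and v = 1/δ, each use of the equation for `x` splits off one more term
      -- of the geometric series in vw; that term is a power of `w` of positive exponent below 2ᵐ
      -- and has mean zero.
      avg-contract : ∀ m n v (x : Fin (2 ℕ.^ m) → Carrier) → (∀ k → x k ≈ v * w m k * x k - v * w m k) →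
                     n ℕ.< 2 ℕ.^ m → avg m x ≈ avg m (λ k → (v * w m k) ^ n * x k)
      avg-contract m ℕ.zero  v x eq _   = mean-cong h+h≈1 m (λ k → sym (*-identityˡ (x k)))
      avg-contract m (suc n) v x eq n<M = begin
        avg m x
          ≈⟨ avg-contract m n v x eq (ℕ.<⇒≤ n<M) ⟩
        avg m (λ k → (v * w m k) ^ n * x k)
          ≈⟨ mean-cong h+h≈1 m (λ k → trans
               (lin₁ ((v * w m k) ^ n) (eq k) (solve 3 (λ y p x →
                 p :* x := y :* p :* x :+ :- con (+ 1) :* (y :* p) :+ p :* (x :- (y :* x :- y))) refl (v * w m k) ((v * w m k) ^ n) (x k)))
               (+-congˡ (trans (*-congˡ (^-distrib-* v (w m k) (suc n))) (sym (*-assoc _ _ _))))) ⟩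
        avg m (λ k → (v * w m k) ^ suc n * x k + - 1# * v ^ suc n * w m k ^ suc n)
          ≈⟨ mean-+ h+h≈1 m _ _ ⟩
        avg m (λ k → (v * w m k) ^ suc n * x k) + avg m (λ k → - 1# * v ^ suc n * w m k ^ suc n)
          ≈⟨ +-congˡ (avg-power m (suc n) (- 1# * v ^ suc n) (ℕ.s≤s ℕ.z≤n) n<M) ⟩
        avg m (λ k → (v * w m k) ^ suc n * x k) + 0#
          ≈⟨ +-identityʳ _ ⟩
        avg m (λ k → (v * w m k) ^ suc n * x k) ∎

-- Eigenvalues, eigenbasis, splitting fields and the Galois group

module TwoRoots {c ℓ₁ ℓ₂} (Rl : Reals c ℓ₁ ℓ₂) where
  private
    module ℝ where
      open Reals Rl public
      open OrderedField Rl public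
  open Complex Rl
  open ComplexField Rl
  open CommutativeRing ℂ-commutativeRing using (refl; sym; trans; reflexive; *-congʳ; *-identityˡ; +-identityˡ; *-comm; zeroˡ)
  open IntegerSolver ℂ-commutativeRing
  open LinearCombination ℂ-commutativeRing
  open Evaluation ℂ-commutativeRing
  open PowerSums ℂ-commutativeRing using (sum-0)
  open TwoByTwo ℂ-commutativeRing using (Bisymmetric; module BisymmetricProperties)

  x-y≈0⇒x≈y : ∀ {x y} → x - y ≈ 0# → x ≈ y
  x-y≈0⇒x≈y {x} {y} eq = lin₁ 1# eq
    (solve 2 (λ x y → x := y :+ con (+ 1) :* (x :- y :- con (+ 0))) refl x y)

  -- Constructively, a vanishing product does not tell which factor vanishes, but
  -- r cannot be close to both a and b.
  one-of-two-roots : ∀ {a b r} → a # b → (r - a) * (r - b) ≈ 0# → r ≈ a ⊎ r ≈ b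
  one-of-two-roots {a} {b} {r} a#b eq =
    [ (λ a#r → inj₂ (x-y≈0⇒x≈y (*-cancel-0 (#-0ˡ (#-sym a#r)) eq)))
    , (λ r#b → inj₁ (x-y≈0⇒x≈y (*-cancel-0 (#-0ˡ r#b) (trans (*-comm _ _) eq))))
    ]′ (#-cotrans a#b r)

  1#-1 : 1# # - 1#
  1#-1 = inj₁ (ℝ.#-sym (ℝ.<⇒# (ℝ.0<⇒< ℝ.0<2 (ℝ.solve 0 (ℝ.con (+ 1) ℝ.:- (ℝ.:- ℝ.con (+ 1)) ℝ.:= ℝ.con (+ 2)) ℝ.refl))))

  square-1 : ∀ {x} → x * x ≈ 1# → x ≈ 1# ⊎ x ≈ - 1#
  square-1 {x} eq = one-of-two-roots 1#-1 (lin₁ 1# eq (solve 1 (λ x →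
    (x :- con (+ 1)) :* (x :- :- con (+ 1)) := con (+ 0) :+ con (+ 1) :* (x :* x :- con (+ 1))) refl x))

  fromSign-square : ∀ s → fromSign s * fromSign s ≈ 1#
  fromSign-square Sign.+ = *-identityˡ 1#
  fromSign-square Sign.- = solve 0 (:- con (+ 1) :* :- con (+ 1) := con (+ 1)) refl

  ½ᶜ : ℂ
  ½ᶜ = fromℚ ½

  ½ᶜ+½ᶜ≈1 : ½ᶜ + ½ᶜ ≈ 1#
  ½ᶜ+½ᶜ≈1 = ℝ.½+½≈1 , ℝ.+-identityˡ ℝ.0#

  #-+ : ∀ {x y} → x + y # 0# → x # 0# ⊎ y # 0#
  #-+ {x} {y} p = [ (λ q → inj₁ (#-resp (solve 2 (λ x y → x :+ y :- y := x) refl x y) refl (#-0ˡ q))) , inj₂ ]′ (#-cotrans p y)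

  average : ∀ x y → ½ᶜ * (x + y) + ½ᶜ * (x - y) ≈ x
  average x y = lin₁ x ½ᶜ+½ᶜ≈1 (solve 3 (λ h x y →
    h :* (x :+ y) :+ h :* (x :- y) := x :+ x :* (h :+ h :- con (+ 1))) refl ½ᶜ x y)

  average′ : ∀ x y → ½ᶜ * (x + y) + - ½ᶜ * (x - y) ≈ y
  average′ x y = lin₁ y ½ᶜ+½ᶜ≈1 (solve 3 (λ h x y →
    h :* (x :+ y) :+ :- h :* (x :- y) := y :+ y :* (h :+ h :- con (+ 1))) refl ½ᶜ x y)

  -- Each component is half the sum plus or minus half the difference, so by cotransitivity one of
  -- these two is apart from zero. This is what decides which eigenvalue a given eigenvector belongs
  -- to.
  sum-or-difference : ∀ v → NonZeroVector {2} v → v 0F + v 1F # 0# ⊎ v 0F - v 1F # 0#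
  sum-or-difference v (0F , p) = [ (λ q → inj₁ (*-#0ʳ q)) , (λ q → inj₂ (*-#0ʳ q)) ]′
    (#-+ (#-resp (sym (average (v 0F) (v 1F))) refl p))
  sum-or-difference v (1F , p) = [ (λ q → inj₁ (*-#0ʳ q)) , (λ q → inj₂ (*-#0ʳ q)) ]′
    (#-+ (#-resp (sym (average′ (v 0F) (v 1F))) refl p))

  module _ {M t} (bi : Bisymmetric M t) where
    open BisymmetricProperties bi

    eigenpair₊ : IsEigenpair M 1# (vec₂ 1# 1#)
    eigenpair₊ = (0F , 1#0) , fixed₊

    eigenpair₋ : IsEigenpair M (t + 1#) (vec₂ 1# (- 1#))
    eigenpair₋ = (0F , 1#0) , fixed₋

    eigenvalues : ∀ z → IsEigenvalue M z ⇔ (z ≈ 1# ⊎ z ≈ t + 1#)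
    eigenvalues z = mk⇔
      (λ (v , v≉0 , eq) →
        [ (λ p → inj₁ (x-y≈0⇒x≈y (*-cancel-0 p (trans (*-comm _ _) (eigen₊ z v eq)))))
        , (λ p → inj₂ (x-y≈0⇒x≈y (*-cancel-0 p (trans (*-comm _ _) (eigen₋ z v eq)))))
        ]′ (sum-or-difference v v≉0))
      [ (λ z≈1 → vec₂ 1# 1# , (0F , 1#0) , λ i → trans (fixed₊ i) (*-congʳ (sym z≈1)))
      , (λ z≈t+1 → vec₂ 1# (- 1#) , (0F , 1#0) , λ i → trans (fixed₋ i) (*-congʳ (sym z≈t+1)))
      ]′

  module _ {k} (F : Subfield k) where
    open Subfield F renaming (resp to ∈-resp)

    ½∈ : ½ᶜ ∈ Member F
    ½∈ = let (w , w∈ , 2w≈1) = inv∈ (+∈ 1∈ 1∈) 2≉0 in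
      ∈-resp (lin₂ (- w) ½ᶜ ½ᶜ+½ᶜ≈1 2w≈1 (solve 2 (λ h w →
        w := h :+ :- w :* (h :+ h :- con (+ 1)) :+ h :* ((con (+ 1) :+ con (+ 1)) :* w :- con (+ 1))) refl ½ᶜ w)) w∈
      where
      2≉0 : ¬ 1# + 1# ≈ 0#
      2≉0 2≈0 = #-irrefl (lin₂ (- 1#) ½ᶜ ½ᶜ+½ᶜ≈1 2≈0 (solve 1 (λ h →
        con (+ 1) := con (+ 0) :+ :- con (+ 1) :* (h :+ h :- con (+ 1)) :+ h :* (con (+ 1) :+ con (+ 1) :- con (+ 0))) refl ½ᶜ)) 1#0

    eigenbasis : IsBasis F (vec₂ 1# 1# ∷ᵛ vec₂ 1# (- 1#) ∷ᵛ []ᵛ)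
    eigenbasis = record
      { over = λ { 0F 0F → 1∈ ; 0F 1F → 1∈ ; 1F 0F → 1∈ ; 1F 1F → -∈ 1∈ }
      ; spanning = λ v v∈ →
          (½ᶜ * (v 0F + v 1F) ∷ᵛ ½ᶜ * (v 0F - v 1F) ∷ᵛ []ᵛ) ,
          (λ { 0F → *∈ ½∈ (+∈ (v∈ 0F) (v∈ 1F)) ; 1F → *∈ ½∈ (+∈ (v∈ 0F) (-∈ (v∈ 1F))) }) ,
          (λ { 0F → trans (sym (average (v 0F) (v 1F))) (solve 2 (λ x y →
                 x :+ y := x :* con (+ 1) :+ (y :* con (+ 1) :+ con (+ 0))) refl _ _)
             ; 1F → trans (sym (average′ (v 0F) (v 1F))) (solve 3 (λ h x y →
                 h :* x :+ :- h :* y := h :* x :* con (+ 1) :+ (h :* y :* :- con (+ 1) :+ con (+ 0))) refl ½ᶜ (v 0F + v 1F) (v 0F - v 1F)) })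
      ; independent = λ a _ eq → let (p , q) = independence (a 0F) (a 1F) (eq 0F) (eq 1F) in
          λ { 0F → p ; 1F → q }
      }
      where
      independence : ∀ x y → x * 1# + (y * 1# + 0#) ≈ 0# → x * 1# + (y * - 1# + 0#) ≈ 0# → x ≈ 0# × y ≈ 0#
      independence x y p q =
        lin₃ (- x) ½ᶜ ½ᶜ ½ᶜ+½ᶜ≈1 p q (solve 3 (λ h x y → x := con (+ 0) :+ :- x :* (h :+ h :- con (+ 1))
          :+ h :* (x :* con (+ 1) :+ (y :* con (+ 1) :+ con (+ 0)) :- con (+ 0))
          :+ h :* (x :* con (+ 1) :+ (y :* :- con (+ 1) :+ con (+ 0)) :- con (+ 0))) refl ½ᶜ x y) ,
        lin₃ (- y) ½ᶜ (- ½ᶜ) ½ᶜ+½ᶜ≈1 p q (solve 3 (λ h x y → y := con (+ 0) :+ :- y :* (h :+ h :- con (+ 1))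
          :+ h :* (x :* con (+ 1) :+ (y :* con (+ 1) :+ con (+ 0)) :- con (+ 0))
          :+ :- h :* (x :* con (+ 1) :+ (y :* :- con (+ 1) :+ con (+ 0)) :- con (+ 0))) refl ½ᶜ x y)

    -- Only inverses need an argument: the subfield supplies an inverse of its own, which uniqueness
    -- identifies with the given one.
    adjoin⊆ : ∀ {m} {S : Fin m → ℂ} → (∀ i → S i ∈ Member F) → ∀ {z} → Adjoin F S z → z ∈ Member F
    adjoin⊆ S∈ (base z∈)   = z∈
    adjoin⊆ S∈ (gen i)     = S∈ i
    adjoin⊆ S∈ (resp eq p) = ∈-resp eq (adjoin⊆ S∈ p)
    adjoin⊆ S∈ (add p q)   = +∈ (adjoin⊆ S∈ p) (adjoin⊆ S∈ q)
    adjoin⊆ S∈ (mul p q)   = *∈ (adjoin⊆ S∈ p) (adjoin⊆ S∈ q)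
    adjoin⊆ S∈ (neg p)     = -∈ (adjoin⊆ S∈ p)
    adjoin⊆ S∈ (inv {z} {w} p zw≈1) =
      let z≉0 = λ z≈0 → #-irrefl z≈0 (inverse⇒# zw≈1)
          (v , v∈ , zv≈1) = inv∈ (adjoin⊆ S∈ p) z≉0
      in ∈-resp (lin₂ (- v) w zw≈1 zv≈1 (solve 3 (λ z v w →
           v := w :+ :- v :* (z :* w :- con (+ 1)) :+ w :* (z :* v :- con (+ 1))) refl z v w)) v∈

    -- `L` is generated by roots that already lie in `F`, so all of `L` lies in `F` and is fixed.
    gal-trivial : ∀ {l} (p : Poly) (L : Subfield l) (split : IsSplittingField F p L) →
                  (∀ i → IsSplittingField.roots split i ∈ Member F) →
                  ∀ σ → Group._≈_ (Gal F L) σ (Group.ε (Gal F L))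
    gal-trivial p L split roots∈F σ x = KAutomorphism.fixes σ x
      (adjoin⊆ roots∈F (IsSplittingField.generated split (proj₂ x)))

    module _ {M t} (bi : Bisymmetric M t) (t∈ : t ∈ Member F) where
      open BisymmetricProperties bi

      splittingField : IsSplittingField F (charPoly M) F
      splittingField = record
        { K⊆L       = λ z∈ → z∈
        ; leading   = 1#
        ; leading∈  = 1∈
        ; leading≉0 = λ 1≈0 → #-irrefl 1≈0 1#0
        ; count     = 2
        ; roots     = vec₂ 1# (t + 1#)
        ; roots∈    = λ { 0F → 1∈ ; 1F → +∈ t∈ 1∈ }
        ; splits    = charPoly-splits
        ; generated = base
        }

      -- A root satisfies only (r - 1)(r - (t + 1)) = 0. If the candidates are apart, `r` equals one
      -- of them; if they coincide, (r - 1)² vanishes and so does r - 1.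
      charPoly-root∈ : t ≈ 0# ⊎ t # 0# → ∀ {r} → eval (charPoly M) r ≈ 0# → r ∈ Member F
      charPoly-root∈ t≟0 {r} eq = [ degenerate , distinct ]′ t≟0
        where
        factored : (r - 1#) * (r - (t + 1#)) ≈ 0#
        factored = lin₁ 1# (trans (sym (eval-cong (charPoly M) ((t + 1#) ∷ - (t + 2#) ∷ 1# ∷ []) r charPoly-M)) eq) (solve 2 (λ t r →
          (r :- con (+ 1)) :* (r :- (t :+ con (+ 1))) := con (+ 0) :+ con (+ 1) :*
          (t :+ con (+ 1) :+ r :* (:- (t :+ con (+ 2)) :+ r :* (con (+ 1) :+ r :* con (+ 0))) :- con (+ 0))) refl t r)
        degenerate : t ≈ 0# → r ∈ Member F
        degenerate t≈0 = ∈-resp (sym (x-y≈0⇒x≈y (square-0 (lin₂ (r - 1#) 1# t≈0 factored (solve 2 (λ t r →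
          (r :- con (+ 1)) :* (r :- con (+ 1)) := con (+ 0) :+ (r :- con (+ 1)) :* (t :- con (+ 0))
          :+ con (+ 1) :* ((r :- con (+ 1)) :* (r :- (t :+ con (+ 1))) :- con (+ 0))) refl t r))))) 1∈
        1#t+1 : t # 0# → 1# # t + 1#
        1#t+1 t#0 = #-sym (-#0⇒# (#-resp (solve 1 (λ t → t := t :+ con (+ 1) :- con (+ 1)) refl t) refl t#0))
        distinct : t # 0# → r ∈ Member F
        distinct t#0 = [ (λ r≈1 → ∈-resp (sym r≈1) 1∈) , (λ r≈t+1 → ∈-resp (sym r≈t+1) (+∈ t∈ 1∈)) ]′
          (one-of-two-roots (1#t+1 t#0) factored)

  fromℚ-0 : fromℚ 0ℚ ≈ 0#
  fromℚ-0 = ℝ.zeroˡ _ , ℝ.refl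

  -- Membership in a number field is witnessed by rational coordinates, so
  -- vanishing is decidable there, unlike in ℂ.
  zero-or-apart : ∀ {k} (K : NumberField k) {z} → z ∈ Member (NumberField.subfield K) → z ≈ 0# ⊎ z # 0#
  zero-or-apart K {z} z∈ = decide (NumberField.spanning K z∈)
    where
    open NumberField K
    decide : (Σ[ q ∈ _ ] z ≈ sum (λ i → fromℚ (q i) * basis i)) → z ≈ 0# ⊎ z # 0#
    decide (q , z≈Σ) with Fin.all? (λ i → q i ℚ.≟ 0ℚ)
    ... | yes q≡0 = inj₁ (trans z≈Σ (sum-0 degree (λ i → trans
          (*-congʳ (trans (reflexive (≡.cong fromℚ (q≡0 i))) fromℚ-0)) (zeroˡ _))))
    ... | no  q≢0 = let (w , _ , zw≈1) = Subfield.inv∈ subfield z∈ λ z≈0 →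
                          q≢0 (independent q (trans (sym z≈Σ) z≈0))
                    in inj₂ (inverse⇒# zw≈1)

-- The square root of 2 and the dyadic roots of unity

module RootsOfUnity {c ℓ₁ ℓ₂} (Rl : Reals c ℓ₁ ℓ₂) where
  private
    module ℝ where
      open Reals Rl public
      open OrderedField Rl public
      open SquareRoot Rl public
  open Complex Rl
  open ℝ using (½ᴿ; solve; _:=_; _:+_; _:*_; _:-_; :-_; con; lin₁; lin₂; lin₃)

  ½≤1 : ½ᴿ ℝ.≤ ℝ.1#
  ½≤1 = ℝ.<⇒≤ ℝ.½<1

  √½ : ℝ
  √½ = ℝ.√ ½ᴿ ℝ.≤-refl ½≤1

  -- `√` is available only on the interval from 1/2 to 1, hence the form 2√(1/2).
  √2 : ℝ
  √2 = √½ ℝ.+ √½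

  0<√2 : ℝ.0# ℝ.< √2
  0<√2 = ℝ.0<-+ 0<√½ 0<√½
    where 0<√½ = ℝ.<-≤-trans ℝ.0<½ (ℝ.½≤√ ½ᴿ ℝ.≤-refl ½≤1)

  √2-square : √2 ℝ.* √2 ℝ.≈ ℝ.1# ℝ.+ ℝ.1#
  √2-square = double (ℝ.√-square ½ᴿ ℝ.≤-refl ½≤1)
    where
    double : ∀ {x} → x ℝ.* x ℝ.≈ ½ᴿ → (x ℝ.+ x) ℝ.* (x ℝ.+ x) ℝ.≈ ℝ.1# ℝ.+ ℝ.1#
    double {x} eq = lin₂ (ℝ.1# ℝ.+ ℝ.1# ℝ.+ ℝ.1# ℝ.+ ℝ.1#) (ℝ.1# ℝ.+ ℝ.1#) eq ℝ.½+½≈1 (solve 2 (λ h x →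
      (x :+ x) :* (x :+ x) := con (+ 2) :+ con (+ 4) :* (x :* x :- h) :+ con (+ 2) :* (h :+ h :- con (+ 1))) ℝ.refl ½ᴿ x)

  recip-square : ∀ {x} (0<x : ℝ.0# ℝ.< x) → x ℝ.* x ℝ.≈ ℝ.1# ℝ.+ ℝ.1# →
                 fromℝ (ℝ.recip x 0<x) * fromℝ (ℝ.recip x 0<x) * 2# ≈ 1#
  recip-square {x} 0<x x²≈2 = inverse-square (ℝ.recip x 0<x)
    (proj₂ (proj₂ (ℝ.#⇒invertible (Equivalence.from ℝ.#⇔<⊎> (inj₂ 0<x)))))
    where
    inverse-square : ∀ r → (x ℝ.- ℝ.0#) ℝ.* r ℝ.≈ ℝ.1# → fromℝ r * fromℝ r * 2# ≈ 1#
    inverse-square r xr≈1 =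
      lin₂ (ℝ.- (r ℝ.* r)) (x ℝ.* r ℝ.+ ℝ.1#) x²≈2 xr≈1 (solve 2 (λ x r →
        (r :* r :- con (+ 0) :* con (+ 0)) :* con (+ 2) :- (r :* con (+ 0) :+ con (+ 0) :* r) :* (con (+ 0) :+ con (+ 0)) :=
        con (+ 1) :+ :- (r :* r) :* (x :* x :- con (+ 2)) :+ (x :* r :+ con (+ 1)) :* ((x :- con (+ 0)) :* r :- con (+ 1))) ℝ.refl x r) ,
      solve 1 (λ r → (r :* r :- con (+ 0) :* con (+ 0)) :* (con (+ 0) :+ con (+ 0)) :+
        (r :* con (+ 0) :+ con (+ 0) :* r) :* con (+ 2) := con (+ 0)) ℝ.refl r

  -- A nonnegative cosine keeps (1 + cos)/2 between 1/2 and 1, where `√` is defined and its value is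
  -- bounded away from zero; the half-angle vector is again of this kind.
  record UnitVector : Set (c ⊔ ℓ₁ ⊔ ℓ₂) where
    field
      cos sin : ℝ
      0≤cos   : ℝ.0# ℝ.≤ cos
      unit    : cos ℝ.* cos ℝ.+ sin ℝ.* sin ℝ.≈ ℝ.1#
  open UnitVector

  quarter-turn : UnitVector
  quarter-turn = record
    { cos = ℝ.0# ; sin = ℝ.1# ; 0≤cos = ℝ.≤-refl
    ; unit = solve 0 (con (+ 0) :* con (+ 0) :+ con (+ 1) :* con (+ 1) := con (+ 1)) ℝ.refl
    }

  module HalfAngle (u : UnitVector) where
    y : ℝ
    y = ½ᴿ ℝ.* (ℝ.1# ℝ.+ cos u)

    cos≤1 : cos u ℝ.≤ ℝ.1#
    cos≤1 = ℝ.square-cancel-≤ (ℝ.<⇒≤ ℝ.0<1) (ℝ.0≤⇒≤ (ℝ.0≤² (sin u)) (lin₁ (ℝ.- ℝ.1#) (unit u)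
      (solve 2 (λ c s → con (+ 1) :* con (+ 1) :- c :* c := s :* s :+ :- con (+ 1) :* (c :* c :+ s :* s :- con (+ 1))) ℝ.refl (cos u) (sin u))))

    ½≤y : ½ᴿ ℝ.≤ y
    ½≤y = ℝ.0≤⇒≤ (ℝ.0≤-* (ℝ.<⇒≤ ℝ.0<½) (0≤cos u))
      (solve 2 (λ h c → h :* (con (+ 1) :+ c) :- h := h :* c) ℝ.refl ½ᴿ (cos u))

    y≤1 : y ℝ.≤ ℝ.1#
    y≤1 = ℝ.0≤⇒≤ (ℝ.0≤-* (ℝ.<⇒≤ ℝ.0<½) (ℝ.≤⇒0≤ cos≤1)) (lin₁ (ℝ.- ℝ.1#) ℝ.½+½≈1
      (solve 2 (λ h c → con (+ 1) :- h :* (con (+ 1) :+ c) := h :* (con (+ 1) :- c) :+ :- con (+ 1) :* (h :+ h :- con (+ 1))) ℝ.refl ½ᴿ (cos u)))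

    cos/2 : ℝ
    cos/2 = ℝ.√ y ½≤y y≤1

    0<cos/2 : ℝ.0# ℝ.< cos/2
    0<cos/2 = ℝ.<-≤-trans ℝ.0<½ (ℝ.½≤√ y ½≤y y≤1)

    -- The sine comes from sin u = 2 sin(u/2) cos(u/2) instead of a second square root, which also
    -- settles its sign.
    cos/2⁻¹ sin/2 : ℝ
    cos/2⁻¹ = proj₁ (ℝ.0<⇒inverse 0<cos/2)
    sin/2 = ½ᴿ ℝ.* sin u ℝ.* cos/2⁻¹

    module Identities (s c′ i : ℝ) (eq₁ : c′ ℝ.* c′ ℝ.≈ y) (eq₂ : c′ ℝ.* i ℝ.≈ ℝ.1#)
                      (eq₃ : cos u ℝ.* cos u ℝ.+ s ℝ.* s ℝ.≈ ℝ.1#) where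
      private
        s′ = ½ᴿ ℝ.* s ℝ.* i

      sin² : s′ ℝ.* s′ ℝ.≈ ½ᴿ ℝ.* (ℝ.1# ℝ.- cos u)
      sin² = lin₃ (ℝ.- (½ᴿ ℝ.* (i ℝ.* i) ℝ.* (ℝ.1# ℝ.- cos u))) (½ᴿ ℝ.* (ℝ.1# ℝ.- cos u) ℝ.* (c′ ℝ.* i ℝ.+ ℝ.1#))
        (½ᴿ ℝ.* ½ᴿ ℝ.* (i ℝ.* i)) eq₁ eq₂ eq₃ (solve 5 (λ h c s c′ i →
          (h :* s :* i) :* (h :* s :* i) := h :* (con (+ 1) :- c)
            :+ :- (h :* (i :* i) :* (con (+ 1) :- c)) :* (c′ :* c′ :- h :* (con (+ 1) :+ c))
            :+ h :* (con (+ 1) :- c) :* (c′ :* i :+ con (+ 1)) :* (c′ :* i :- con (+ 1))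
            :+ h :* h :* (i :* i) :* (c :* c :+ s :* s :- con (+ 1))) ℝ.refl ½ᴿ (cos u) s c′ i)

      unit′ : c′ ℝ.* c′ ℝ.+ s′ ℝ.* s′ ℝ.≈ ℝ.1#
      unit′ = ℝ.trans (ℝ.+-cong eq₁ sin²) (lin₁ ℝ.1# ℝ.½+½≈1 (solve 2 (λ h c →
        h :* (con (+ 1) :+ c) :+ h :* (con (+ 1) :- c) := con (+ 1) :+ con (+ 1) :* (h :+ h :- con (+ 1))) ℝ.refl ½ᴿ (cos u)))

      re-double : c′ ℝ.* c′ ℝ.- s′ ℝ.* s′ ℝ.≈ cos u
      re-double = ℝ.trans (ℝ.+-cong eq₁ (ℝ.-‿cong sin²)) (lin₁ (cos u) ℝ.½+½≈1 (solve 2 (λ h c →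
        h :* (con (+ 1) :+ c) :- h :* (con (+ 1) :- c) := c :+ c :* (h :+ h :- con (+ 1))) ℝ.refl ½ᴿ (cos u)))

      im-double : c′ ℝ.* s′ ℝ.+ s′ ℝ.* c′ ℝ.≈ s
      im-double = lin₂ ((½ᴿ ℝ.+ ½ᴿ) ℝ.* s) s eq₂ ℝ.½+½≈1 (solve 4 (λ h s c′ i →
        c′ :* (h :* s :* i) :+ h :* s :* i :* c′ := s :+ (h :+ h) :* s :* (c′ :* i :- con (+ 1)) :+ s :* (h :+ h :- con (+ 1)))
        ℝ.refl ½ᴿ s c′ i)

    open Identities (sin u) cos/2 cos/2⁻¹ (ℝ.√-square y ½≤y y≤1) (proj₂ (proj₂ (ℝ.0<⇒inverse 0<cos/2))) (unit u) public

    half : UnitVector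
    half = record { cos = cos/2 ; sin = sin/2 ; 0≤cos = ℝ.<⇒≤ 0<cos/2 ; unit = unit′ }

  turn : ℕ → UnitVector
  turn zero    = quarter-turn
  turn (suc m) = HalfAngle.half (turn m)

  dyadicRoots : DyadicRoots
  dyadicRoots = record
    { ζ        = ζ
    ; ∣ζ∣≈1    = modulus
    ; ζ-zero   = ℝ.refl , ℝ.refl
    ; ζ-one    = ℝ.refl , ℝ.refl
    ; ζ-square = square
    }
    where
    ζ : ℕ → ℂ
    ζ 0             = 1#
    ζ 1             = - 1#
    -- Halving cannot start from -1, whose cosine is negative; it starts from the quarter turn i,
    -- whose square is `ζ 1`.
    ζ (suc (suc m)) = cos (turn m) +i sin (turn m)
    modulus : ∀ m → ∣ ζ m ∣² ℝ.≈ ℝ.1#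
    modulus 0 = solve 0 (con (+ 1) :* con (+ 1) :+ con (+ 0) :* con (+ 0) := con (+ 1)) ℝ.refl
    modulus 1 = solve 0 (:- con (+ 1) :* :- con (+ 1) :+ :- con (+ 0) :* :- con (+ 0) := con (+ 1)) ℝ.refl
    modulus (suc (suc m)) = unit (turn m)
    square : ∀ m → ζ (suc m) * ζ (suc m) ≈ ζ m
    square 0 =
      solve 0 (:- con (+ 1) :* :- con (+ 1) :- :- con (+ 0) :* :- con (+ 0) := con (+ 1)) ℝ.refl ,
      solve 0 (:- con (+ 1) :* :- con (+ 0) :+ :- con (+ 0) :* :- con (+ 1) := con (+ 0)) ℝ.refl
    square 1 =
      solve 0 (con (+ 0) :* con (+ 0) :- con (+ 1) :* con (+ 1) := :- con (+ 1)) ℝ.refl ,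
      solve 0 (con (+ 0) :* con (+ 1) :+ con (+ 1) :* con (+ 0) := :- con (+ 0)) ℝ.refl
    square (suc (suc m)) = HalfAngle.re-double (turn m) , HalfAngle.im-double (turn m)

-- Limits of means over the nodes of a circle

n<2^n : ∀ n → n ℕ.< 2 ℕ.^ n
n<2^n zero    = ℕ.s≤s ℕ.z≤n
n<2^n (suc n) = ℕ.+-mono-≤ (ℕ.≤-trans (ℕ.s≤s ℕ.z≤n) (n<2^n n)) (ℕ.≤-trans (n<2^n n) (ℕ.m≤m+n _ 0))

<2^ : ∀ {N m} → N ℕ.≤ m → N ℕ.< 2 ℕ.^ m
<2^ N≤m = ℕ.≤-<-trans N≤m (n<2^n _)

module CircleMeans {c ℓ₁ ℓ₂} (Rl : Reals c ℓ₁ ℓ₂) (roots : Complex.DyadicRoots Rl) where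
  private
    module ℝ where
      open Reals Rl public
      open OrderedField Rl public
  open Complex Rl
  open Complex.DyadicRoots roots
  open ComplexField Rl
  open TwoRoots Rl using (½ᶜ+½ᶜ≈1)
  open CommutativeRing ℂ-commutativeRing using (refl; sym; trans; +-congʳ; +-congˡ; *-congʳ; -‿cong; *-identityˡ; +-identityˡ; zeroˡ; zeroʳ)
  open IntegerSolver ℂ-commutativeRing
  open LinearCombination ℂ-commutativeRing
  open PowerSums ℂ-commutativeRing using (partialSum; partialSum-suc; mean-cong; mean-+; mean-*ˡ; mean-const)
  open DyadicMeans.Nodes ℂ-commutativeRing ½ᶜ+½ᶜ≈1 ζ ζ-one ζ-square public
    using (w; avg; avg-partialSum; avg-shift; avg-contract)

  avg-≼ : ∀ ρ m {r} (g : Fin (2 ℕ.^ m) → ℂ) → (∀ k → g k ≼ r) → avg ρ m g ≼ r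
  avg-≼ ρ m {r} g g≼r = ≼-resp refl
    (PowerSums.h^m*2^m ℝ.commutativeRing ℝ.½+½≈1 m r)
    (≼-* (≼-^ (≼-fromℝ (ℝ.<⇒≤ ℝ.0<½)) m) (≼-sum (2 ℕ.^ m) g g≼r))

  module _ (ρ : ℂ) where

    -- One `N` serves the nodes of all subdivisions, so the error survives averaging while `m`
    -- grows. With `suc N` terms the constant term is always present.
    UniformLimit : (∀ m → Fin (2 ℕ.^ m) → ℂ) → (ℕ → ℂ) → Set (c ⊔ ℓ₂)
    UniformLimit g a = ∀ ε → ℝ.0# ℝ.< ε → ∃[ N ] ∀ m k → g m k - partialSum a (suc N) (w ρ m k) ≼ ε

    avg-- : ∀ m f g → avg ρ m (λ k → f k - g k) ≈ avg ρ m f - avg ρ m g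
    avg-- m f g = trans (mean-cong ½ᶜ+½ᶜ≈1 m (λ k → solve 2 (λ f g → f :- g := f :+ :- con (+ 1) :* g) refl (f k) (g k)))
      (trans (mean-+ ½ᶜ+½ᶜ≈1 m f (λ k → - 1# * g k))
        (trans (+-congˡ (mean-*ˡ ½ᶜ+½ᶜ≈1 m (- 1#) g))
          (solve 2 (λ f g → f :+ :- con (+ 1) :* g := f :- g) refl (avg ρ m f) (avg ρ m g))))

    -- From m = N on, 2ᵐ exceeds every exponent present and the mean of the partial sum is exactly
    -- `a 0`; only the uniform error is left.
    avg-limit : ∀ {g a} → UniformLimit g a → (λ m → avg ρ m (g m)) ⇝ a 0
    avg-limit {g} {a} unif ε 0<ε =
      let (N , close) = unif ε 0<ε in
      N , λ m N≤m → ≼-resp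
        (trans (avg-- m (g m) (λ k → partialSum a (suc N) (w ρ m k)))
          (+-congˡ (-‿cong (avg-partialSum ρ m a N (<2^ N≤m)))))
        ℝ.refl (avg-≼ ρ m (λ k → g m k - partialSum a (suc N) (w ρ m k)) (close m))

    -- With x = w / (w - δ) for a point δ outside the circle of radius ρ, these
    -- are Cauchy's theorem for the integrands wⁿ / (w - δ) and g(w) / (w - δ).
    module _ {δ v : ℂ} (vδ≈1 : v * δ ≈ 1#) {C θ : ℝ} (0<C : ℝ.0# ℝ.< C) (0<θ : ℝ.0# ℝ.< θ) (θ<1 : θ ℝ.< ℝ.1#)
             (x : ∀ m → Fin (2 ℕ.^ m) → ℂ)
             (x-eq : ∀ m k → w ρ m k * x m k ≈ w ρ m k + δ * x m k)
             (x≼C : ∀ m k → x m k ≼ C) (vw≼θ : ∀ m k → v * w ρ m k ≼ θ) where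

      private
        C⁻¹ = proj₁ (ℝ.0<⇒inverse 0<C)
        0<C⁻¹ = proj₁ (proj₂ (ℝ.0<⇒inverse 0<C))

        scale : ∀ ε → ε ℝ.* C⁻¹ ℝ.* C ℝ.≈ ε
        scale ε = rescale C⁻¹ (proj₂ (proj₂ (ℝ.0<⇒inverse 0<C)))
          where
          rescale : ∀ i → C ℝ.* i ℝ.≈ ℝ.1# → ε ℝ.* i ℝ.* C ℝ.≈ ε
          rescale i eq = ℝ.lin₁ ε eq (ℝ.solve 3 (λ e i c → e ℝ.:* i ℝ.:* c ℝ.:=
            e ℝ.:+ e ℝ.:* (c ℝ.:* i ℝ.:- ℝ.con (+ 1))) ℝ.refl ε i C)

        x-contract : ∀ m k → x m k ≈ v * w ρ m k * x m k - v * w ρ m k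
        x-contract m k = lin₂ (- x m k) (- v) vδ≈1 (x-eq m k) (solve 4 (λ v w x δ →
          x := v :* w :* x :- v :* w :+ :- x :* (v :* δ :- con (+ 1)) :+ :- v :* (w :* x :- (w :+ δ :* x))) refl v (w ρ m k) (x m k) δ)

      -- For n = 0, `K` geometric steps replace `x` by (vw)^K x, which is at most θ^K C. A further
      -- factor `w` multiplies the mean by `δ`, up to a power of `w` of mean zero.
      moment-limit : ∀ n → (λ m → avg ρ m (λ k → w ρ m k ^ n * x m k)) ⇝ 0#
      moment-limit zero ε 0<ε =
        let (K , small) = ℝ.^→0 0<θ θ<1 (ε ℝ.* C⁻¹) (ℝ.*-pos 0<ε 0<C⁻¹) in
        K , λ m K≤m → ≼-resp
          (trans (sym (avg-contract ρ m K v (x m) (x-contract m) (<2^ K≤m)))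
            (trans (mean-cong ½ᶜ+½ᶜ≈1 m (λ k → sym (*-identityˡ (x m k))))
              (solve 1 (λ y → y := y :- con (+ 0)) refl _)))
          (scale ε)
          (avg-≼ ρ m (λ k → (v * w ρ m k) ^ K * x m k) (λ k →
            ≼-mono (ℝ.*-mono-≤ (ℝ.0≤^ (ℝ.<⇒≤ 0<θ) K) (ℝ.<⇒≤ 0<C) (small K ℕ.≤-refl) ℝ.≤-refl)
              (≼-* (≼-^ (vw≼θ m k) K) (x≼C m k))))
      moment-limit (suc n) = ⇝-cong (suc n)
        (λ m n<m → sym (avg-shift ρ m n δ (x m) (x-eq m) (<2^ n<m))) (zeroʳ δ)
        (⇝-*ˡ δ (moment-limit n))

      polynomial-limit : ∀ a N → (λ m → avg ρ m (λ k → partialSum a N (w ρ m k) * x m k)) ⇝ 0#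
      polynomial-limit a zero = ⇝-sequence-cong
        (λ m → sym (trans (mean-cong ½ᶜ+½ᶜ≈1 m (λ k → zeroˡ (x m k))) (mean-const ½ᶜ+½ᶜ≈1 m 0#))) ⇝-const
      polynomial-limit a (suc N) = ⇝-limit-cong (trans (+-identityˡ _) (zeroʳ (a N))) (⇝-sequence-cong
        (λ m → sym (trans
          (mean-cong ½ᶜ+½ᶜ≈1 m (λ k → trans (*-congʳ (partialSum-suc a N (w ρ m k)))
            (solve 4 (λ p a w x → (p :+ a :* w) :* x := p :* x :+ a :* (w :* x)) refl
              (partialSum a N (w ρ m k)) (a N) (w ρ m k ^ N) (x m k))))
          (trans (mean-+ ½ᶜ+½ᶜ≈1 m _ _) (+-congˡ (mean-*ˡ ½ᶜ+½ᶜ≈1 m (a N) _)))))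
        (⇝-+ (polynomial-limit a N) (⇝-*ˡ (a N) (moment-limit N))))

      -- Write gx = (g - p)x + px for a partial sum `p` within ε/(2C) of `g`. The first mean is at
      -- most ε/2 because x is bounded by `C`; the second tends to 0.
      avg-vanish : ∀ {g a} → UniformLimit g a → (λ m → avg ρ m (λ k → g m k * x m k)) ⇝ 0#
      avg-vanish {g} {a} unif ε 0<ε =
        let (N , close) = unif (ℝ.halve ε ℝ.* C⁻¹) (ℝ.*-pos (ℝ.0<halve 0<ε) 0<C⁻¹)
            (M , small) = polynomial-limit a (suc N) (ℝ.halve ε) (ℝ.0<halve 0<ε)
        in M , λ m M≤m → ≼-resp
          (trans (+-congʳ (trans
              (mean-cong ½ᶜ+½ᶜ≈1 m (λ k → solve 3 (λ g p x → (g :- p) :* x := g :* x :- p :* x) refl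
                (g m k) (partialSum a (suc N) (w ρ m k)) (x m k)))
              (avg-- m _ _)))
            (solve 2 (λ u v → u :- v :+ (v :- con (+ 0)) := u :- con (+ 0)) refl _ _))
          (ℝ.trans (ℝ.+-congʳ (scale (ℝ.halve ε))) (ℝ.halve+halve ε))
          (≼-+ (avg-≼ ρ m (λ k → (g m k - partialSum a (suc N) (w ρ m k)) * x m k) (λ k → ≼-* (close m k) (x≼C m k)))
            (small m M≤m))

-- Uniform convergence of power series on smaller discs

module PowerSeries {c ℓ₁ ℓ₂} (Rl : Reals c ℓ₁ ℓ₂) where
  private
    module ℝ where
      open Reals Rl public
      open OrderedField Rl public
  open Complex Rl
  open ComplexField Rl
  open TwoRoots Rl using (x-y≈0⇒x≈y)
  open CommutativeRing ℂ-commutativeRing using (refl; sym; trans; +-congʳ; *-congʳ; -‿inverseʳ; *-identityˡ; *-identityʳ; *-assoc)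
  open IntegerSolver ℂ-commutativeRing
  open LinearCombination ℂ-commutativeRing
  open PowerSums ℂ-commutativeRing using (partialSum; partialSum-step; partialSum-diff; partialSum-0; partialSum-cong; rescale-term)

  ≼-all⇒≈0 : ∀ {z} → (∀ ε → ℝ.0# ℝ.< ε → z ≼ ε) → z ≈ 0#
  ≼-all⇒≈0 {z} bound = tight λ z#0 →
    -- The bounds concern squares, and ε < 1 gives ε² ≤ ε < |z|².
    let (ε , 0<ε , ε<1 , ε<n) = ℝ.positive-below ℝ.0<1 (#⇒0<∣∣² z#0)
    in ℝ.≤-trans (∣∣²≤ (bound ε 0<ε))
         (ℝ.≤-resp ℝ.refl (ℝ.*-identityʳ ε) (ℝ.*-mono-≤ (ℝ.<⇒≤ 0<ε) (ℝ.<⇒≤ 0<ε) ℝ.≤-refl (ℝ.<⇒≤ ε<1)))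
         ε<n

  ⇝-constant : ∀ {s l x} → (∀ n → s (suc n) ≈ x) → s ⇝ l → x ≈ l
  ⇝-constant s≈x s⇝l = x-y≈0⇒x≈y (≼-all⇒≈0 λ ε 0<ε →
    let (N , close) = s⇝l ε 0<ε in
    ≼-resp (+-congʳ (s≈x N)) ℝ.refl (close (suc N) (ℕ.n≤1+n N)))

  -- A term is the difference of consecutive partial sums, both eventually within 1/2 of the limit.
  terms-bounded : ∀ a {x l} → (λ n → partialSum a n x) ⇝ l → ∃[ N ] ∀ n → N ℕ.≤ n → a n * x ^ n ≼ ℝ.1#
  terms-bounded a {x} {l} converges =
    let (N , close) = converges (ℝ.halve ℝ.1#) (ℝ.0<halve ℝ.0<1) in
    N , λ n N≤n → ≼-resp (partialSum-diff a n x l) (ℝ.halve+halve ℝ.1#)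
      (≼-+ (close (suc n) (ℕ.≤-trans N≤n (ℕ.n≤1+n n))) (≼-neg (close n N≤n)))

  fromℝ-inverse : ∀ {r i} → r ℝ.* i ℝ.≈ ℝ.1# → fromℝ r * fromℝ i ≈ 1#
  fromℝ-inverse {r} {i} eq =
    ℝ.trans (ℝ.solve 2 (λ x y → x ℝ.:* y ℝ.:- ℝ.con (+ 0) ℝ.:* ℝ.con (+ 0) ℝ.:= x ℝ.:* y) ℝ.refl r i) eq ,
    ℝ.solve 2 (λ x y → x ℝ.:* ℝ.con (+ 0) ℝ.:+ ℝ.con (+ 0) ℝ.:* y ℝ.:= ℝ.con (+ 0)) ℝ.refl r i

  -- Terms bounded at radius r = 1/i are dominated on the circle of radius ρ < r
  -- by the geometric series with ratio ρ/r and sum K.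
  module GeometricBound (a : ℕ → ℂ) {r i ρ K : ℝ} (0<i : ℝ.0# ℝ.< i) (ri≈1 : r ℝ.* i ℝ.≈ ℝ.1#)
    (N₀ : ℕ) (bounded : ∀ n → N₀ ℕ.≤ n → a n * fromℝ r ^ n ≼ ℝ.1#)
    (K-eq : (ℝ.1# ℝ.- ρ ℝ.* i) ℝ.* K ℝ.≈ ℝ.1#) where
    private
      θ = ρ ℝ.* i

    term-≼ : ∀ {w} → w ≼ ρ → ∀ n → N₀ ℕ.≤ n → a n * w ^ n ≼ θ ℝ.^ n
    term-≼ {w} w≼ρ n N≤n = ≼-resp {a n * fromℝ r ^ n * (w * fromℝ i) ^ n} {a n * w ^ n} {ℝ.1# ℝ.* θ ℝ.^ n} {θ ℝ.^ n}
      (rescale-term (a n) {fromℝ r} {fromℝ i} w n (fromℝ-inverse ri≈1))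
      (ℝ.*-identityˡ (θ ℝ.^ n))
      (≼-* (bounded n N≤n) (≼-^ (≼-* w≼ρ (≼-fromℝ (ℝ.<⇒≤ 0<i))) n))

    telescope : ∀ p q → K ℝ.* (p ℝ.- q) ℝ.+ q ℝ.≈ K ℝ.* (p ℝ.- θ ℝ.* q)
    telescope p q = ℝ.lin₁ (ℝ.- q) K-eq (ℝ.solve 4 (λ k p q t →
      k ℝ.:* (p ℝ.:- q) ℝ.:+ q ℝ.:= k ℝ.:* (p ℝ.:- t ℝ.:* q) ℝ.:+ ℝ.:- q ℝ.:* ((ℝ.con (+ 1) ℝ.:- t) ℝ.:* k ℝ.:- ℝ.con (+ 1))) ℝ.refl K p q θ)

    -- `K` is 1/(1 - θ), so the bound is the geometric sum of θ^k for n ≤ k < j + n; `telescope`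
    -- appends the next summand.
    block-≼ : ∀ {w} → w ≼ ρ → ∀ n → N₀ ℕ.≤ n → ∀ j →
              partialSum a (j ℕ.+ n) w - partialSum a n w ≼ K ℝ.* (θ ℝ.^ n ℝ.- θ ℝ.^ (j ℕ.+ n))
    block-≼ {w} w≼ρ n N≤n zero = ≼-resp {0#} {partialSum a n w - partialSum a n w}
      (sym (-‿inverseʳ (partialSum a n w)))
      (ℝ.solve 2 (λ k p → ℝ.con (+ 0) ℝ.:= k ℝ.:* (p ℝ.:- p)) ℝ.refl K (θ ℝ.^ n)) ≼-0
    block-≼ {w} w≼ρ n N≤n (suc j) = ≼-resp
      (partialSum-step a (j ℕ.+ n) n w)
      (telescope (θ ℝ.^ n) (θ ℝ.^ (j ℕ.+ n)))
      (≼-+ (block-≼ w≼ρ n N≤n j) (term-≼ w≼ρ (j ℕ.+ n) (ℕ.≤-trans N≤n (ℕ.m≤n+m n j))))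

    tail-≼ : ℝ.0# ℝ.< K → ℝ.0# ℝ.≤ θ → ∀ {w y ε} → w ≼ ρ → (λ n → partialSum a n w) ⇝ y → ℝ.0# ℝ.< ε →
             ∀ n → N₀ ℕ.≤ n → K ℝ.* θ ℝ.^ n ℝ.≤ ℝ.halve ε → y - partialSum a n w ≼ ε
    tail-≼ 0<K 0≤θ {w} {y} {ε} w≼ρ conv 0<ε n N≤n small =
      let (J , close) = conv (ℝ.halve ε) (ℝ.0<halve 0<ε) in
      ≼-resp
        (solve 3 (λ s y t → :- (s :- y) :+ (s :- t) := y :- t) refl (partialSum a (J ℕ.+ n) w) y (partialSum a n w))
        (ℝ.halve+halve ε)
        (≼-+ (≼-neg (close (J ℕ.+ n) (ℕ.m≤m+n J n)))
          (≼-mono (ℝ.≤-trans (shrink (θ ℝ.^ n) (θ ℝ.^ (J ℕ.+ n)) (ℝ.0≤^ 0≤θ (J ℕ.+ n))) small)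
            (block-≼ w≼ρ n N≤n J)))
      where
      shrink : ∀ p q → ℝ.0# ℝ.≤ q → K ℝ.* (p ℝ.- q) ℝ.≤ K ℝ.* p
      shrink p q 0≤q = ℝ.0≤⇒≤ (ℝ.0≤-* (ℝ.<⇒≤ 0<K) 0≤q)
        (ℝ.solve 3 (λ k p q → k ℝ.:* p ℝ.:- k ℝ.:* (p ℝ.:- q) ℝ.:= k ℝ.:* q) ℝ.refl K p q)

  ratio<1 : ∀ {r i ρ} → ℝ.0# ℝ.< i → r ℝ.* i ℝ.≈ ℝ.1# → ρ ℝ.< r → ρ ℝ.* i ℝ.< ℝ.1#
  ratio<1 {r} {i} {ρ} 0<i eq ρ<r = ℝ.0<⇒< (ℝ.*-pos (ℝ.<⇒0< ρ<r) 0<i) (ℝ.lin₁ (ℝ.- ℝ.1#) eq (ℝ.solve 3 (λ p r i →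
    ℝ.con (+ 1) ℝ.:- p ℝ.:* i ℝ.:= (r ℝ.:- p) ℝ.:* i ℝ.:+ ℝ.:- ℝ.con (+ 1) ℝ.:* (r ℝ.:* i ℝ.:- ℝ.con (+ 1))) ℝ.refl ρ r i))

  -- Abel's lemma: convergence at the single point `r` bounds the terms there, and for |w| ≤ ρ < r
  -- the tail is dominated by a geometric series of ratio ρ/r, whatever `w` is.
  uniform : ∀ a {r l ρ} → (λ n → partialSum a n (fromℝ r)) ⇝ l → ℝ.0# ℝ.< ρ → ρ ℝ.< r →
            ∀ ε → ℝ.0# ℝ.< ε → ∃[ N ] ∀ {w y} → w ≼ ρ → (λ n → partialSum a n w) ⇝ y → y - partialSum a (suc N) w ≼ ε
  uniform a {r} {l} {ρ} converges 0<ρ ρ<r ε 0<ε =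
    let (i , 0<i , ri≈1) = ℝ.0<⇒inverse (ℝ.<-trans 0<ρ ρ<r)
        (N₀ , bounded) = terms-bounded a converges
        θ<1 = ratio<1 0<i ri≈1 ρ<r
        0<θ = ℝ.*-pos 0<ρ 0<i
        (K , 0<K , K-eq) = ℝ.0<⇒inverse (ℝ.<⇒0< θ<1)
        (k , 0<k , Kk≈1) = ℝ.0<⇒inverse 0<K
        (M , small) = ℝ.^→0 0<θ θ<1 (k ℝ.* ℝ.halve ε) (ℝ.*-pos 0<k (ℝ.0<halve 0<ε))
        N = N₀ ℕ.⊔ M
    in N , λ w≼ρ conv → GeometricBound.tail-≼ a 0<i ri≈1 N₀ bounded K-eq 0<K (ℝ.<⇒≤ 0<θ) w≼ρ conv 0<ε (suc N)
      (ℕ.≤-trans (ℕ.m≤m⊔n N₀ M) (ℕ.n≤1+n N))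
      (ℝ.≤-trans
        (ℝ.*-mono-≤ (ℝ.<⇒≤ 0<K) (ℝ.0≤^ (ℝ.<⇒≤ 0<θ) (suc N)) ℝ.≤-refl (small (suc N) (ℕ.≤-trans (ℕ.m≤n⊔m N₀ M) (ℕ.n≤1+n N))))
        (ℝ.≤-reflexive (ℝ.trans (ℝ.sym (ℝ.*-assoc K k (ℝ.halve ε))) (ℝ.trans (ℝ.*-congʳ Kk≈1) (ℝ.*-identityˡ (ℝ.halve ε))))))

  module _ {d} (f : PartialFunction d) {a R} (expansion : ExpandsOn f a R) {ρ} (0<ρ : ℝ.0# ℝ.< ρ) (ρ<R : ρ ℝ.< R) where
    open PartialFunction f

    coefficients : ℕ → ℂ
    coefficients = proj₁ expansion

    private
      0<R = ℝ.<-trans 0<ρ ρ<R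

      evaluate : ∀ z → z ∈ Disc a R → (z∈ : z ∈ Dom) → (λ n → partialSum coefficients n (z - a)) ⇝ fun z z∈
      evaluate z z∈D z∈ = let (z∈′ , conv) = proj₂ expansion z z∈D in
        ⇝-limit-cong (fun-cong z∈′ z∈ refl) (⟶⇒⇝ conv)

      disc : ∀ {z r} → z - a ≼ r → r ℝ.< R → z ∈ Disc a R
      disc p r<R = ≼-< p r<R

    coefficient-0 : (a∈ : a ∈ Dom) → coefficients 0 ≈ fun a a∈
    coefficient-0 a∈ = ⇝-constant (λ n → partialSum-0 coefficients n (-‿inverseʳ a))
      (evaluate a (disc (≼-resp (sym (-‿inverseʳ a)) ℝ.refl ≼-0) 0<R) a∈)

    expansion-uniform : ∀ ε → ℝ.0# ℝ.< ε → ∃[ N ] ∀ z (z∈ : z ∈ Dom) → z - a ≼ ρ →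
                        fun z z∈ - partialSum coefficients (suc N) (z - a) ≼ ε
    expansion-uniform ε 0<ε =
      -- Convergence is given on the open disc only, so the comparison point a + r is placed
      -- strictly between the circle of radius `ρ` and the boundary.
      let (r , ρ<r , r<R) = ℝ.between ρ<R
          0<r = ℝ.<-trans 0<ρ ρ<r
          z₀ = a + fromℝ r
          z₀-a = solve 2 (λ a r → a :+ r :- a := r) refl a (fromℝ r)
          z₀∈D = disc (≼-resp (sym z₀-a) ℝ.refl (≼-fromℝ (ℝ.<⇒≤ 0<r))) r<R
          conv = ⇝-sequence-cong (λ n → partialSum-cong coefficients n z₀-a)
                   (evaluate z₀ z₀∈D (proj₁ (proj₂ expansion z₀ z₀∈D)))
          (N , close) = uniform coefficients conv 0<ρ ρ<r ε 0<ε
      in N , λ z z∈ z-a≼ρ → close z-a≼ρ (evaluate z (disc z-a≼ρ ρ<R) z∈)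

-- Algebra of integrands with simple poles

module PoleAlgebra {c ℓ} (R : CommutativeRing c ℓ) where
  open CommutativeRing R hiding (zero)
  open IntegerSolver R
  open LinearCombination R
  open PowerSums R using (sum; ∑-distrib-+; *-distribˡ-sum; sum-0)

  pole-at-centre : ∀ {z a w μ u} → z - a ≈ w → a ≈ μ → (z - μ) * u ≈ 1# → w * u ≈ 1#
  pole-at-centre {z} {a} {w} {μ} {u} e₁ e₂ e₃ = lin₃ (- u) (- u) 1# e₁ e₂ e₃ (solve 5 (λ z a w μ u →
    w :* u := con (+ 1) :+ :- u :* (z :- a :- w) :+ :- u :* (a :- μ) :+ con (+ 1) :* ((z :- μ) :* u :- con (+ 1))) refl z a w μ u)

  pole-shift : ∀ {z a w μ u} → z - a ≈ w → (z - μ) * u ≈ 1# → w * (w * u) ≈ w + (μ - a) * (w * u)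
  pole-shift {z} {a} {w} {μ} {u} e₁ e₂ = lin₂ (- (w * u)) w e₁ e₂ (solve 5 (λ z a w μ u →
    w :* (w :* u) := w :+ (μ :- a) :* (w :* u) :+ :- (w :* u) :* (z :- a :- w) :+ w :* ((z :- μ) :* u :- con (+ 1))) refl z a w μ u)

  integrand-split : ∀ {n h σ u v w′ w} F → w′ ≈ w → n ≈ h * (u + σ * v) →
                    w′ * (F * n) ≈ h * (F * (w * u)) + h * σ * (F * (w * v))
  integrand-split {n} {h} {σ} {u} {v} {w′} {w} F e₁ e₂ = trans (*-cong e₁ (*-congˡ e₂)) (solve 6 (λ h σ u v w F →
    w :* (F :* (h :* (u :+ σ :* v))) := h :* (F :* (w :* u)) :+ h :* σ :* (F :* (w :* v))) refl h σ u v w F)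

  -- A scaled Kronecker delta: the limit of the mean with a pole at the centre of circle `j`, as a
  -- function of the circle over which it is taken.
  pick : ∀ {n} → Fin n → Carrier → Fin n → Carrier
  pick zero    x zero    = x
  pick zero    x (suc i) = 0#
  pick (suc j) x zero    = 0#
  pick (suc j) x (suc i) = pick j x i

  pick-same : ∀ {n} (j : Fin n) x → pick j x j ≈ x
  pick-same zero    x = refl
  pick-same (suc j) x = pick-same j x

  pick-other : ∀ {n} {i j : Fin n} x → ¬ i ≡ j → pick j x i ≈ 0#
  pick-other {i = zero}  {zero}  x i≢j = ⊥-elim (i≢j ≡.refl)
  pick-other {i = suc i} {zero}  x i≢j = refl
  pick-other {i = zero}  {suc j} x i≢j = refl
  pick-other {i = suc i} {suc j} x i≢j = pick-other x (λ i≡j → i≢j (≡.cong suc i≡j))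

  sum-pick : ∀ {n} (j : Fin n) x → sum (pick j x) ≈ x
  sum-pick {suc n} zero x = trans (+-congˡ (sum-0 n (λ _ → refl))) (+-identityʳ x)
  sum-pick (suc j) x = trans (+-identityˡ _) (sum-pick j x)

  sum-two-picks : ∀ {n} (i j : Fin n) h k x y → sum (λ l → h * pick i x l + k * pick j y l) ≈ h * x + k * y
  sum-two-picks i j h k x y = trans (∑-distrib-+ (λ l → h * pick i x l) (λ l → k * pick j y l)) (+-cong
    (trans (sym (*-distribˡ-sum h (pick i x))) (*-congˡ (sum-pick i x)))
    (trans (sym (*-distribˡ-sum k (pick j y))) (*-congˡ (sum-pick j y))))

  factor-½ : ∀ h σ x y → h * x + h * σ * y ≈ h * (x + σ * y)
  factor-½ = solve 4 (λ h σ x y → h :* x :+ h :* σ :* y := h :* (x :+ σ :* y)) refl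

-- Distances between circles and poles

module Separation {c ℓ₁ ℓ₂} (Rl : Reals c ℓ₁ ℓ₂) where
  private
    module ℝ where
      open Reals Rl public
      open OrderedField Rl public
  open Complex Rl
  open ComplexField Rl
  open CommutativeRing ℂ-commutativeRing using (refl; sym; trans)
  open IntegerSolver ℂ-commutativeRing

  circle-≼ : ∀ {a ρ z} → ℝ.0# ℝ.< ρ → z ∈ Circle a ρ → z - a ≼ ρ
  circle-≼ 0<ρ z∈ = ℝ.<⇒≤ 0<ρ , ℝ.≤-reflexive z∈

  -- The triangle inequality by contradiction: if |z - μ| < s, then |a - μ| ≤ ρ + s.
  outside-≤ : ∀ {z a μ ρ s} → z - a ≼ ρ → ℝ.0# ℝ.< s → (ρ ℝ.+ s) ℝ.* (ρ ℝ.+ s) ℝ.< ∣ a - μ ∣² →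
              s ℝ.* s ℝ.≤ ∣ z - μ ∣²
  outside-≤ {z} {a} {μ} {ρ} {s} z-a≼ρ 0<s far near = ∣∣²≤ sum-≼ far
    where
    z-μ≼s : z - μ ≼ s
    z-μ≼s = ℝ.<⇒≤ 0<s , ℝ.<⇒≤ near
    sum-≼ : a - μ ≼ ρ ℝ.+ s
    sum-≼ = ≼-resp {(- (z - a)) + (z - μ)} {a - μ}
      (solve 3 (λ z a μ → :- (z :- a) :+ (z :- μ) := a :- μ) refl z a μ) ℝ.refl (≼-+ (≼-neg z-a≼ρ) z-μ≼s)

  inverse-≼ : ∀ {z w s i} → z * w ≈ 1# → ℝ.0# ℝ.< i → s ℝ.* i ℝ.≈ ℝ.1# → s ℝ.* s ℝ.≤ ∣ z ∣² → w ≼ i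
  inverse-≼ {z} {w} {s} {i} zw≈1 0<i si≈1 s²≤ = ℝ.<⇒≤ 0<i ,
    bound ∣ z ∣² ∣ w ∣² (ℝ.trans (ℝ.sym (∣∣²-* z w)) (ℝ.trans (∣∣²-cong zw≈1) (ℝ.trans (∣fromℝ∣² ℝ.1#) (ℝ.*-identityˡ ℝ.1#)))) (0≤∣∣² w) s²≤
    where
    bound : ∀ Z W → Z ℝ.* W ℝ.≈ ℝ.1# → ℝ.0# ℝ.≤ W → s ℝ.* s ℝ.≤ Z → W ℝ.≤ i ℝ.* i
    bound Z W ZW≈1 0≤W s²≤Z = ℝ.0≤⇒≤ (ℝ.0≤-* (ℝ.0≤-* (ℝ.0≤² i) 0≤W) (ℝ.≤⇒0≤ s²≤Z))
      (ℝ.lin₂ (ℝ.- (i ℝ.* i)) (W ℝ.* (s ℝ.* i ℝ.+ ℝ.1#)) ZW≈1 si≈1 (ℝ.solve 4 (λ Z W s i →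
        i ℝ.:* i ℝ.:- W ℝ.:= i ℝ.:* i ℝ.:* W ℝ.:* (Z ℝ.:- s ℝ.:* s) ℝ.:+ ℝ.:- (i ℝ.:* i) ℝ.:* (Z ℝ.:* W ℝ.:- ℝ.con (+ 1))
          ℝ.:+ W ℝ.:* (s ℝ.:* i ℝ.:+ ℝ.con (+ 1)) ℝ.:* (s ℝ.:* i ℝ.:- ℝ.con (+ 1))) ℝ.refl Z W s i))

-- Contribution of one circle and one pole

module PoleLimits {c ℓ₁ ℓ₂} (Rl : Reals c ℓ₁ ℓ₂) (roots : Complex.DyadicRoots Rl) where
  private
    module ℝ where
      open Reals Rl public
      open OrderedField Rl public
  open Complex Rl
  open ComplexField Rl
  open Separation Rl
  open PoleAlgebra ℂ-commutativeRing
  open PowerSeries Rl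
  open CircleMeans Rl roots
  open CommutativeRing ℂ-commutativeRing using (refl; sym; trans; +-cong; +-congˡ; -‿cong; *-congˡ; *-comm; *-identityʳ; -‿inverseʳ)
  open IntegerSolver ℂ-commutativeRing
  open PowerSums ℂ-commutativeRing using (partialSum; partialSum-cong; mean-cong; mean-+; mean-*ˡ)
  open TwoRoots Rl using (½ᶜ; ½ᶜ+½ᶜ≈1)

  node-offset : ∀ a ρ m k → node roots a ρ m k - a ≈ w (fromℝ ρ) m k
  node-offset a ρ m k = solve 2 (λ a u → a :+ u :- a := u) refl a (w (fromℝ ρ) m k)

  module _ {d} (f : PartialFunction d) {a R ρ} (expansion : ExpandsOn f a R) (0<ρ : ℝ.0# ℝ.< ρ) (ρ<R : ρ ℝ.< R)
           (⊆Dom : ∀ z → z ∈ Circle a ρ → z ∈ PartialFunction.Dom f) where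
    open PartialFunction f

    values : ∀ m → Fin (2 ℕ.^ m) → ℂ
    values m k = fun (node roots a ρ m k) (⊆Dom (node roots a ρ m k) (node∈Circle roots a ρ m k))

    private
      coef = coefficients f expansion 0<ρ ρ<R

      w≼ρ : ∀ m k → w (fromℝ ρ) m k ≼ ρ
      w≼ρ m k = ≼-resp (node-offset a ρ m k) ℝ.refl (circle-≼ 0<ρ (node∈Circle roots a ρ m k))

      values-uniform : UniformLimit (fromℝ ρ) values coef
      values-uniform ε 0<ε =
        let (N , close) = expansion-uniform f expansion 0<ρ ρ<R ε 0<ε in
        N , λ m k → ≼-resp
          {values m k - partialSum coef (suc N) (node roots a ρ m k - a)} {values m k - partialSum coef (suc N) (w (fromℝ ρ) m k)}
          (+-congˡ (-‿cong (partialSum-cong coef (suc N) (node-offset a ρ m k)))) ℝ.refl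
          (close (node roots a ρ m k) (⊆Dom _ (node∈Circle roots a ρ m k)) (circle-≼ 0<ρ (node∈Circle roots a ρ m k)))

    -- `u` stands for 1/(z - μ) at the nodes; the factor w = z - a comes from dz = i(z - a)dθ.
    pole-mean : (∀ m → Fin (2 ℕ.^ m) → ℂ) → ℕ → ℂ
    pole-mean u m = avg (fromℝ ρ) m (λ k → values m k * (w (fromℝ ρ) m k * u m k))

    circle-mean : ∀ (g : ∀ z → z ∈ Circle a ρ → Matrix 2) {i j σ u v} →
                  (∀ m k → g (node roots a ρ m k) (node∈Circle roots a ρ m k) i j ≈ ½ᶜ * (u m k + σ * v m k)) →
                  ∀ m → circleSum roots a ρ (λ z z∈ → fun z (⊆Dom z z∈) ·ᴹ g z z∈) m i j ≈
                        ½ᶜ * pole-mean u m + ½ᶜ * σ * pole-mean v m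
    circle-mean g {i} {j} {σ} {u} {v} eq m = trans
      (mean-cong ½ᶜ+½ᶜ≈1 m (λ k → integrand-split (values m k) (node-offset a ρ m k) (eq m k)))
      (trans (mean-+ ½ᶜ+½ᶜ≈1 m (λ k → ½ᶜ * (values m k * (w (fromℝ ρ) m k * u m k))) (λ k → ½ᶜ * σ * (values m k * (w (fromℝ ρ) m k * v m k))))
        (+-cong (mean-*ˡ ½ᶜ+½ᶜ≈1 m ½ᶜ (λ k → values m k * (w (fromℝ ρ) m k * u m k)))
                (mean-*ˡ ½ᶜ+½ᶜ≈1 m (½ᶜ * σ) (λ k → values m k * (w (fromℝ ρ) m k * v m k)))))

    module _ {μ} (u : ∀ m → Fin (2 ℕ.^ m) → ℂ) (u-inverse : ∀ m k → (node roots a ρ m k - μ) * u m k ≈ 1#) where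

      centre-limit : a ≈ μ → (μ∈ : μ ∈ Dom) →
                     pole-mean u ⇝ fun μ μ∈
      centre-limit a≈μ μ∈ = ⇝-limit-cong
        (trans (coefficient-0 f expansion 0<ρ ρ<R a∈) (fun-cong a∈ μ∈ a≈μ))
        (⇝-sequence-cong
          (λ m → mean-cong ½ᶜ+½ᶜ≈1 m (λ k → sym (trans
            (*-congˡ {values m k} (pole-at-centre (node-offset a ρ m k) a≈μ (u-inverse m k))) (*-identityʳ (values m k)))))
          (avg-limit (fromℝ ρ) {values} {coef} values-uniform))
        where
        a∈ : a ∈ Dom
        a∈ = proj₁ (proj₂ expansion a (≼-< (≼-resp (sym (-‿inverseʳ a)) ℝ.refl ≼-0) (ℝ.<-trans 0<ρ ρ<R)))

      -- `s` is a gap between the circle and `μ`. Nodes are at distance at least `s` from `μ`, so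
      -- |w/(z - μ)| ≤ ρ/s, and |μ - a| > ρ + s makes ρ/(ρ + s) < 1 the ratio of the geometric
      -- series.
      outside-limit : ∀ {s} → ℝ.0# ℝ.< s → (ρ ℝ.+ s) ℝ.* (ρ ℝ.+ s) ℝ.< ∣ a - μ ∣² →
                      pole-mean u ⇝ 0#
      outside-limit {s} 0<s far =
        let 0<ρ+s = ℝ.0<-+ 0<ρ 0<s
            (i , 0<i , [ρ+s]i≈1) = ℝ.0<⇒inverse 0<ρ+s
            (j , 0<j , sj≈1) = ℝ.0<⇒inverse 0<s
            (v , δv≈1) = 0<∣∣²⇒inverse (ℝ.<-trans (ℝ.*-pos 0<ρ+s 0<ρ+s) far′)
        in avg-vanish (fromℝ ρ) {δ = μ - a} {v = v} (trans (*-comm v (μ - a)) δv≈1)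
          (ℝ.*-pos 0<ρ 0<j) (ℝ.*-pos 0<i 0<ρ)
          (ℝ.<-respˡ-≈ (ℝ.*-comm ρ i) (ratio<1 0<i [ρ+s]i≈1
            (ℝ.0<⇒< 0<s (ℝ.solve 2 (λ ρ s → ρ ℝ.:+ s ℝ.:- ρ ℝ.:= s) ℝ.refl ρ s))))
          (λ m k → w (fromℝ ρ) m k * u m k)
          (λ m k → pole-shift (node-offset a ρ m k) (u-inverse m k))
          (λ m k → ≼-* (w≼ρ m k) (inverse-≼ (u-inverse m k) 0<j sj≈1
            (outside-≤ (circle-≼ 0<ρ (node∈Circle roots a ρ m k)) 0<s far)))
          (λ m k → ≼-* (inverse-≼ δv≈1 0<i [ρ+s]i≈1 (ℝ.<⇒≤ far′)) (w≼ρ m k))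
          {values} {coef} values-uniform
        where
        far′ : (ρ ℝ.+ s) ℝ.* (ρ ℝ.+ s) ℝ.< ∣ μ - a ∣²
        far′ = ℝ.<-respʳ-≈ (ℝ.trans (ℝ.sym (∣-∣² (a - μ)))
          (∣∣²-cong { - (a - μ)} {μ - a} (solve 2 (λ a μ → :- (a :- μ) := μ :- a) refl a μ))) far

-- The contour integral of the resolvent

module FunctionalCalculus {c ℓ₁ ℓ₂} (Rl : Reals c ℓ₁ ℓ₂) where
  private
    module ℝ where
      open Reals Rl public
      open OrderedField Rl public
  open Complex Rl
  open ComplexField Rl
  open Separation Rl
  open PoleAlgebra ℂ-commutativeRing
  open TwoRoots Rl
  open RootsOfUnity Rl using (dyadicRoots)
  open CommutativeRing ℂ-commutativeRing using (refl; sym; trans; +-congʳ; +-congˡ; -‿cong; *-congˡ; +-identityˡ)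
  open IntegerSolver ℂ-commutativeRing
  open LinearCombination ℂ-commutativeRing
  open TwoByTwo ℂ-commutativeRing using (Bisymmetric; module BisymmetricProperties; conjugate-diagonal)

  module _ {M t} (bi : Bisymmetric M t) {d} (f : PartialFunction d)
           (f₁ : AnalyticAt f 1#) (f₂ : AnalyticAt f (t + 1#)) where
    open BisymmetricProperties bi
    open PartialFunction f
    private
      H = ⟦ 1# , 1# ∣ 1# , - 1# ⟧
      y₁ = AnalyticAt.value f₁
      y₂ = AnalyticAt.value f₂

    f[M] : Matrix 2
    f[M] = ½ᶜ ·ᴹ (H *ᴹ ⟦ y₁ , 0# ∣ 0# , y₂ ⟧ *ᴹ H)

    module _ (ζ : DyadicRoots) (Γ : Contour f M) where
      open Contour Γ
      open PoleLimits Rl ζ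

      private
        inverse : ∀ i m k → Invertible (node ζ (centre i) (radius i) m k ·ᴹ 1ᴹ -ᴹ M)
        inverse i m k = resolvent i (node ζ (centre i) (radius i) m k) (node∈Circle ζ (centre i) (radius i) m k)

        u₊ u₋ : ∀ i m → Fin (2 ℕ.^ m) → ℂ
        u₊ i m k = resolvent₊ ½ᶜ+½ᶜ≈1 (node ζ (centre i) (radius i) m k) (inverse i m k)
        u₋ i m k = resolvent₋ ½ᶜ+½ᶜ≈1 (node ζ (centre i) (radius i) m k) (inverse i m k)

        mean-at : ∀ i → (∀ m → Fin (2 ℕ.^ m) → ℂ) → ℕ → ℂ
        mean-at i = pole-mean f {centre i} {proj₁ (analytic i)} {radius i} (proj₂ (proj₂ (analytic i))) (0<radius i) (proj₁ (proj₂ (analytic i))) (⊆Dom i)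

      -- Each pole is the centre of one circle `j`. For any other circle, disjointness leaves a gap
      -- as wide as the radius of circle `j`.
      pole-limit : ∀ {μ} (μ∈ : μ ∈ Dom) j → μ ≈ centre j → ∀ i (u : ∀ m → Fin (2 ℕ.^ m) → ℂ) →
                   (∀ m k → (node ζ (centre i) (radius i) m k - μ) * u m k ≈ 1#) →
                   mean-at i u ⇝ pick j (fun μ μ∈) i
      pole-limit {μ} μ∈ j μ≈cⱼ i u u-inverse = decide (i Fin.≟ j)
        where
        decide : Dec (i ≡ j) → mean-at i u ⇝ pick j (fun μ μ∈) i
        decide (yes ≡.refl) = ⇝-limit-cong (sym (pick-same i (fun μ μ∈)))
          (centre-limit f {centre i} {proj₁ (analytic i)} {radius i} (proj₂ (proj₂ (analytic i))) (0<radius i) (proj₁ (proj₂ (analytic i))) (⊆Dom i) {μ} u u-inverse (sym μ≈cⱼ) μ∈)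
        decide (no i≢j) = ⇝-limit-cong (sym (pick-other (fun μ μ∈) i≢j))
          (outside-limit f {centre i} {proj₁ (analytic i)} {radius i} (proj₂ (proj₂ (analytic i))) (0<radius i) (proj₁ (proj₂ (analytic i))) (⊆Dom i) {μ} u u-inverse {radius j} (0<radius j)
            (ℝ.<-respʳ-≈ (∣∣²-cong {centre i - centre j} {centre i - μ} (+-congˡ {centre i} (-‿cong (sym μ≈cⱼ)))) (disjoint i≢j)))

      isContourIntegral : IsContourIntegral f M ζ Γ f[M]
      isContourIntegral j k =
        -- In an arbitrary contour the two eigenvalues may share a circle; as their contributions
        -- are added separately, i₁ = i₂ is covered by the same computation.
        let (i₁ , 1≈c) = Equivalence.to (spectrum 1#) (vec₂ 1# 1# , eigenpair₊ bi)
            (i₂ , t+1≈c) = Equivalence.to (spectrum (t + 1#)) (vec₂ 1# (- 1#) , eigenpair₋ bi)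
            σ = H 1F j * H 1F k
        in ⇝⇒⟶ (⇝-limit-cong
          (trans (sum-two-picks i₁ i₂ ½ᶜ (½ᶜ * σ) y₁ y₂)
            (trans (factor-½ ½ᶜ σ y₁ y₂) (*-congˡ (sym (conjugate-diagonal y₁ y₂ j k)))))
          (⇝-sum size (λ i → ⇝-sequence-cong (λ m → sym (circle-mean f {centre i} {proj₁ (analytic i)} {radius i} (proj₂ (proj₂ (analytic i))) (0<radius i) (proj₁ (proj₂ (analytic i))) (⊆Dom i)
              (λ z z∈ → proj₁ (resolvent i z z∈)) {j} {k} {σ} {u₊ i} {u₋ i}
              (λ m κ → resolvent-decomposition ½ᶜ+½ᶜ≈1 (node ζ (centre i) (radius i) m κ) (inverse i m κ) j k) m))
            (⇝-+
              (⇝-*ˡ ½ᶜ (pole-limit {1#} (AnalyticAt.a∈ f₁) i₁ 1≈c i (u₊ i)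
                (λ m κ → resolvent₊-inverse ½ᶜ+½ᶜ≈1 (node ζ (centre i) (radius i) m κ) (inverse i m κ))))
              (⇝-*ˡ (½ᶜ * σ) (pole-limit {t + 1#} (AnalyticAt.a∈ f₂) i₂ t+1≈c i (u₋ i)
                (λ m κ → resolvent₋-inverse ½ᶜ+½ᶜ≈1 (node ζ (centre i) (radius i) m κ) (inverse i m κ))))))))

    private
      circle-apart : ∀ {a ρ z} → ℝ.0# ℝ.< ρ → z ∈ Circle a ρ → ℝ.0# ℝ.< ∣ z - a ∣²
      circle-apart 0<ρ z∈ = ℝ.<-respʳ-≈ (ℝ.sym z∈) (ℝ.*-pos 0<ρ 0<ρ)

      resolvent-at : ∀ z → ℝ.0# ℝ.< ∣ z - 1# ∣² → ℝ.0# ℝ.< ∣ z - (t + 1#) ∣² → Invertible (z ·ᴹ 1ᴹ -ᴹ M)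
      resolvent-at z p q =
        let (u , e₁) = 0<∣∣²⇒inverse {z - 1#} p
            (v , e₂) = 0<∣∣²⇒inverse {z - (t + 1#)} q
        in resolvent-exists {½ᶜ} ½ᶜ+½ᶜ≈1 z {u} {v} e₁ e₂

      expansion⇒Dom : ∀ {a r ρ} → ExpandsOn f a r → ℝ.0# ℝ.< ρ → ρ ℝ.< r → ∀ z → z ∈ Circle a ρ → z ∈ Dom
      expansion⇒Dom {a} {r} {ρ} expansion 0<ρ ρ<r z z∈ =
        proj₁ (proj₂ expansion z (≼-< {z - a} {ρ} {r} (circle-≼ {a} {ρ} {z} 0<ρ z∈) ρ<r))

      module A₁ = AnalyticAt f₁
      module A₂ = AnalyticAt f₂

    one-circle : t ≈ 0# → Contour f M
    one-circle t≈0 = record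
      { size      = 1
      ; centre    = λ _ → 1#
      ; spectrum  = λ z → mk⇔
          (λ e → 0F , [ (λ z≈1 → z≈1) , (λ z≈t+1 → trans {z} {t + 1#} {1#} z≈t+1 t+1≈1) ]′ (Equivalence.to (eigenvalues bi z) e))
          (λ (_ , z≈1) → Equivalence.from (eigenvalues bi z) (inj₁ z≈1))
      ; radius    = λ _ → ρ
      ; 0<radius  = λ _ → 0<ρ
      ; disjoint  = λ { {0F} {0F} 0≢0 → ⊥-elim (0≢0 ≡.refl) }
      ; analytic  = λ _ → A₁.radius , ρ<r , A₁.expands
      ; ⊆Dom      = λ _ → expansion⇒Dom A₁.expands 0<ρ ρ<r
      ; resolvent = λ _ z z∈ → resolvent-at z (circle-apart {1#} 0<ρ z∈)
          (ℝ.<-respʳ-≈ (∣∣²-cong {z - 1#} {z - (t + 1#)} (+-congˡ {z} (-‿cong {1#} {t + 1#} (sym {t + 1#} {1#} t+1≈1)))) (circle-apart {1#} 0<ρ z∈))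
      }
      where
      t+1≈1 : t + 1# ≈ 1#
      t+1≈1 = trans {t + 1#} {0# + 1#} {1#} (+-congʳ {1#} t≈0) (+-identityˡ 1#)
      ρ = ℝ.halve A₁.radius
      0<ρ = ℝ.0<halve A₁.0<radius
      ρ<r = ℝ.halve< A₁.0<radius

    module _ {ρ} (0<ρ : ℝ.0# ℝ.< ρ) (ρ<r₁ : ρ ℝ.< A₁.radius) (ρ<r₂ : ρ ℝ.< A₂.radius)
             (far : (ρ ℝ.+ ρ) ℝ.* (ρ ℝ.+ ρ) ℝ.< ∣ t ∣²) where
      private
        far₁ : (ρ ℝ.+ ρ) ℝ.* (ρ ℝ.+ ρ) ℝ.< ∣ 1# - (t + 1#) ∣²
        far₁ = ℝ.<-respʳ-≈ (ℝ.trans (ℝ.sym (∣-∣² t)) (∣∣²-cong { - t} {1# - (t + 1#)}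
          (solve 1 (λ t → :- t := con (+ 1) :- (t :+ con (+ 1))) refl t))) far

        far₂ : (ρ ℝ.+ ρ) ℝ.* (ρ ℝ.+ ρ) ℝ.< ∣ (t + 1#) - 1# ∣²
        far₂ = ℝ.<-respʳ-≈ (∣∣²-cong {t} {(t + 1#) - 1#}
          (solve 1 (λ t → t := t :+ con (+ 1) :- con (+ 1)) refl t)) far

        apart : ∀ {a μ z} → z ∈ Circle a ρ → (ρ ℝ.+ ρ) ℝ.* (ρ ℝ.+ ρ) ℝ.< ∣ a - μ ∣² → ℝ.0# ℝ.< ∣ z - μ ∣²
        apart {a} {μ} {z} z∈ p = ℝ.<-≤-trans (ℝ.*-pos 0<ρ 0<ρ)
          (outside-≤ {z} {a} {μ} {ρ} {ρ} (circle-≼ {a} {ρ} {z} 0<ρ z∈) 0<ρ p)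

      -- Both circles have radius less than half of |t|, the distance of the eigenvalues. The same
      -- separation keeps each circle off the other eigenvalue, so the resolvent exists on it.
      two-circles : Contour f M
      two-circles = record
        { size      = 2
        ; centre    = vec₂ 1# (t + 1#)
        ; spectrum  = λ z → mk⇔
            (λ e → [ (λ z≈1 → 0F , z≈1) , (λ z≈t+1 → 1F , z≈t+1) ]′ (Equivalence.to (eigenvalues bi z) e))
            (λ { (0F , z≈1) → Equivalence.from (eigenvalues bi z) (inj₁ z≈1)
               ; (1F , z≈t+1) → Equivalence.from (eigenvalues bi z) (inj₂ z≈t+1) })
        ; radius    = λ _ → ρ
        ; 0<radius  = λ _ → 0<ρ
        ; disjoint  = λ { {0F} {0F} 0≢0 → ⊥-elim (0≢0 ≡.refl) ; {0F} {1F} _ → far₁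
                        ; {1F} {0F} _ → far₂ ; {1F} {1F} 1≢1 → ⊥-elim (1≢1 ≡.refl) }
        ; analytic  = λ { 0F → A₁.radius , ρ<r₁ , A₁.expands ; 1F → A₂.radius , ρ<r₂ , A₂.expands }
        ; ⊆Dom      = λ { 0F → expansion⇒Dom A₁.expands 0<ρ ρ<r₁ ; 1F → expansion⇒Dom A₂.expands 0<ρ ρ<r₂ }
        ; resolvent = λ { 0F z z∈ → resolvent-at z (circle-apart {1#} 0<ρ z∈) (apart {1#} {t + 1#} z∈ far₁)
                        ; 1F z z∈ → resolvent-at z (apart {t + 1#} {1#} z∈ far₂) (circle-apart {t + 1#} 0<ρ z∈) }
        }

    -- The centres must be distinct eigenvalues, so the number of circles depends on whether `t`
    -- vanishes.
    contour : t ≈ 0# ⊎ t # 0# → Contour f M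
    contour = [ one-circle , separate ]′
      where
      -- As ρ < 1, 4ρ² < 4ρ < n; this keeps 2ρ below |t| while comparing only with |t|².
      double-square-< : ∀ {n ρ} → ℝ.0# ℝ.< ρ → ρ ℝ.< ℝ.1# → ρ ℝ.< ℝ.½ᴿ ℝ.* ℝ.½ᴿ ℝ.* n → (ρ ℝ.+ ρ) ℝ.* (ρ ℝ.+ ρ) ℝ.< n
      double-square-< {n} {ρ} 0<ρ ρ<1 ρ<n/4 = ℝ.0<⇒<
        (ℝ.*-pos (ℝ.*-pos ℝ.0<2 ℝ.0<2) (ℝ.0<-+ (ℝ.<⇒0< ρ<n/4) (ℝ.*-pos 0<ρ (ℝ.<⇒0< ρ<1))))
        (ℝ.lin₁ (ℝ.- (n ℝ.* (ℝ.½ᴿ ℝ.+ ℝ.½ᴿ ℝ.+ ℝ.1#))) ℝ.½+½≈1 (ℝ.solve 3 (λ h n ρ →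
          n ℝ.:- (ρ ℝ.:+ ρ) ℝ.:* (ρ ℝ.:+ ρ) ℝ.:=
          ℝ.con (+ 2) ℝ.:* ℝ.con (+ 2) ℝ.:* (h ℝ.:* h ℝ.:* n ℝ.:- ρ ℝ.:+ ρ ℝ.:* (ℝ.con (+ 1) ℝ.:- ρ))
          ℝ.:+ ℝ.:- (n ℝ.:* (h ℝ.:+ h ℝ.:+ ℝ.con (+ 1))) ℝ.:* (h ℝ.:+ h ℝ.:- ℝ.con (+ 1))) ℝ.refl ℝ.½ᴿ n ρ))
      separate : t # 0# → Contour f M
      separate t#0 =
        let (p , 0<p , p<r₁ , p<r₂) = ℝ.positive-below A₁.0<radius A₂.0<radius
            (q , 0<q , q<1 , q<n) = ℝ.positive-below ℝ.0<1 (ℝ.*-pos (ℝ.*-pos ℝ.0<½ ℝ.0<½) (#⇒0<∣∣² t#0))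
            (ρ , 0<ρ , ρ<p , ρ<q) = ℝ.positive-below 0<p 0<q
        in two-circles 0<ρ (ℝ.<-trans ρ<p p<r₁) (ℝ.<-trans ρ<p p<r₂)
             (double-square-< 0<ρ (ℝ.<-trans ρ<q q<1) (ℝ.<-trans ρ<q q<n))

    isMatrixFunction : t ≈ 0# ⊎ t # 0# → IsMatrixFunction f M f[M]
    isMatrixFunction t≟0 = dyadicRoots , contour t≟0 , isContourIntegral

proposition2 :
  ∀ {c ℓ₁ ℓ₂ k l d : Level} (ℝeals : Reals c ℓ₁ ℓ₂) →
  let module ℝ = Reals ℝeals
      open Complex ℝeals
  in
  (K : NumberField k) →
  let F = NumberField.subfield K in
  (A : Matrix 2) →
  (∀ i j → A i j ∈ Member F) →
  A *ᴹ A ∈ SL 2 (Member F) →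
  (det A ≈ 1# ⊎ det A ≈ - 1#) ×
  Invertible A ×
  (∀ (s : Sign) (A⁻¹ : Invertible A) → det A ≈ fromSign s →
    let a₁₂ = A zero (suc zero)
        a₂₁ = A (suc zero) zero
        t = fromSign s * (2# * a₁₂ * a₂₁)
        C = 𝒞 A A⁻¹
        H = ⟦ 1# , 1# ∣ 1# , - 1# ⟧
    in
    (tr C ≈ t + 2#) ×
    (det C ≈ tr C - 1#) ×
    (charPoly C ≈ₚ (t + 1#) ∷ - (t + 2#) ∷ 1# ∷ []) ×
    (∀ z → IsEigenvalue C z ⇔ (z ≈ 1# ⊎ z ≈ t + 1#)) ×
    (let v₁ = vec₂ 1# 1#
         v₂ = vec₂ 1# (- 1#)
     in IsEigenvector C v₁ × IsEigenvector C v₂ × IsBasis F (v₁ ∷ᵛ v₂ ∷ᵛ []ᵛ)) ×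
    ((Σ[ L ∈ Subfield k ] IsSplittingField F (charPoly C) L) ×
     (∀ (L : Subfield l) → IsSplittingField F (charPoly C) L →
      ∀ σ → Group._≈_ (Gal F L) σ (Group.ε (Gal F L)))) ×
    (Σ[ √2 ∈ ℝ ] Σ[ 0<√2 ∈ ℝ.0# ℝ.< √2 ] (√2 ℝ.* √2 ℝ.≈ ℝ.1# ℝ.+ ℝ.1#) ×
      (let P = fromℝ (ℝ.recip √2 0<√2) ·ᴹ H
           D = ⟦ 1# , 0# ∣ 0# , t + 1# ⟧
       in P ≋ P ᵀ × P *ᴹ P ᵀ ≋ 1ᴹ × C ≋ P *ᴹ D *ᴹ P ᵀ)) ×
    (∀ (f : PartialFunction d) (f₁ : AnalyticAt f 1#) (f₂ : AnalyticAt f (t + 1#)) →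
      IsMatrixFunction f C
        (fromℚ ½ ·ᴹ (H *ᴹ ⟦ AnalyticAt.value f₁ , 0# ∣ 0# , AnalyticAt.value f₂ ⟧ *ᴹ H))))
proposition2 ℝeals K A A∈ (_ , det[A²]≈1) = det≈±1 , A-invertible , λ s A⁻¹ det≈s →
    let bi = 𝒞-bisymmetric A A⁻¹ (fromSign-square s) det≈s
        t∈ = *∈ (fromSign∈ s) (*∈ (*∈ (+∈ 1∈ 1∈) (A∈ zero (suc zero))) (A∈ (suc zero) zero))
        -- Decided inside `K`, where `t` has rational coordinates; both the triviality of the Galois
        -- group and the existence of a contour depend on it.
        t≟0 = zero-or-apart K t∈
        2h²≈1 = recip-square 0<√2 √2-square
        module B = BisymmetricProperties bi
    in B.tr-M
     , B.det≈tr-1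
     , B.charPoly-M
     , eigenvalues bi
     , ((_ , eigenpair₊ bi) , (_ , eigenpair₋ bi) , eigenbasis F)
     , ((F , splittingField F bi t∈) , λ L split → gal-trivial F (charPoly (𝒞 A A⁻¹)) L split
         (λ i → charPoly-root∈ F bi t∈ t≟0 (root-of-product (charPoly (𝒞 A A⁻¹)) (IsSplittingField.leading split)
           (IsSplittingField.roots split) (IsSplittingField.splits split) i)))
     , (√2 , 0<√2 , √2-square , B.symmetric 2h²≈1 , B.orthogonal 2h²≈1 , B.diagonalisation 2h²≈1)
     , λ f f₁ f₂ → isMatrixFunction bi f f₁ f₂ t≟0
  where
  open Complex ℝeals
  open TwoRoots ℝeals
  open RootsOfUnity ℝeals
  open FunctionalCalculus ℝeals
  open TwoByTwo (ComplexField.ℂ-commutativeRing ℝeals)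
  open Evaluation (ComplexField.ℂ-commutativeRing ℝeals) using (root-of-product)
  F = NumberField.subfield K
  open Subfield F using (1∈; +∈; *∈; -∈)
  open CommutativeRing (ComplexField.ℂ-commutativeRing ℝeals) using (sym; trans)

  det≈±1 : det A ≈ 1# ⊎ det A ≈ - 1#
  det≈±1 = square-1 {det A} (trans {det A * det A} {det (A *ᴹ A)} {1#} (sym {det (A *ᴹ A)} {det A * det A} (det-square A)) det[A²]≈1)

  A-invertible : Invertible A
  A-invertible = [ invertible A (fromSign-square Sign.+) , invertible A (fromSign-square Sign.-) ]′ det≈±1

  fromSign∈ : ∀ s → fromSign s ∈ Member F
  fromSign∈ Sign.+ = 1∈
  fromSign∈ Sign.- = -∈ 1∈
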